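{- Let $G$ be a (finite, simple) plane graph and let $X = \{ v \in V(G) : d(v) \geq 4 \}$. If the induced subgraph $G[X]$ is a star forest, then $\chi_{\mathrm{fum}}(G) \leq 4$; that is, $G$ has a facial unique-maximum coloring using colors from $\{1,2,3,4\}$.
   Context: All graphs are finite and simple. A plane graph is a planar graph together with a fixed crossing-free drawing in the plane; its faces are the connected regions of the complement of the drawing. A coloring of $G$ is an assignment of positive integers (colors) to the vertices; it is proper if adjacent vertices receive different colors. A facial unique-maximum coloring (FUM-coloring) of a plane graph is a proper coloring by positive integers such that for every face $f$, exactly one vertex incident with $f$ receives the maximum color among the vertices incident with $f$. $\chi_{\mathrm{fum}}(G)$ is the minimum number $k$ such that $G$ has a FUM-coloring using colors from $\{1,\dots,k\}$. $d(v)$ denotes the degree of $v$ in $G$. A star is a connected graph with at most one vertex of degree greater than $1$; a star forest is a graph each of whose connected components is a star (the graph with no vertices counts as a star forest). -}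

module Defs where

open import Data.Nat using (ℕ; zero; suc; _+_; _*_; _≤_; _<_)
open import Data.Fin using (Fin)
open import Data.Fin.Properties using (_≟_)
open import Data.List using (List; length; filter; allFin)
open import Data.Product using (Σ; ∃; ∃-syntax; ∃₂; _×_; _,_)
open import Data.Sum using (_⊎_; inj₁; inj₂)
open import Relation.Binary.PropositionalEquality using (_≡_; _≢_)
open import Relation.Binary.Construct.Closure.ReflexiveTransitive using (Star)
open import Function.Base using (_∘_)
open import Function.Definitions using (Injective)

iter : ∀ {A : Set} → (A → A) → ℕ → A → A
iter f zero x = x
iter f (suc k) x = f (iter f k x)

-- A finite simple graph given by a rotation system (combinatorial map).
-- Vertices: Fin n.  Darts (half-edges): Fin m; every edge uv gives the
-- two darts (u→v) and (v→u), swapped by the fixed-point-free involution α.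
-- tail d is the vertex the dart d leaves from.  σ is the rotation at the
-- vertices: a permutation of the darts that cyclically permutes the darts
-- at each vertex (the clockwise order of edges around the vertex in the
-- drawing).

record RotationSystem : Set where
  field
    n m     : ℕ
    tail    : Fin m → Fin n
    α σ     : Fin m → Fin m
    α-inv   : ∀ d → α (α d) ≡ d
    α-nofix : ∀ d → α d ≢ d
    σ-inj   : Injective _≡_ _≡_ σ
    σ-tail  : ∀ d → tail (σ d) ≡ tail d
    σ-cyc   : ∀ d d′ → tail d ≡ tail d′ → ∃[ k ] iter σ k d ≡ d′
    noLoop  : ∀ d → tail (α d) ≢ tail d
    noMulti : ∀ d d′ → tail d ≡ tail d′ → tail (α d) ≡ tail (α d′) → d ≡ d′

module _ (R : RotationSystem) where
  open RotationSystem R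

  Adj : Fin n → Fin n → Set
  Adj u v = ∃[ d ] (tail d ≡ u × tail (α d) ≡ v)

  Reach : Fin n → Fin n → Set
  Reach = Star Adj

  Isolated : Fin n → Set
  Isolated v = ∀ d → tail d ≢ v

  deg : Fin n → ℕ
  deg v = length (filter (λ d → tail d ≟ v) (allFin m))

  -- facial walks are the orbits of φ = σ ∘ α
  φ : Fin m → Fin m
  φ = σ ∘ α

-- Reachability in the bipartite multigraph with vertex set
-- (components) ⊎ (faces), with one edge  bc b — fc b  for each boundary b.
BipEdge : ∀ {B c F} → (Fin B → Fin c) → (Fin B → Fin F) →
          Fin c ⊎ Fin F → Fin c ⊎ Fin F → Set
BipEdge bc fc x y = ∃[ b ] ((x ≡ inj₁ (bc b) × y ≡ inj₂ (fc b))
                          ⊎ (x ≡ inj₂ (fc b) × y ≡ inj₁ (bc b)))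

-- A plane graph: a (nonempty, finite, simple) graph with a rotation system
-- such that every connected component is embedded in the sphere (genus 0,
-- via Euler's formula summed over components), together with the way the
-- components are nested: every boundary component (a facial walk of a
-- component, or an isolated vertex) lies in exactly one face of the whole
-- drawing, and the bipartite multigraph "components -- faces" (one edge per
-- boundary component) is a tree.  This is the standard combinatorial
-- description of the faces of a (possibly disconnected) plane graph.

record PlaneGraph : Set₁ where
  field
    rot : RotationSystem
  open RotationSystem rot public
  field
    nonempty : 1 ≤ n
    c          : ℕ
    comp       : Fin n → Fin c
    comp-surj  : ∀ i → ∃[ v ] comp v ≡ i
    comp-adj   : ∀ u v → Adj rot u v → comp u ≡ comp v
    comp-conn  : ∀ u v → comp u ≡ comp v → Reach rot u v
    -- boundary components: φ-orbits of darts, and isolated vertices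
    B          : ℕ
    walk       : Fin m → Fin B
    walk-φ     : ∀ d → walk (φ rot d) ≡ walk d
    walk-orbit : ∀ d d′ → walk d ≡ walk d′ → ∃[ k ] iter (φ rot) k d ≡ d′
    isoB       : Fin n → Fin B
    isoB-inj   : ∀ u v → Isolated rot u → Isolated rot v → isoB u ≡ isoB v → u ≡ v
    isoB-walk  : ∀ v d → Isolated rot v → isoB v ≢ walk d
    bnd-surj   : ∀ b → (∃[ d ] walk d ≡ b) ⊎ (∃[ v ] (Isolated rot v × isoB v ≡ b))
    -- every component has genus 0:  Σ_K (V_K - E_K + F_K) = 2c
    euler      : 2 * n + 2 * B ≡ m + 4 * c
    bcomp      : Fin B → Fin c
    bcomp-walk : ∀ d → bcomp (walk d) ≡ comp (tail d)
    bcomp-iso  : ∀ v → Isolated rot v → bcomp (isoB v) ≡ comp v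
    F          : ℕ
    face       : Fin B → Fin F
    tree-count : B + 1 ≡ c + F
    tree-conn  : ∀ x y → Star (BipEdge bcomp face) x y

module _ (G : PlaneGraph) where
  open PlaneGraph G

  Incident : Fin n → Fin F → Set
  Incident v f = (∃[ d ] (tail d ≡ v × face (walk d) ≡ f))
               ⊎ (Isolated rot v × face (isoB v) ≡ f)

  IsFUMColoring : ℕ → (Fin n → ℕ) → Set
  IsFUMColoring k col =
      (∀ v → 1 ≤ col v × col v ≤ k)
    × (∀ u v → Adj rot u v → col u ≢ col v)
    × (∀ f → ∃[ v ] (Incident v f
                     × (∀ w → Incident w f → col w ≤ col v)
                     × (∀ w → Incident w f → col w ≡ col v → w ≡ v)))

  InX : Fin n → Set
  InX v = 4 ≤ deg rot v

  AdjX : Fin n → Fin n → Set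
  AdjX u v = InX u × InX v × Adj rot u v

  BigInX : Fin n → Set
  BigInX v = ∃₂ λ a b → a ≢ b × AdjX v a × AdjX v b

  -- G[X] is a star forest: each component of G[X] is a star, i.e. contains
  -- at most one vertex of degree > 1 in G[X]
  XStarForest : Set
  XStarForest = ∀ u w → InX u → InX w → Star AdjX u w →
                BigInX u → BigInX w → u ≡ w

{-# OPTIONS --safe #-}
module Submission where

-- Colour a vertex 4, delete it, and call the face of the rest containing it
-- white: vertices on the white face may only get 1, 2, 3, but the deleted vertex
-- is the unique maximum of all faces swallowed by the white one.  A white vertex
-- x of degree at most 3 with an inner neighbour r (or of degree 2 with an inner
-- vertex r on its other face) is deleted together with r, which gets 4; x is
-- coloured last, having at most two other neighbours.  At cut vertices and at
-- chords of the white boundary the graph is split, with the shared vertex or edge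
-- precoloured in the second part.  In the remaining case the white boundary is a
-- cycle a b x₁ … xₖ with ab precoloured and all xᵢ of degree at least 4, so k ≤ 3
-- as the big vertices induce a star forest; then a or b (or both) can be deleted
-- with an inner vertex, after precolouring a suitable edge of the path b x₁ … xₖ a.
-- Several components are coloured one after another along the tree of components
-- and faces, each with a 4 on the face it is entered from if that face has none yet.
--
-- Planarity enters through Euler's formula only: counting the classes of vertices
-- and of facial walks while the edges are deleted one by one shows that an edge
-- with the same region on both sides is a bridge of what is left.

open import Defs
open import Data.Nat using (ℕ; zero; suc; _+_; _*_; _∸_; _≤_; _<_; z≤n; s≤s; _≤?_; _<?_)
open import Data.Nat.Properties renaming (_≟_ to _≟ⁿ_)
open import Data.Nat.Solver using (module +-*-Solver)
open import Data.Bool using (Bool; true; false; _∨_; if_then_else_)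
open import Data.Bool.Properties using () renaming (_≟_ to _≟ᵇ_)
open import Data.Fin using (Fin; zero; suc; toℕ; fromℕ<; punchOut; punchIn)
open import Data.Fin.Properties using (_≟_; any?; pigeonhole; injective⇒≤; punchOut-injective; punchInᵢ≢i; punchOut-punchIn; punchOut-cong; toℕ-injective)
open import Data.List using (List; []; _∷_; _++_; length; map; filter; allFin; cartesianProduct; reverseAcc)
open import Data.List.Properties using (length-++; length-map; length-tabulate; ++-identityʳ; filter-accept)
open import Data.List.Membership.Propositional using (_∈_; _∉_)
open import Data.List.Membership.Propositional.Properties
open import Data.List.Relation.Unary.Any using (here; there)
open import Data.List.Relation.Unary.Any.Properties using (reverseAcc⁺)
import Data.List.Relation.Unary.All as All
open import Data.List.Relation.Unary.AllPairs using ([]; _∷_)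
open import Data.List.Relation.Unary.Unique.Propositional using (Unique)
import Data.List.Relation.Unary.Unique.Propositional.Properties as Uniq
open import Data.Product using (Σ; ∃-syntax; ∃₂; _×_; _,_; proj₁; proj₂)
open import Data.Sum using (_⊎_; inj₁; inj₂; [_,_]′)
open import Data.Empty using (⊥; ⊥-elim)
open import Data.Unit using (⊤; tt)
open import Data.Maybe using (Maybe; just; nothing)
open import Function.Base using (_∘_; id; case_of_)
open import Function.Definitions using (Injective)
open import Relation.Nullary using (¬_; Dec; yes; no; does; contradiction)
open import Relation.Nullary.Decidable using (map′; _×-dec_; _⊎-dec_; ¬?; dec-true; dec-false)
open import Relation.Binary.Definitions using (tri<; tri≈; tri>)
open import Relation.Binary.PropositionalEquality using (_≡_; _≢_; refl; sym; trans; cong; cong₂; subst; subst₂; module ≡-Reasoning)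
open import Relation.Binary.Construct.Closure.ReflexiveTransitive using (Star; ε; _◅_; _◅◅_)
import Relation.Binary.Construct.Closure.ReflexiveTransitive as Star

-- Colour 4 stays off the live vertices of the white face, so a white vertex coloured last chooses
-- among three colours and survives two coloured neighbours besides one of colour 4; hence the role
-- of degree 3. Deleting it swallows the gray faces at it, and each of them needs its unique
-- maximum: one inner vertex on all of them supplies the 4. The obstacle is the precoloured edge ab,
-- whose ends cannot be recoloured. If three big vertices x₁ x₂ x₃ close the cycle, neither a nor b
-- is in X, and both have to go with one inner vertex that serves the gray faces of both. This works
-- if one end has only two live neighbours, because its one gray face then lies behind ab and is
-- shared with the other end. That is the origin of the invariant `Slack`. Every precolouring made
-- on the way satisfies it: at a cut vertex or a chord a neighbour is lost to the other part, and on
-- the cycle the new edge has an end in X. The bound k ≤ 3 comes from paths in G[X]: on a path of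
-- four big vertices the two middle ones both have degree above 1.

length-⊆ : ∀ {A : Set} {xs ys : List A} → Unique xs → (∀ {x} → x ∈ xs → x ∈ ys) →
           length xs ≤ length ys
length-⊆ [] sub = z≤n
length-⊆ {xs = x ∷ xs} (x∉ ∷ u) sub with ∈-∃++ (sub (here refl))
... | ys₁ , ys₂ , refl = begin
  suc (length xs)                  ≤⟨ s≤s (length-⊆ u sub′) ⟩
  suc (length (ys₁ ++ ys₂))        ≡⟨ cong suc (length-++ ys₁) ⟩
  suc (length ys₁ + length ys₂)    ≡⟨ sym (+-suc _ _) ⟩
  length ys₁ + suc (length ys₂)    ≡⟨ sym (length-++ ys₁) ⟩
  length (ys₁ ++ x ∷ ys₂)          ∎
  where
  open ≤-Reasoning
  sub′ : ∀ {y} → y ∈ xs → y ∈ ys₁ ++ ys₂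
  sub′ y∈ with ∈-++⁻ ys₁ (sub (there y∈))
  ... | inj₁ p = ∈-++⁺ˡ p
  ... | inj₂ (here refl) = contradiction refl (All.lookup x∉ y∈)
  ... | inj₂ (there p) = ∈-++⁺ʳ ys₁ p

star-sym : ∀ {A : Set} {R : A → A → Set} → (∀ {x y} → R x y → R y x) →
           ∀ {x y} → Star R x y → Star R y x
star-sym s = Star.reverse s

star-cong : ∀ {A B : Set} {R : A → A → Set} (f : A → B) →
            (∀ {x y} → R x y → f x ≡ f y) → ∀ {x y} → Star R x y → f x ≡ f y
star-cong f h ε = refl
star-cong f h (r ◅ rs) = trans (h r) (star-cong f h rs)

star-bind : ∀ {A B : Set} {R : A → A → Set} {S : B → B → Set} (f : A → B) →
            (∀ {x y} → R x y → Star S (f x) (f y)) → ∀ {x y} → Star R x y → Star S (f x) (f y)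
star-bind f h ε = ε
star-bind f h (r ◅ rs) = h r ◅◅ star-bind f h rs

star-exit : ∀ {A : Set} {R : A → A → Set} {P : A → Set} → (∀ x → Dec (P x)) →
            ∀ {x y} → Star R x y → P x → ¬ P y → ∃₂ λ u v → R u v × P u × ¬ P v
star-exit P? ε px ¬py = contradiction px ¬py
star-exit P? (_◅_ {j = j} r rs) px ¬py with P? j
... | yes pj = star-exit P? rs pj ¬py
... | no ¬pj = _ , _ , r , px , ¬pj

-- Counting the classes of the equivalence relation generated by a list of pairs

Linked₂ : ∀ {A : Set} → List (A × A) → A → A → Set
Linked₂ L x y = (x , y) ∈ L ⊎ (y , x) ∈ L

linked₂-sym : ∀ {A : Set} (L : List (A × A)) {x y} → Linked₂ L x y → Linked₂ L y x
linked₂-sym L (inj₁ p) = inj₂ p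
linked₂-sym L (inj₂ p) = inj₁ p

linked₂-there : ∀ {A : Set} {L : List (A × A)} {e x y} → Linked₂ L x y → Linked₂ (e ∷ L) x y
linked₂-there (inj₁ p) = inj₁ (there p)
linked₂-there (inj₂ p) = inj₂ (there p)

record Quotient {N : ℕ} (L : List (Fin N × Fin N)) : Set where
  field
    size     : ℕ
    class    : Fin N → Fin size
    surj     : ∀ i → ∃[ x ] class x ≡ i
    sound    : ∀ {x y} → class x ≡ class y → Star (Linked₂ L) x y
    complete : ∀ {x y} → Star (Linked₂ L) x y → class x ≡ class y

open Quotient

module Merge {N k : ℕ} {L : List (Fin N × Fin N)} (p q : Fin N) (cl : Fin N → Fin (suc k))
  (surj₀ : ∀ i → ∃[ x ] cl x ≡ i) (sound₀ : ∀ {x y} → cl x ≡ cl y → Star (Linked₂ L) x y)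
  (complete₀ : ∀ {x y} → Star (Linked₂ L) x y → cl x ≡ cl y) (p≢q : cl p ≢ cl q) where

  -- The class of `q` is redirected to that of `p`; the index it frees is then removed by
  -- `punchOut`.
  move : Fin (suc k) → Fin (suc k)
  move i with cl q ≟ i
  ... | yes _ = cl p
  ... | no  _ = i

  move≢ : ∀ i → cl q ≢ move i
  move≢ i with cl q ≟ i
  ... | yes _ = λ e → p≢q (sym e)
  ... | no ne = ne

  move-id : ∀ i → cl q ≢ i → move i ≡ i
  move-id i ne with cl q ≟ i
  ... | yes e = contradiction e ne
  ... | no  _ = refl

  move-q : move (cl q) ≡ cl p
  move-q with cl q ≟ cl q
  ... | yes _ = refl
  ... | no ne = contradiction refl ne

  newcl : Fin N → Fin k
  newcl x = punchOut (move≢ (cl x))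

  newcl-cong : ∀ {x y} → move (cl x) ≡ move (cl y) → newcl x ≡ newcl y
  newcl-cong e = punchOut-cong (cl q) e

  p~q : Star (Linked₂ ((p , q) ∷ L)) p q
  p~q = inj₁ (here refl) ◅ ε

  weaken : ∀ {x y} → Star (Linked₂ L) x y → Star (Linked₂ ((p , q) ∷ L)) x y
  weaken = Star.map linked₂-there

  move-sound : ∀ x y → move (cl x) ≡ move (cl y) → Star (Linked₂ ((p , q) ∷ L)) x y
  move-sound x y e with cl q ≟ cl x | cl q ≟ cl y
  ... | yes a | yes b = weaken (sound₀ (trans (sym a) b))
  ... | yes a | no  _ = weaken (sound₀ (sym a)) ◅◅ star-sym (linked₂-sym _) p~q ◅◅ weaken (sound₀ e)
  ... | no  _ | yes b = weaken (sound₀ e) ◅◅ p~q ◅◅ weaken (sound₀ b)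
  ... | no  _ | no  _ = weaken (sound₀ e)

  move-pq : move (cl p) ≡ move (cl q)
  move-pq = trans (move-id (cl p) (λ e → p≢q (sym e))) (sym move-q)

  link : ∀ {x y} → Linked₂ ((p , q) ∷ L) x y → newcl x ≡ newcl y
  link (inj₁ (here refl)) = newcl-cong move-pq
  link (inj₂ (here refl)) = newcl-cong (sym move-pq)
  link (inj₁ (there r)) = newcl-cong (cong move (complete₀ (inj₁ r ◅ ε)))
  link (inj₂ (there r)) = newcl-cong (cong move (complete₀ (inj₂ r ◅ ε)))

  merged : Quotient ((p , q) ∷ L)
  merged .size = k
  merged .class = newcl
  merged .surj i with surj₀ (punchIn (cl q) i)
  ... | x , e = x , trans (punchOut-cong (cl q) {i≢k = punchInᵢ≢i (cl q) i ∘ sym}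
                            (trans (cong move e) (move-id _ (punchInᵢ≢i (cl q) i ∘ sym))))
                          (punchOut-punchIn (cl q))
  merged .sound {x} {y} e = move-sound x y (punchOut-injective (move≢ (cl x)) (move≢ (cl y)) e)
  merged .complete = star-cong newcl link

-- A link within a class changes nothing, and a link between two classes merges just these two.
add-link : ∀ {N} {L : List (Fin N × Fin N)} (e : Fin N × Fin N) → (Q : Quotient L) →
           Σ (Quotient (e ∷ L)) λ Q′ → size Q ≤ suc (size Q′)
add-link (p , q) Q with class Q p ≟ class Q q
... | yes e = record
  { size = size Q ; class = class Q ; surj = surj Q
  ; sound = λ r → Star.map linked₂-there (sound Q r)
  ; complete = star-cong (class Q) λ where
      (inj₁ (here refl)) → e
      (inj₂ (here refl)) → sym e
      (inj₁ (there r)) → complete Q (inj₁ r ◅ ε)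
      (inj₂ (there r)) → complete Q (inj₂ r ◅ ε) } , n≤1+n _
add-link (p , q) record { size = suc k ; class = cl ; surj = s ; sound = so ; complete = co } | no ne =
  Merge.merged p q cl s so co ne , ≤-refl
add-link (p , q) record { size = zero ; class = cl } | no ne = contradiction (cl p) λ ()

quotient : ∀ {N} (L : List (Fin N × Fin N)) → Quotient L
quotient {N} [] = record { size = N ; class = id ; surj = λ i → i , refl
  ; sound = λ { refl → ε } ; complete = star-cong id λ { (inj₁ ()) ; (inj₂ ()) } }
quotient (e ∷ L) = proj₁ (add-link e (quotient L))

classes : ∀ {N} → List (Fin N × Fin N) → ℕ
classes L = size (quotient L)

classes-add : ∀ {N} (e : Fin N × Fin N) L → classes L ≤ suc (classes (e ∷ L))
classes-add e L = proj₂ (add-link e (quotient L))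

surjections-≤ : ∀ {N j k} (f : Fin N → Fin j) (g : Fin N → Fin k) → (∀ i → ∃[ x ] g x ≡ i) →
                (∀ {x y} → f x ≡ f y → g x ≡ g y) → k ≤ j
surjections-≤ f g gs h = injective⇒≤ {f = f ∘ proj₁ ∘ gs}
  (λ {a} {b} e → trans (sym (proj₂ (gs a))) (trans (h e) (proj₂ (gs b))))

-- An implied link adds nothing to the generated relation, so the new classes map onto the old ones.
classes-old : ∀ {N} (p q : Fin N) L → Star (Linked₂ L) p q → classes L ≤ classes ((p , q) ∷ L)
classes-old p q L r = surjections-≤ (class (quotient ((p , q) ∷ L))) (class (quotient L)) (surj (quotient L))
  (λ e → complete (quotient L) (star-bind id old (sound (quotient ((p , q) ∷ L)) e)))
  where
  old : ∀ {x y} → Linked₂ ((p , q) ∷ L) x y → Star (Linked₂ L) x y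
  old (inj₁ (here refl)) = r
  old (inj₂ (here refl)) = star-sym (linked₂-sym L) r
  old (inj₁ (there s)) = inj₁ s ◅ ε
  old (inj₂ (there s)) = inj₂ s ◅ ε

related? : ∀ {N} (L : List (Fin N × Fin N)) x y → Dec (Star (Linked₂ L) x y)
related? L x y = map′ (sound (quotient L)) (complete (quotient L)) (class (quotient L) x ≟ class (quotient L) y)

abstract
  -- The pairs in relation `R` form a finite list whose quotient decides connectivity; symmetry of
  -- `R` makes the undirected quotient faithful.
  star? : ∀ {N} {R : Fin N → Fin N → Set} → (∀ x y → Dec (R x y)) → (∀ {x y} → R x y → R y x) →
          ∀ x y → Dec (Star R x y)
  star? {N} {R} R? R-sym x y = map′ (Star.map to) (Star.map from) (related? L x y)
    where
    pairs : List (Fin N × Fin N)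
    pairs = cartesianProduct (allFin N) (allFin N)
    related : ∀ e → Dec (R (proj₁ e) (proj₂ e))
    related e = R? (proj₁ e) (proj₂ e)
    L : List (Fin N × Fin N)
    L = filter related pairs
    to : ∀ {u v} → Linked₂ L u v → R u v
    to (inj₁ m) = proj₂ (∈-filter⁻ related {xs = pairs} m)
    to (inj₂ m) = R-sym (proj₂ (∈-filter⁻ related {xs = pairs} m))
    from : ∀ {u v} → R u v → Linked₂ L u v
    from {u} {v} r = inj₁ (∈-filter⁺ related (∈-cartesianProduct⁺ (∈-allFin u) (∈-allFin v)) r)

-- Least witnesses and orbits of permutations of a finite set

least-below : ∀ {P : ℕ → Set} → (∀ i → Dec (P i)) → ∀ n →
              (∃[ l ] (P l × (∀ i → i < l → ¬ P i))) ⊎ (∀ i → i < n → ¬ P i)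
least-below P? zero = inj₂ λ i ()
least-below P? (suc n) with least-below P? n
... | inj₁ found = inj₁ found
... | inj₂ none with P? n
...   | yes p = inj₁ (n , p , none)
...   | no ¬p = inj₂ λ i i≤n → case m≤n⇒m<n∨m≡n (≤-pred i≤n) of λ { (inj₁ lt) → none i lt ; (inj₂ refl) → ¬p }

least-witness : ∀ {P : ℕ → Set} → (∀ i → Dec (P i)) → ∀ n → P n → ∃[ l ] (P l × (∀ i → i < l → ¬ P i))
least-witness P? n p with least-below P? (suc n)
... | inj₁ found = found
... | inj₂ none = contradiction p (none n (n<1+n n))

module Orbit {M : ℕ} (f : Fin M → Fin M) (f-inj : Injective _≡_ _≡_ f) where

  iter-+ : ∀ a b x → iter f (a + b) x ≡ iter f a (iter f b x)
  iter-+ zero b x = refl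
  iter-+ (suc a) b x = cong f (iter-+ a b x)

  iter-suc : ∀ k x → iter f (suc k) x ≡ iter f k (f x)
  iter-suc zero x = refl
  iter-suc (suc k) x = cong f (iter-suc k x)

  iter-inj : ∀ k {x y} → iter f k x ≡ iter f k y → x ≡ y
  iter-inj zero e = e
  iter-inj (suc k) e = iter-inj k (f-inj e)

  abstract
    -- Two of the first `M + 1` iterates coincide, and cancelling the common part by injectivity
    -- leaves a positive return time.
    returns : ∀ x → ∃[ p ] iter f (suc p) x ≡ x
    returns x with pigeonhole (n<1+n M) (λ i → iter f (toℕ i) x)
    ... | i , j , i<j , e = toℕ j ∸ suc (toℕ i) ,
      sym (iter-inj (toℕ i) (trans e (trans (cong (λ k → iter f k x) (sym split)) (iter-+ (toℕ i) _ x))))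
      where
      split : toℕ i + suc (toℕ j ∸ suc (toℕ i)) ≡ toℕ j
      split = trans (+-suc _ _) (m+[n∸m]≡n i<j)

    period : ∀ x → ∃[ l ] (iter f (suc l) x ≡ x × (∀ i → i < l → iter f (suc i) x ≢ x))
    period x = least-witness (λ i → iter f (suc i) x ≟ x) (proj₁ (returns x)) (proj₂ (returns x))

  len : Fin M → ℕ
  len x = suc (proj₁ (period x))

  iter-len : ∀ x → iter f (len x) x ≡ x
  iter-len x = proj₁ (proj₂ (period x))

  iter-distinct : ∀ x i j → i < j → j < len x → iter f i x ≢ iter f j x
  iter-distinct x i j i<j j<l e = proj₂ (proj₂ (period x)) (j ∸ suc i)
    (<-≤-trans (∸-monoʳ-< {o = 0} (s≤s z≤n) i<j) (≤-pred j<l))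
    (sym (iter-inj i (trans e (trans (cong (λ k → iter f k x) (sym split)) (iter-+ i _ x)))))
    where
    split : i + suc (j ∸ suc i) ≡ j
    split = trans (+-suc _ _) (m+[n∸m]≡n i<j)

  iter-reduce : ∀ x k → ∃[ i ] (i < len x × iter f k x ≡ iter f i x)
  iter-reduce x zero = 0 , s≤s z≤n , refl
  iter-reduce x (suc k) with iter-reduce x k
  ... | i , i<l , e with m≤n⇒m<n∨m≡n i<l
  ...   | inj₁ lt = suc i , lt , cong f e
  ...   | inj₂ eq = 0 , s≤s z≤n , trans (cong f e) (trans (cong (λ k → iter f k x) eq) (iter-len x))

  trace : ℕ → Fin M → List (Fin M)
  trace zero x = []
  trace (suc k) x = x ∷ trace k (f x)

  ∈-trace⁺ : ∀ k i x → i < k → iter f i x ∈ trace k x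
  ∈-trace⁺ (suc k) zero x _ = here refl
  ∈-trace⁺ (suc k) (suc i) x (s≤s i<k) = there (subst (_∈ trace k (f x)) (sym (iter-suc i x)) (∈-trace⁺ k i (f x) i<k))

  ∈-trace⁻ : ∀ k x {y} → y ∈ trace k x → ∃[ i ] (i < k × iter f i x ≡ y)
  ∈-trace⁻ (suc k) x (here refl) = 0 , s≤s z≤n , refl
  ∈-trace⁻ (suc k) x (there m) with ∈-trace⁻ k (f x) m
  ... | i , i<k , e = suc i , s≤s i<k , trans (iter-suc i x) e

  trace-unique : ∀ k x → (∀ i j → i < j → j < k → iter f i x ≢ iter f j x) → Unique (trace k x)
  trace-unique zero x h = []
  trace-unique (suc k) x h =
    All.tabulate (λ m e → case ∈-trace⁻ k (f x) m of λ { (j , j<k , e′) →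
      h 0 (suc j) (s≤s z≤n) (s≤s j<k) (trans e (sym (trans (iter-suc j x) e′))) })
    ∷ trace-unique k (f x) λ i j i<j j<k e →
        h (suc i) (suc j) (s≤s i<j) (s≤s j<k) (trans (iter-suc i x) (trans e (sym (iter-suc j x))))

  cycle : Fin M → List (Fin M)
  cycle x = trace (len x) x

  cycle-unique : ∀ x → Unique (cycle x)
  cycle-unique x = trace-unique (len x) x (iter-distinct x)

  ∈-cycle : ∀ x k → iter f k x ∈ cycle x
  ∈-cycle x k with iter-reduce x k
  ... | i , i<l , e = subst (_∈ cycle x) (sym e) (∈-trace⁺ (len x) i x i<l)

-- Cardinalities of decidable subsets

count : ∀ {N} → (Fin N → Bool) → ℕ
count {zero} U = 0
count {suc N} U with U zero
... | true  = suc (count (U ∘ suc))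
... | false = count (U ∘ suc)

infix 4 _⊑_
_⊑_ : ∀ {N} → (Fin N → Bool) → (Fin N → Bool) → Set
U ⊑ V = ∀ v → U v ≡ true → V v ≡ true

count-mono : ∀ {N} {U V : Fin N → Bool} → U ⊑ V → count U ≤ count V
count-mono {zero} s = z≤n
count-mono {suc N} {U} {V} s with U zero in u | V zero in v
... | true  | true  = s≤s (count-mono (s ∘ suc))
... | false | true  = m≤n⇒m≤1+n (count-mono (s ∘ suc))
... | false | false = count-mono (s ∘ suc)
... | true  | false = contradiction (trans (sym (s zero u)) v) λ ()

count-strict : ∀ {N} {U V : Fin N → Bool} → U ⊑ V → ∀ v → U v ≡ false → V v ≡ true → count U < count V
count-strict {suc N} {U} {V} s zero p q with U zero | V zero
... | false | true = s≤s (count-mono (s ∘ suc))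
count-strict {suc N} {U} {V} s (suc v) p q with U zero in a | V zero in b
... | true  | true  = s≤s (count-strict (s ∘ suc) v p q)
... | false | true  = m≤n⇒m≤1+n (count-strict (s ∘ suc) v p q)
... | false | false = count-strict (s ∘ suc) v p q
... | true  | false = contradiction (trans (sym (s zero a)) b) λ ()

count-≤ : ∀ {N} (U : Fin N → Bool) → count U ≤ N
count-≤ {zero} U = z≤n
count-≤ {suc N} U with U zero
... | true  = s≤s (count-≤ (U ∘ suc))
... | false = m≤n⇒m≤1+n (count-≤ (U ∘ suc))

count-full : ∀ {N} (U : Fin N → Bool) → N ≤ count U → ∀ v → U v ≡ true
count-full {suc N} U h v with U zero in u
count-full {suc N} U h zero    | true = u
count-full {suc N} U h (suc v) | true = count-full (U ∘ suc) (≤-pred h) v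
count-full {suc N} U h v | false = contradiction (≤-trans h (count-≤ (U ∘ suc))) 1+n≰n

-- Planarity: Euler's formula and the deletion of edges

module Planar (G : PlaneGraph) where
  open PlaneGraph G
  open import Data.List.Membership.DecPropositional (_≟_ {m}) using (_∈?_)

  hd : Fin m → Fin n
  hd d = tail (α d)

  walk-σ : ∀ d → walk (σ d) ≡ walk (α d)
  walk-σ d = trans (cong (walk ∘ σ) (sym (α-inv d))) (walk-φ (α d))

  α-inj : ∀ {d d′} → α d ≡ α d′ → d ≡ d′
  α-inj {d} {d′} e = trans (sym (α-inv d)) (trans (cong α e) (α-inv d′))

  tail-φ : ∀ d → tail (φ rot d) ≡ hd d
  tail-φ d = σ-tail (α d)

  -- Cutting an edge unites the walks on its two sides, keeping it unites its two ends: the links of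
  -- an edge in the dual and in the primal graph.
  faceLinks : List (Fin m) → List (Fin B × Fin B)
  faceLinks = map (λ d → walk d , walk (α d))

  edgeLinks : List (Fin m) → List (Fin n × Fin n)
  edgeLinks = map (λ d → tail d , hd d)

  -- A list stands for a set of edges, each given by either of its darts.
  Of : List (Fin m) → Fin m → Set
  Of L d = d ∈ L ⊎ α d ∈ L

  of-α : ∀ {L d} → Of L d → Of L (α d)
  of-α {L} {d} (inj₁ p) = inj₂ (subst (_∈ L) (sym (α-inv d)) p)
  of-α (inj₂ p) = inj₁ p

  of? : ∀ L d → Dec (Of L d)
  of? L d = (d ∈? L) ⊎-dec (α d ∈? L)

  face-link : ∀ {L d} → Of L d → Linked₂ (faceLinks L) (walk d) (walk (α d))
  face-link (inj₁ p) = inj₁ (∈-map⁺ (λ d → walk d , walk (α d)) p)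
  face-link {L} {d} (inj₂ p) =
    subst (λ w → Linked₂ (faceLinks L) w (walk (α d))) (cong walk (α-inv d))
      (inj₂ (∈-map⁺ (λ d → walk d , walk (α d)) p))

  edge-link : ∀ {L d} → Of L d → Linked₂ (edgeLinks L) (tail d) (hd d)
  edge-link (inj₁ p) = inj₁ (∈-map⁺ (λ d → tail d , hd d) p)
  edge-link {L} {d} (inj₂ p) =
    subst (λ w → Linked₂ (edgeLinks L) w (hd d)) (cong tail (α-inv d))
      (inj₂ (∈-map⁺ (λ d → tail d , hd d) p))

  linked-mono : ∀ {A : Set} (f : Fin m → A × A) {L L′ : List (Fin m)} → (∀ {d} → d ∈ L → d ∈ L′) →
                ∀ {x y} → Linked₂ (map f L) x y → Linked₂ (map f L′) x y
  linked-mono f s (inj₁ p) with ∈-map⁻ f p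
  ... | d , d∈ , refl = inj₁ (∈-map⁺ f (s d∈))
  linked-mono f s (inj₂ p) with ∈-map⁻ f p
  ... | d , d∈ , refl = inj₂ (∈-map⁺ f (s d∈))

  FaceConn : List (Fin m) → Fin B → Fin B → Set
  FaceConn L = Star (Linked₂ (faceLinks L))

  EdgeConn : List (Fin m) → Fin n → Fin n → Set
  EdgeConn L = Star (Linked₂ (edgeLinks L))

  F♯ V♯ : List (Fin m) → ℕ
  F♯ L = classes (faceLinks L)
  V♯ L = classes (edgeLinks L)

  -- Following the boundary of the region to the left of e in the graph without
  -- the edges of T, one comes back to e; so unless αe was met on the way, the
  -- walk connects the ends of e without using e.
  module Bridge (T : List (Fin m)) (e : Fin m) (P : List (Fin m))
                (cover : ∀ d → Of T d ⊎ Of (e ∷ P) d) (e∉T : ¬ Of T e) where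

    turn : Fin m → Fin m
    turn d with of? T d
    ... | yes _ = d
    ... | no  _ = α d

    turn-out : ∀ d → ¬ Of T d → turn d ≡ α d
    turn-out d ¬p with of? T d
    ... | yes p = contradiction p ¬p
    ... | no _ = refl

    turn-inj : ∀ {d d′} → turn d ≡ turn d′ → d ≡ d′
    turn-inj {d} {d′} eq with of? T d | of? T d′
    ... | yes _ | yes _ = eq
    ... | no _  | no _  = α-inj eq
    ... | yes p | no ¬q = contradiction (subst (Of T) (trans (cong α eq) (α-inv d′)) (of-α {d = d} p)) ¬q
    ... | no ¬p | yes q = contradiction (subst (Of T) (trans (cong α (sym eq)) (α-inv d)) (of-α {d = d′} q)) ¬p

    -- The boundary walk of the graph without `T`, with the cut darts visited on the way while the
    -- rotation passes them; being injective, it has closed orbits.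
    ρ : Fin m → Fin m
    ρ d = σ (turn d)

    open Orbit ρ (turn-inj ∘ σ-inj)

    Answer : Set
    Answer = FaceConn T (walk e) (walk (α e)) ⊎ EdgeConn P (tail e) (hd e)

    reverse-edge : EdgeConn P (hd e) (tail e) → Answer
    reverse-edge p = inj₂ (star-sym (linked₂-sym _) p)

    ρ-step : ∀ d → FaceConn T (walk e) (walk d) → EdgeConn P (hd e) (tail d) →
             Answer ⊎ (FaceConn T (walk e) (walk (ρ d)) × EdgeConn P (hd e) (tail (ρ d)))
    ρ-step d f v with of? T d
    ... | yes p = inj₂ (subst (Star _ _) (sym (walk-σ d)) (f ◅◅ (face-link {T} p ◅ ε)) , subst (Star _ _) (sym (σ-tail d)) v)
    ... | no ¬p with cover d
    ...   | inj₁ p = contradiction p ¬p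
    -- The walk is back at `e`, so the ends of `e` are joined without it. In the next case it has
    -- met `α e` instead, and both sides of `e` lie in one region.
    ...   | inj₂ (inj₁ (here refl)) = inj₁ (reverse-edge v)
    ...   | inj₂ (inj₂ (here refl)) = inj₁ (inj₁ (subst (Star _ _) (cong walk (sym (α-inv d))) f))
    ...   | inj₂ (inj₁ (there q)) = inj₂ (subst (Star _ _) (sym (walk-φ d)) f ,
        subst (Star _ _) (sym (σ-tail (α d))) (v ◅◅ (edge-link {P} {d} (inj₁ q) ◅ ε)))
    ...   | inj₂ (inj₂ (there q)) = inj₂ (subst (Star _ _) (sym (walk-φ d)) f ,
        subst (Star _ _) (sym (σ-tail (α d))) (v ◅◅ (edge-link {P} {d} (inj₂ q) ◅ ε)))

    along : ∀ k → Answer ⊎ (FaceConn T (walk e) (walk (iter ρ (suc k) e)) ×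
                            EdgeConn P (hd e) (tail (iter ρ (suc k) e)))
    along zero = inj₂ (subst (Star _ _) (sym (trans (cong (walk ∘ σ) (turn-out e e∉T)) (walk-φ e))) ε ,
                       subst (Star _ _) (sym (trans (cong (tail ∘ σ) (turn-out e e∉T)) (tail-φ e))) ε)
    along (suc k) with along k
    ... | inj₁ a = inj₁ a
    ... | inj₂ (f , v) = ρ-step _ f v

    answer : Answer
    answer with returns e
    ... | p , back with along p
    ...   | inj₁ a = a
    ...   | inj₂ (_ , v) = reverse-edge (subst (Star _ _) (cong tail back) v)

  Cover : List (Fin m) → List (Fin m) → Set
  Cover T P = ∀ d → Of T d ⊎ Of P d

  bridge : ∀ T e P → Cover T (e ∷ P) →
           FaceConn T (walk e) (walk (α e)) ⊎ EdgeConn P (tail e) (hd e)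
  bridge T e P cover with of? T e
  ... | yes p = inj₁ (face-link {T} p ◅ ε)
  ... | no ¬p = Bridge.answer T e P cover ¬p

  -- Moving e from the graph to the cut T joins two regions or splits a component,
  -- but never both.
  move-one : ∀ T e P → Cover T (e ∷ P) → F♯ T + V♯ P ≤ suc (F♯ (e ∷ T) + V♯ (e ∷ P))
  move-one T e P cover with bridge T e P cover
  ... | inj₁ f = subst (F♯ T + V♯ P ≤_) (+-suc _ _) (+-mono-≤ (classes-old _ _ (faceLinks T) f)
      (classes-add _ (edgeLinks P)))
  ... | inj₂ v = +-mono-≤ (classes-add _ (faceLinks T)) (classes-old _ _ (edgeLinks P) v)

  cover-shift : ∀ {T e P} → Cover T (e ∷ P) → Cover (e ∷ T) P
  cover-shift cover d with cover d
  ... | inj₁ (inj₁ p) = inj₁ (inj₁ (there p))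
  ... | inj₁ (inj₂ p) = inj₁ (inj₂ (there p))
  ... | inj₂ (inj₁ (here p)) = inj₁ (inj₁ (here p))
  ... | inj₂ (inj₂ (here p)) = inj₁ (inj₂ (here p))
  ... | inj₂ (inj₁ (there p)) = inj₂ (inj₁ p)
  ... | inj₂ (inj₂ (there p)) = inj₂ (inj₂ p)

  move-arith : ∀ a b c d q f p → a + b ≤ suc (c + d) → c + q ≤ p + (f + b) → a + q ≤ suc (p + (f + d))
  move-arith a b c d q f p h k = +-cancelʳ-≤ (b + c) _ _ (begin
    (a + q) + (b + c)               ≡⟨ solve 4 (λ a q b c → (a :+ q) :+ (b :+ c) := (a :+ b) :+ (c :+ q)) refl a q b c ⟩
    (a + b) + (c + q)               ≤⟨ +-mono-≤ h k ⟩
    suc (c + d) + (p + (f + b))     ≡⟨ solve 5 (λ c d p f b →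
        (con 1 :+ (c :+ d)) :+ (p :+ (f :+ b)) := (con 1 :+ (p :+ (f :+ d))) :+ (b :+ c)) refl c d p f b ⟩
    suc (p + (f + d)) + (b + c)     ∎)
    where
    open ≤-Reasoning
    open +-*-Solver

  -- This sums `move-one` over `R`; the cut grows by `reverseAcc` since the edges are moved head
  -- first.
  move-many : ∀ R T Q → Cover T (R ++ Q) → F♯ T + V♯ Q ≤ length R + (F♯ (reverseAcc T R) + V♯ (R ++ Q))
  move-many [] T Q cover = ≤-refl
  move-many (e ∷ R) T Q cover = move-arith (F♯ T) _ _ _ _ _ (length R) (move-one T e (R ++ Q) cover)
    (move-many R (e ∷ T) Q (cover-shift cover))

  module Total (L : List (Fin m)) (full : ∀ d → Of L d) where

    around : ∀ k d → FaceConn L (walk d) (walk (iter σ k d))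
    around zero d = ε
    around (suc k) d = around k d ◅◅ subst (Star _ _) (sym (walk-σ _)) (face-link {L} (full _) ◅ ε)

    same-tail : ∀ {d d′} → tail d ≡ tail d′ → FaceConn L (walk d) (walk d′)
    same-tail {d} {d′} e with σ-cyc d d′ e
    ... | k , refl = around k d

    along-path : ∀ {u v} → Reach rot u v → ∀ d d′ → tail d ≡ u → tail d′ ≡ v →
                 FaceConn L (walk d) (walk d′)
    along-path ε d d′ p q = same-tail (trans p (sym q))
    along-path ((d₁ , refl , refl) ◅ r) d d′ p q =
      same-tail p ◅◅ (face-link {L} (full d₁) ◅ ε) ◅◅ along-path r (α d₁) d′ refl q

    isolated-stuck : ∀ {u v} → Isolated rot u → Reach rot u v → u ≡ v
    isolated-stuck i ε = refl
    isolated-stuck i ((d , e , _) ◅ _) = contradiction e (i d)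

    -- When every edge is cut, the rotation at a vertex unites all walks through it, and each edge
    -- unites those at its two ends; a component is left with a single region.
    face-total : ∀ {b b′} → bcomp b ≡ bcomp b′ → FaceConn L b b′
    face-total {b} {b′} e with bnd-surj b | bnd-surj b′
    ... | inj₁ (d , refl) | inj₁ (d′ , refl) =
      along-path (comp-conn _ _ (trans (sym (bcomp-walk d)) (trans e (bcomp-walk d′)))) d d′ refl refl
    ... | inj₂ (v , i , refl) | inj₂ (v′ , i′ , refl) =
      subst (λ w → Star _ (isoB v) (isoB w))
        (isolated-stuck i (comp-conn _ _ (trans (sym (bcomp-iso v i)) (trans e (bcomp-iso v′ i′))))) ε
    ... | inj₂ (v , i , refl) | inj₁ (d , refl) =
      contradiction (sym (isolated-stuck i (comp-conn _ _ (trans (sym (bcomp-iso v i)) (trans e (bcomp-walk d)))))) (i d)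
    ... | inj₁ (d , refl) | inj₂ (v , i , refl) =
      contradiction (sym (isolated-stuck i
          (comp-conn _ _ (trans (sym (bcomp-iso v i)) (trans (sym e) (bcomp-walk d)))))) (i d)

    F♯-total : F♯ L ≤ c
    F♯-total = surjections-≤ bcomp (Quotient.class (quotient (faceLinks L))) (Quotient.surj (quotient (faceLinks L)))
      (λ e → Quotient.complete (quotient (faceLinks L)) (face-total e))

    V♯-total : V♯ L ≤ c
    V♯-total = surjections-≤ comp (Quotient.class (quotient (edgeLinks L))) (Quotient.surj (quotient (edgeLinks L)))
      (λ e → Quotient.complete (quotient (edgeLinks L)) (Star.map (λ { (d , refl , refl) → edge-link {L} (full d) })
          (comp-conn _ _ e)))

  -- The dual half of planarity: an edge whose two sides are in one region of the
  -- graph without T is a bridge of the graph without T.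
  no-handle-list : ∀ T e P → Cover T (e ∷ P) → suc (length T + length P) * 2 ≤ m →
    FaceConn T (walk e) (walk (α e)) → ¬ EdgeConn P (tail e) (hd e)
  no-handle-list T e P cover small f v = 1+n≰n (begin
    suc (m + 4 * c)                           ≡⟨ cong suc (sym euler) ⟩
    suc (2 * n + 2 * B)                       ≡⟨ solve 2 (λ n B →
        con 1 :+ (con 2 :* n :+ con 2 :* B) := con 1 :+ con 2 :* (B :+ n)) refl n B ⟩
    suc (2 * (B + n))                         ≤⟨ s≤s (*-monoʳ-≤ 2 total) ⟩
    suc (2 * (t + p + (c + c)))               ≤⟨ n≤1+n _ ⟩
    2 + 2 * (t + p + (c + c))                 ≡⟨ solve 3 (λ t p c →
        con 2 :+ con 2 :* (t :+ p :+ (c :+ c)) := (con 1 :+ (t :+ p)) :* con 2 :+ con 4 :* c) refl t p c ⟩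
    suc (t + p) * 2 + 4 * c                   ≤⟨ +-monoˡ-≤ (4 * c) small ⟩
    m + 4 * c                                 ∎)
    where
    open ≤-Reasoning
    open +-*-Solver
    t p : ℕ
    t = length T
    p = length P
    T′ : List (Fin m)
    T′ = reverseAcc [] T
    to-rev : ∀ {d} → d ∈ T → d ∈ T′
    to-rev q = reverseAcc⁺ [] T (inj₂ q)
    of-map : ∀ {L L′ : List (Fin m)} → (∀ {d} → d ∈ L → d ∈ L′) → ∀ {d} → Of L d → Of L′ d
    of-map s (inj₁ q) = inj₁ (s q)
    of-map s (inj₂ q) = inj₂ (s q)
    full₀ : ∀ d → Of (T ++ e ∷ P) d
    full₀ d with cover d
    ... | inj₁ q = of-map ∈-++⁺ˡ {d} q
    ... | inj₂ q = of-map (∈-++⁺ʳ T) {d} q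
    cover₁ : Cover (e ∷ T′) (P ++ [])
    cover₁ d with cover-shift {T} cover d
    ... | inj₁ q = inj₁ (of-map (λ { (here r) → here r ; (there r) → there (to-rev r) }) {d} q)
    ... | inj₂ q = inj₂ (of-map ∈-++⁺ˡ {d} q)
    full₁ : ∀ d → Of (reverseAcc (e ∷ T′) P) d
    full₁ d with cover₁ d
    ... | inj₁ q = of-map (λ r → reverseAcc⁺ (e ∷ T′) P (inj₁ r)) {d} q
    ... | inj₂ q = of-map (λ r → reverseAcc⁺ (e ∷ T′) P (inj₂ r)) {d} (subst (λ L → Of L d) (++-identityʳ P) q)
    first : B + V♯ (e ∷ P) ≤ t + (F♯ T′ + c)
    first = ≤-trans (move-many T [] (e ∷ P) (λ d → inj₂ (full₀ d)))
                    (+-monoʳ-≤ t (+-monoʳ-≤ (F♯ T′) (Total.V♯-total _ full₀)))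
    second : F♯ (e ∷ T′) + n ≤ p + (c + V♯ P)
    second = ≤-trans (move-many P (e ∷ T′) [] cover₁)
                     (+-monoʳ-≤ p (+-mono-≤ (Total.F♯-total _ full₁) (≤-reflexive (cong V♯ (++-identityʳ P)))))
    old-F : F♯ T′ ≤ F♯ (e ∷ T′)
    old-F = classes-old _ _ (faceLinks T′) (Star.map (linked-mono _ to-rev) f)
    old-V : V♯ P ≤ V♯ (e ∷ P)
    old-V = classes-old _ _ (edgeLinks P) v
    -- If moving `e` neither joined regions nor split a component, the fall from `B` to at most `c`
    -- regions and from `n` to at most `c` vertex classes would be paid for by the other `t + p`
    -- edges. Euler's formula asks for one edge more.
    total : B + n ≤ t + p + (c + c)
    total = +-cancelʳ-≤ (V♯ (e ∷ P) + F♯ (e ∷ T′)) _ _ (begin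
      (B + n) + (V♯ (e ∷ P) + F♯ (e ∷ T′))
        ≡⟨ solve 4 (λ B n v f → (B :+ n) :+ (v :+ f) := (B :+ v) :+ (f :+ n)) refl B n (V♯ (e ∷ P)) (F♯ (e ∷ T′)) ⟩
      (B + V♯ (e ∷ P)) + (F♯ (e ∷ T′) + n)
        ≤⟨ +-mono-≤ first second ⟩
      (t + (F♯ T′ + c)) + (p + (c + V♯ P))
        ≤⟨ +-mono-≤ (+-monoʳ-≤ t (+-monoˡ-≤ c old-F)) (+-monoʳ-≤ p (+-monoʳ-≤ c old-V)) ⟩
      (t + (F♯ (e ∷ T′) + c)) + (p + (c + V♯ (e ∷ P)))
        ≡⟨ solve 5 (λ t p c v f → (t :+ (f :+ c)) :+ (p :+ (c :+ v)) := (t :+ p :+ (c :+ c)) :+ (v :+ f)) refl t p c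
            (V♯ (e ∷ P)) (F♯ (e ∷ T′)) ⟩
      (t + p + (c + c)) + (V♯ (e ∷ P) + F♯ (e ∷ T′)) ∎)

  module NoHandle (T : Fin m → Set) (T? : ∀ d → Dec (T d)) (T-α : ∀ {d} → T d → T (α d)) where

    FaceStep : Fin B → Fin B → Set
    FaceStep b b′ = ∃[ d ] (T d × b ≡ walk d × b′ ≡ walk (α d))

    EdgeStep : Fin m → Fin n → Fin n → Set
    EdgeStep e u v = ∃[ d ] (¬ T d × d ≢ e × α d ≢ e × u ≡ tail d × v ≡ hd d)

    -- Selects one dart of each edge, so that counting darts counts edges.
    Forward : Fin m → Set
    Forward d = toℕ d < toℕ (α d)

    forward-or : ∀ d → Forward d ⊎ Forward (α d)
    forward-or d with <-cmp (toℕ d) (toℕ (α d))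
    ... | tri< lt _ _ = inj₁ lt
    ... | tri≈ _ eq _ = contradiction (sym (toℕ-injective eq)) (α-nofix d)
    ... | tri> _ _ gt = inj₂ (subst (λ x → toℕ (α d) < toℕ x) (sym (α-inv d)) gt)

    not-both : ∀ {d} → Forward d → ¬ Forward (α d)
    not-both {d} p q = <-asym p (subst (λ x → toℕ (α d) < toℕ x) (α-inv d) q)

    forward? : ∀ d → Dec (Forward d)
    forward? d = toℕ d <? toℕ (α d)

    darts fwd : List (Fin m)
    darts = allFin m
    fwd = filter forward? darts

    darts-unique : Unique darts
    darts-unique = Uniq.allFin⁺ m

    fwd-half : length fwd * 2 ≤ m
    fwd-half = begin
      length fwd * 2                       ≡⟨ *-comm (length fwd) 2 ⟩
      length fwd + (length fwd + 0)        ≡⟨ cong (length fwd +_) (trans (+-identityʳ _) (sym (length-map α fwd))) ⟩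
      length fwd + length (map α fwd)      ≡⟨ sym (length-++ fwd) ⟩
      length (fwd ++ map α fwd)            ≤⟨ length-⊆ (Uniq.++⁺ u (Uniq.map⁺ α-inj u) disj) (λ {x} _ → ∈-allFin x) ⟩
      length darts                         ≡⟨ length-tabulate id ⟩
      m                                    ∎
      where
      open ≤-Reasoning
      u : Unique fwd
      u = Uniq.filter⁺ forward? darts-unique
      disj : ∀ {x} → ¬ (x ∈ fwd × x ∈ map α fwd)
      disj (p , q) with ∈-map⁻ α q
      ... | y , y∈ , refl = not-both (proj₂ (∈-filter⁻ forward? {xs = darts} y∈)) (proj₂ (∈-filter⁻ forward? {xs = darts} p))

    module _ (e : Fin m) (e-fwd : Forward e) (e∉T : ¬ T e) where

      cut? : ∀ d → Dec (T d × Forward d)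
      cut? d = T? d ×-dec forward? d

      kept? : ∀ d → Dec ((¬ T d × d ≢ e) × Forward d)
      kept? d = (¬? (T? d) ×-dec ¬? (d ≟ e)) ×-dec forward? d

      cut kept : List (Fin m)
      cut = filter cut? darts
      kept = filter kept? darts

      ∈-cut⁻ : ∀ {d} → d ∈ cut → T d × Forward d
      ∈-cut⁻ p = proj₂ (∈-filter⁻ cut? {xs = darts} p)

      ∈-kept⁻ : ∀ {d} → d ∈ kept → (¬ T d × d ≢ e) × Forward d
      ∈-kept⁻ p = proj₂ (∈-filter⁻ kept? {xs = darts} p)

      sorted : ∀ d → Forward d → d ∈ cut ⊎ d ∈ e ∷ kept
      sorted d f with T? d | d ≟ e
      ... | yes t | _ = inj₁ (∈-filter⁺ cut? (∈-allFin d) (t , f))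
      ... | no ¬t | yes refl = inj₂ (here refl)
      ... | no ¬t | no ne = inj₂ (there (∈-filter⁺ kept? (∈-allFin d) ((¬t , ne) , f)))

      cut-kept-cover : Cover cut (e ∷ kept)
      cut-kept-cover d with forward-or d
      cut-kept-cover d | inj₁ f with sorted d f
      ... | inj₁ p = inj₁ (inj₁ p)
      ... | inj₂ p = inj₂ (inj₁ p)
      cut-kept-cover d | inj₂ f with sorted (α d) f
      ... | inj₁ p = inj₁ (inj₂ p)
      ... | inj₂ p = inj₂ (inj₂ p)

      cut-kept-small : suc (length cut + length kept) * 2 ≤ m
      cut-kept-small = ≤-trans (*-monoˡ-≤ 2 (subst (_≤ length fwd) (cong suc (length-++ cut))
        (length-⊆ (All.tabulate e∉ ∷ Uniq.++⁺ (Uniq.filter⁺ cut? darts-unique) (Uniq.filter⁺ kept? darts-unique)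
                     (λ (p , q) → proj₁ (proj₁ (∈-kept⁻ q)) (proj₁ (∈-cut⁻ p)))) sub))) fwd-half
        where
        e∉ : ∀ {x} → x ∈ cut ++ kept → e ≢ x
        e∉ x∈ refl with ∈-++⁻ cut x∈
        ... | inj₁ p = e∉T (proj₁ (∈-cut⁻ p))
        ... | inj₂ p = proj₂ (proj₁ (∈-kept⁻ p)) refl
        sub : ∀ {x} → x ∈ e ∷ cut ++ kept → x ∈ fwd
        sub (here refl) = ∈-filter⁺ forward? (∈-allFin _) e-fwd
        sub (there x∈) with ∈-++⁻ cut x∈
        ... | inj₁ p = ∈-filter⁺ forward? (∈-allFin _) (proj₂ (∈-cut⁻ p))
        ... | inj₂ p = ∈-filter⁺ forward? (∈-allFin _) (proj₂ (∈-kept⁻ p))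

      of-cut : ∀ {d} → T d → Of cut d
      of-cut {d} t with forward-or d
      ... | inj₁ f = inj₁ (∈-filter⁺ cut? (∈-allFin _) (t , f))
      ... | inj₂ f = inj₂ (∈-filter⁺ cut? (∈-allFin _) (T-α t , f))

      of-kept : ∀ {d} → ¬ T d → d ≢ e → α d ≢ e → Of kept d
      of-kept {d} ¬t ne ne′ with forward-or d
      ... | inj₁ f = inj₁ (∈-filter⁺ kept? (∈-allFin _) ((¬t , ne) , f))
      ... | inj₂ f = inj₂ (∈-filter⁺ kept? (∈-allFin _) (((λ t → ¬t (subst T (α-inv d) (T-α t))) , ne′) , f))

      forward-no-handle : Star FaceStep (walk e) (walk (α e)) → ¬ Star (EdgeStep e) (tail e) (hd e)
      forward-no-handle f v = no-handle-list cut e kept cut-kept-cover cut-kept-small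
        (Star.map (λ { (d , t , refl , refl) → face-link {cut} {d} (of-cut t) }) f)
        (Star.map (λ { (d , ¬t , ne , ne′ , refl , refl) → edge-link {kept} {d} (of-kept ¬t ne ne′) }) v)

    face-step-sym : ∀ {b b′} → FaceStep b b′ → FaceStep b′ b
    face-step-sym (d , t , refl , refl) = α d , T-α t , refl , cong walk (sym (α-inv d))

    edge-step-sym : ∀ {e u v} → EdgeStep e u v → EdgeStep (α e) v u
    edge-step-sym {e} (d , ¬t , ne , ne′ , refl , refl) =
      α d , (λ t → ¬t (subst T (α-inv d) (T-α t))) , (λ q → ne (α-inj q)) ,
      (λ q → ne′ (trans (cong α (trans (sym (α-inv d)) q)) (α-inv e))) , refl , cong tail (sym (α-inv d))

    -- The count works with forward darts, so a backward `e` is exchanged for `α e`.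
    no-handle : ∀ e → ¬ T e → Star FaceStep (walk e) (walk (α e)) → ¬ Star (EdgeStep e) (tail e) (hd e)
    no-handle e e∉T f v with forward-or e
    ... | inj₁ fw = forward-no-handle e fw e∉T f v
    ... | inj₂ fw = forward-no-handle (α e) fw (λ t → e∉T (subst T (α-inv e) (T-α t)))
      (subst (λ x → Star FaceStep (walk (α e)) (walk x)) (sym (α-inv e)) (star-sym face-step-sym f))
      (subst (λ x → Star (EdgeStep (α e)) (hd e) (tail x)) (sym (α-inv e)) (Star.reverse edge-step-sym v))

dec-∪ : ∀ {N} {P : Fin N → Set} → (Fin N → Bool) → (∀ v → Dec (P v)) → Fin N → Bool
dec-∪ U P? v = U v ∨ does (P? v)

module _ {N : ℕ} {P : Fin N → Set} {U : Fin N → Bool} (P? : ∀ v → Dec (P v)) where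

  ∪-true⁻ : ∀ {v} → dec-∪ U P? v ≡ true → U v ≡ true ⊎ P v
  ∪-true⁻ {v} e with U v | P? v
  ... | true  | _     = inj₁ refl
  ... | false | yes p = inj₂ p

  ∪-trueˡ : ∀ {v} → U v ≡ true → dec-∪ U P? v ≡ true
  ∪-trueˡ {v} e rewrite e = refl

  ∪-trueʳ : ∀ {v} → P v → dec-∪ U P? v ≡ true
  ∪-trueʳ {v} p with U v | P? v
  ... | true  | _    = refl
  ... | false | yes _ = refl
  ... | false | no ¬p = contradiction p ¬p

  ∪-false⁻ : ∀ {v} → dec-∪ U P? v ≡ false → U v ≡ false × ¬ P v
  ∪-false⁻ {v} e with U v | P? v
  ... | false | no ¬p = refl , ¬p

  ∪-false⁺ : ∀ {v} → U v ≡ false → ¬ P v → dec-∪ U P? v ≡ false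
  ∪-false⁺ {v} u ¬p with U v | P? v
  ... | false | no _ = refl
  ... | false | yes p = contradiction p ¬p

  ⊑-∪ : U ⊑ dec-∪ U P?
  ⊑-∪ v = ∪-trueˡ

++-middle : ∀ {A : Set} {P : A → Set} (xs : List A) {y ys} → (∀ {x} → x ∈ xs ++ y ∷ ys → P x) →
            (∀ {x} → x ∈ xs → P x) × P y × (∀ {x} → x ∈ ys → P x)
++-middle xs h = (λ p → h (∈-++⁺ˡ p)) , h (∈-++⁺ʳ xs (here refl)) , (λ p → h (∈-++⁺ʳ xs (there p)))

unique-middle : ∀ {A : Set} (xs : List A) {y ys} → Unique (xs ++ y ∷ ys) → y ∉ xs × y ∉ ys
unique-middle [] (a ∷ u) = (λ ()) , λ p → All.lookup a p refl
unique-middle (x ∷ xs) (a ∷ u) with unique-middle xs u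
... | p , q = (λ { (here refl) → All.lookup a (∈-++⁺ʳ xs (here refl)) refl ; (there r) → p r }) , q

unique-++⁻ : ∀ {A : Set} (xs : List A) {ys} → Unique (xs ++ ys) → Unique xs × Unique ys × (∀ {x} → x ∈ xs → x ∉ ys)
unique-++⁻ [] u = [] , u , λ ()
unique-++⁻ (x ∷ xs) (a ∷ u) with unique-++⁻ xs u
... | p , q , r = All.tabulate (λ m → All.lookup a (∈-++⁺ˡ m)) ∷ p , q ,
      λ { (here refl) m → All.lookup a (∈-++⁺ʳ xs m) refl ; (there k) → r k }

-- One component: deleted vertices and the white region

module Component (G : PlaneGraph) (star-forest : XStarForest G) (κ : Fin (PlaneGraph.c G)) (ω : Fin (PlaneGraph.m G))
                 (ω-in : PlaneGraph.comp G (PlaneGraph.tail G ω) ≡ κ) where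
  open PlaneGraph G
  open Planar G
  open import Data.List.Membership.DecPropositional (_≟_ {m}) using (_∈?_)

  VSet : Set
  VSet = Fin n → Bool

  Dead Live : VSet → Fin n → Set
  Dead U v = U v ≡ true
  Live U v = U v ≡ false

  live-or-dead : ∀ U v → Live U v ⊎ Dead U v
  live-or-dead U v with U v
  ... | false = inj₁ refl
  ... | true  = inj₂ refl

  not-both-ld : ∀ {U : VSet} {v} → Live U v → ¬ Dead U v
  not-both-ld l d = contradiction (trans (sym l) d) λ ()

  live-anti : ∀ {U U′ : VSet} → U ⊑ U′ → ∀ {v} → Live U′ v → Live U v
  live-anti {U} {U′} s {v} l with live-or-dead U v
  ... | inj₁ l′ = l′
  ... | inj₂ d = contradiction (s v d) (not-both-ld {U′} l)

  Touch LiveD : VSet → Fin m → Set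
  Touch U d = Dead U (tail d) ⊎ Dead U (hd d)
  LiveD U d = Live U (tail d) × Live U (hd d)

  hd-α : ∀ d → hd (α d) ≡ tail d
  hd-α d = cong tail (α-inv d)

  touch-α : ∀ {U d} → Touch U d → Touch U (α d)
  touch-α {U} {d} (inj₁ t) = inj₂ (subst (Dead U) (sym (hd-α d)) t)
  touch-α (inj₂ t) = inj₁ t

  liveD-α : ∀ {U d} → LiveD U d → LiveD U (α d)
  liveD-α {U} {d} (p , q) = q , subst (Live U) (sym (hd-α d)) p

  touch-or-live : ∀ U d → Touch U d ⊎ LiveD U d
  touch-or-live U d with live-or-dead U (tail d) | live-or-dead U (hd d)
  ... | inj₂ x | _ = inj₁ (inj₁ x)
  ... | inj₁ _ | inj₂ y = inj₁ (inj₂ y)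
  ... | inj₁ x | inj₁ y = inj₂ (x , y)

  abstract
    touch? : ∀ U d → Dec (Touch U d)
    touch? U d = (U (tail d) ≟ᵇ true) ⊎-dec (U (hd d) ≟ᵇ true)

    liveD? : ∀ U d → Dec (LiveD U d)
    liveD? U d = (U (tail d) ≟ᵇ false) ×-dec (U (hd d) ≟ᵇ false)

  not-touch-live : ∀ {U d} → Touch U d → ¬ LiveD U d
  not-touch-live {U} (inj₁ t) (l , _) = not-both-ld {U} l t
  not-touch-live {U} (inj₂ t) (_ , l) = not-both-ld {U} l t

  Step : VSet → Fin B → Fin B → Set
  Step U b b′ = ∃[ d ] (Touch U d × b ≡ walk d × b′ ≡ walk (α d))

  step-sym : ∀ {U b b′} → Step U b b′ → Step U b′ b
  step-sym {U} (d , t , refl , refl) = α d , touch-α {U} t , refl , cong walk (sym (α-inv d))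

  Reg : VSet → Fin B → Fin B → Set
  Reg U = Star (Step U)

  reg-sym : ∀ {U b b′} → Reg U b b′ → Reg U b′ b
  reg-sym {U} = star-sym (step-sym {U})

  -- The white region of U is the face of G − U containing ω.
  White : VSet → Fin m → Set
  White U d = Reg U (walk ω) (walk d)

  abstract
    white? : ∀ U d → Dec (White U d)
    white? U d = star? (λ b b′ → any? λ d → touch? U d ×-dec ((b ≟ walk d) ×-dec (b′ ≟ walk (α d))))
                   (step-sym {U}) (walk ω) (walk d)

  white-walk : ∀ {U d d′} → walk d ≡ walk d′ → White U d → White U d′
  white-walk {U} e w = subst (Reg U (walk ω)) e w

  white-across : ∀ {U d} → Touch U d → White U d → White U (α d)
  white-across t w = w ◅◅ ((_ , t , refl , refl) ◅ ε)

  white-across⁻ : ∀ {U d} → Touch U d → White U (α d) → White U d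
  white-across⁻ {U} {d} t w = white-walk {U} (cong walk (α-inv d)) (white-across {U} (touch-α {U} t) w)

  white-σ : ∀ {U d} → White U (α d) → White U (σ d)
  white-σ {U} {d} = white-walk {U} (sym (walk-σ d))

  white-σ⁻ : ∀ {U d} → White U (σ d) → White U (α d)
  white-σ⁻ {U} {d} = white-walk {U} (walk-σ d)

  white-φ : ∀ {U d} → White U d → White U (φ rot d)
  white-φ {U} {d} = white-walk {U} (sym (walk-φ d))

  touch-mono : ∀ {U U′} → U ⊑ U′ → ∀ {d} → Touch U d → Touch U′ d
  touch-mono s (inj₁ t) = inj₁ (s _ t)
  touch-mono s (inj₂ t) = inj₂ (s _ t)

  reg-mono : ∀ {U U′} → U ⊑ U′ → ∀ {b b′} → Reg U b b′ → Reg U′ b b′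
  reg-mono s = Star.map λ { (d , t , e , e′) → d , touch-mono s t , e , e′ }

  comp-hd : ∀ d → comp (tail d) ≡ comp (hd d)
  comp-hd d = comp-adj _ _ (d , refl , refl)

  comp-walk : ∀ {d d′} → walk d ≡ walk d′ → comp (tail d) ≡ comp (tail d′)
  comp-walk {d} {d′} e = trans (sym (bcomp-walk d)) (trans (cong bcomp e) (bcomp-walk d′))

  -- U is the set of deleted vertices; everything outside the component κ counts
  -- as deleted.  As all dead darts of κ are white, other regions are facial walks.
  record Cfg (U : VSet) : Set where
    field
      outside    : ∀ v → comp v ≢ κ → Dead U v
      dead-white : ∀ d → Dead U (tail d) → comp (tail d) ≡ κ → White U d

    live-in : ∀ {v} → Live U v → comp v ≡ κ
    live-in {v} l with comp v ≟ κ
    ... | yes e = e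
    ... | no ne = contradiction (outside v ne) (not-both-ld {U} l)

    touched-white : ∀ {d} → Touch U d → comp (tail d) ≡ κ → White U d
    touched-white {d} (inj₁ t) e = dead-white d t e
    touched-white {d} (inj₂ t) e = white-across⁻ {U} (inj₂ t) (dead-white (α d) t (trans (sym (comp-hd d)) e))

    live-tail-touched : ∀ {d} → Live U (tail d) → Touch U d → White U d
    live-tail-touched l t = touched-white t (live-in l)

  not-white-live : ∀ {V} → Cfg V → ∀ {d} → comp (tail d) ≡ κ → ¬ White V d → Live V (tail d)
  not-white-live {V} D {d} k ¬w with live-or-dead V (tail d)
  ... | inj₁ x = x
  ... | inj₂ x = contradiction (Cfg.dead-white D d x k) ¬w

  Gray : VSet → Fin m → Set
  Gray U d = ¬ White U d × Live U (tail d)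

  module _ {U : VSet} (C : Cfg U) where
    open Cfg C

    gray-live : ∀ {d} → Gray U d → LiveD U d
    gray-live {d} (¬w , l) with touch-or-live U d
    ... | inj₁ t = contradiction (live-tail-touched l t) ¬w
    ... | inj₂ x = x

    -- A dead vertex on the walk would make the walk white, so all vertices of a gray walk are live.
    gray-walk : ∀ {d d′} → walk d ≡ walk d′ → Gray U d → Gray U d′
    gray-walk e (¬w , l) = ¬w′ , not-white-live C (trans (sym (comp-walk e)) (live-in l)) ¬w′
      where
      ¬w′ = ¬w ∘ white-walk {U} (sym e)

  module _ {U U′ : VSet} (C : Cfg U) (s : U ⊑ U′) where
    open Cfg C

    Reached : Fin B → Set
    Reached b = ∃[ d ] (walk d ≡ b × Live U (tail d) × Dead U′ (tail d))

    reach-step : ∀ {b b′} → Step U′ b b′ → Reg U (walk ω) b ⊎ Reached b → Reg U (walk ω) b′ ⊎ Reached b′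
    reach-step (d , t , refl , refl) h with touch-or-live U d
    reach-step (d , t , refl , refl) (inj₁ w) | inj₁ t′ = inj₁ (white-across {U} t′ w)
    reach-step (d , t , refl , refl) (inj₂ (d₁ , e , l , _)) | inj₁ t′ =
      inj₁ (white-across {U} t′ (touched-white t′ (trans (sym (comp-walk e)) (live-in l))))
    reach-step (d , inj₁ t , refl , refl) h | inj₂ (l , _) =
      inj₂ (σ d , walk-σ d , subst (Live U) (sym (σ-tail d)) l , subst (Dead U′) (sym (σ-tail d)) t)
    reach-step (d , inj₂ t , refl , refl) h | inj₂ (_ , l) = inj₂ (α d , refl , l , t)

    reach-steps : ∀ {b b′} → Star (Step U′) b b′ → Reg U (walk ω) b ⊎ Reached b → Reg U (walk ω) b′ ⊎ Reached b′
    reach-steps ε h = h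
    reach-steps (r ◅ rs) h = reach-steps rs (reach-step r h)

    -- The white region grows only through newly deleted vertices: crossing a newly touched dart
    -- leads to a walk that contains one, while a dart of the component that was touched before is
    -- white already.
    new-white : ∀ {d} → White U′ d → White U d ⊎ Reached (walk d)
    new-white w = reach-steps w (inj₁ ε)

    spread-iter : ∀ k {d} → Dead U′ (tail d) → White U′ d → White U′ (iter σ k d) × Dead U′ (tail (iter σ k d))
    spread-iter zero t w = w , t
    spread-iter (suc k) t w with spread-iter k t w
    ... | w′ , t′ = white-σ {U′} (white-across {U′} (inj₁ t′) w′) , subst (Dead U′) (sym (σ-tail _)) t′

    -- All darts at a deleted vertex are touched, so whiteness passes through its whole rotation.
    spread : ∀ {d d′} → tail d ≡ tail d′ → Dead U′ (tail d) → White U′ d → White U′ d′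
    spread {d} {d′} e t w with σ-cyc d d′ e
    ... | k , refl = proj₁ (spread-iter k t w)

    extend : (∀ v → Live U v → Dead U′ v → ∃[ d ] (tail d ≡ v × White U′ d)) → Cfg U′
    extend rooted .Cfg.outside v ne = s v (outside v ne)
    extend rooted .Cfg.dead-white d t e with live-or-dead U (tail d)
    ... | inj₂ x = reg-mono s (dead-white d x e)
    ... | inj₁ l with rooted (tail d) l t
    ...   | d₀ , e₀ , w = spread e₀ (subst (Dead U′) (sym e₀) t) w

    module _ (frontier : ∀ d → Live U (tail d) → Dead U′ (tail d) → Live U′ (hd d) → White U′ d) where

      -- Follow a path to the root dart as long as its vertices are newly dead. Where this stops,
      -- the old configuration, `frontier` or `ω` itself gives a white dart, and whiteness spreads
      -- back along the path.
      root-path : ∀ {v} → Reach rot v (tail ω) → comp v ≡ κ → Dead U′ v → ∃[ d ] (tail d ≡ v × White U′ d)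
      root-path ε _ _ = ω , refl , ε
      root-path ((d , refl , refl) ◅ r) k t with live-or-dead U (tail d) | live-or-dead U′ (hd d)
      ... | inj₂ x | _ = d , refl , reg-mono s (dead-white d x k)
      ... | inj₁ l | inj₁ l′ = d , refl , frontier d l t l′
      ... | inj₁ l | inj₂ t′ with root-path r (trans (sym (comp-hd d)) k) t′
      ...   | d₁ , e₁ , w = d , refl , white-across⁻ {U′} (inj₁ t) (spread e₁ (subst (Dead U′) (sym e₁) t′) w)

      extend-frontier : Cfg U′
      extend-frontier = extend λ v l t → root-path (comp-conn _ _ (trans (live-in l) (sym ω-in))) (live-in l) t

  -- Rotations of live darts

  -- Consecutive live darts x, y around a vertex: nothing dead in between, or
  -- the white region in between.
  Next : VSet → Fin m → Fin m → Set
  Next U x y = σ x ≡ y ⊎ (White U (α x) × White U y)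

  data Rest (U : VSet) (x : Fin m) : List (Fin m) → Set where
    end  : White U (α x) → Rest U x []
    next : ∀ {y ys} → Next U x y → Rest U y ys → Rest U x (y ∷ ys)

  record Rotation (U : VSet) (w : Fin m) : Set where
    field
      others   : List (Fin m)
      run      : Rest U w others
      unique   : Unique (w ∷ others)
      at       : ∀ {x} → x ∈ w ∷ others → tail x ≡ tail w × LiveD U x
      complete : ∀ {x} → tail x ≡ tail w → LiveD U x → x ∈ w ∷ others

  module _ {U : VSet} (C : Cfg U) where
    open Cfg C
    open Orbit σ σ-inj

    tail-iter : ∀ k d → tail (iter σ k d) ≡ tail d
    tail-iter zero d = refl
    tail-iter (suc k) d = trans (σ-tail _) (tail-iter k d)

    -- A dead dart at a live vertex is white, so wherever dead darts are skipped the sectors next to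
    -- both live neighbours are white: the second form of `Next`.
    rest-build : ∀ k x d → Live U (tail x) → tail d ≡ tail x → Next U x d → White U (iter σ k d) →
                 Rest U x (filter (liveD? U) (trace k d))
    rest-build zero x d l e (inj₁ refl) w = end (white-σ⁻ {U} w)
    rest-build zero x d l e (inj₂ (w′ , _)) w = end w′
    rest-build (suc k) x d l e nx w with liveD? U d
    ... | yes (ld , _) = next nx (rest-build k d (σ d) ld (σ-tail d) (inj₁ refl) (subst (White U) (iter-suc k d) w))
    ... | no ¬ld = rest-build k x (σ d) l (trans (σ-tail d) e) (inj₂ (wx , white-σ {U} (white-across {U} t wd)))
                     (subst (White U) (iter-suc k d) w)
      where
      t : Touch U d
      t with touch-or-live U d
      ... | inj₁ t = t
      ... | inj₂ ld = contradiction ld ¬ld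
      wd : White U d
      wd = live-tail-touched (subst (Live U) (sym e) l) t
      wx : White U (α x)
      wx = case nx of λ { (inj₁ q) → white-σ⁻ {U} (subst (White U) (sym q) wd) ; (inj₂ (w′ , _)) → w′ }

    rotation : ∀ w → LiveD U w → White U w → Rotation U w
    rotation w lw ww = record
      { others = filter (liveD? U) (trace (proj₁ (period w)) (σ w))
      ; run = rest-build (proj₁ (period w)) w (σ w) (proj₁ lw) (σ-tail w) (inj₁ refl)
                (subst (White U) (sym (trans (sym (iter-suc (proj₁ (period w)) w)) (iter-len w))) ww)
      ; unique = subst Unique split (Uniq.filter⁺ (liveD? U) (cycle-unique w))
      ; at = λ x∈ → at′ (subst (_ ∈_) (sym split) x∈)
      ; complete = λ {x} e lx → subst (x ∈_) split (∈-filter⁺ (liveD? U)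
          (case σ-cyc w x (sym e) of λ { (k , refl) → ∈-cycle w k }) lx)
      }
      where
      split : filter (liveD? U) (cycle w) ≡ w ∷ filter (liveD? U) (trace (proj₁ (period w)) (σ w))
      split = filter-accept (liveD? U) lw
      at′ : ∀ {x} → x ∈ filter (liveD? U) (cycle w) → tail x ≡ tail w × LiveD U x
      at′ x∈ with ∈-filter⁻ (liveD? U) {xs = cycle w} x∈
      ... | y∈ , lx with ∈-trace⁻ (len w) w y∈
      ...   | i , _ , refl = tail-iter i w , lx

    first-live : ∀ k d → Live U (tail d) → White U d → LiveD U (iter σ k d) →
                 ∃[ e ] (tail e ≡ tail d × LiveD U e × White U e)
    first-live k d l w lk with touch-or-live U d
    ... | inj₂ ld = d , refl , ld , w
    first-live zero d l w lk | inj₁ t = contradiction lk (not-touch-live {U} t)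
    first-live (suc k) d l w lk | inj₁ t
      with first-live k (σ d) (subst (Live U) (sym (σ-tail d)) l) (white-σ {U} (white-across {U} t w))
          (subst (LiveD U) (iter-suc k d) lk)
    ... | e , q , le , we = e , trans q (σ-tail d) , le , we

    -- Turning on from a white dart, whiteness crosses the dead darts and arrives at the first live
    -- one.
    live-white-at : ∀ {w d} → White U w → tail w ≡ tail d → LiveD U d → ∃[ e ] (tail e ≡ tail d × LiveD U e × White U e)
    live-white-at {w} {d} ww q ld with σ-cyc w d q
    ... | k , refl with first-live k w (subst (Live U) (sym q) (proj₁ ld)) ww ld
    ...   | e , q′ , r = e , trans q′ q , r

    -- The first touched dart on a path to `ω` is white and starts at a live vertex that has a live
    -- dart; if the path has no touched dart, `ω` takes its place.
    live-white-path : ∀ {v} → Reach rot v (tail ω) → ∀ d → tail d ≡ v → LiveD U d → ∃[ e ] (LiveD U e × White U e)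
    live-white-path ε d q ld with live-white-at {ω} ε (sym q) ld
    ... | e , _ , r = e , r
    live-white-path ((d₁ , refl , refl) ◅ p) d q ld with touch-or-live U d₁
    ... | inj₂ l₁ = live-white-path p (α d₁) refl (liveD-α {U} l₁)
    ... | inj₁ t with live-white-at {d₁} (live-tail-touched (subst (Live U) q (proj₁ ld)) t) (sym q) ld
    ...   | e , _ , r = e , r

    live-white : ∀ {d} → LiveD U d → ∃[ e ] (LiveD U e × White U e)
    live-white {d} ld = live-white-path (comp-conn _ _ (trans (live-in (proj₁ ld)) (sym ω-in))) d refl ld

  -- Closed curves through the regions

  -- Chain U b Q b′: crossing the darts of Q in turn leads from region b to region b′.
  data Chain (U : VSet) (b : Fin B) : List (Fin m) → Fin B → Set where
    nil  : ∀ {b′} → Reg U b b′ → Chain U b [] b′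
    cons : ∀ {x xs b′} → Reg U b (walk x) → Chain U (walk (α x)) xs b′ → Chain U b (x ∷ xs) b′

  chain-from : ∀ {U b b₁ xs b′} → Reg U b b₁ → Chain U b₁ xs b′ → Chain U b xs b′
  chain-from r (nil s) = nil (r ◅◅ s)
  chain-from r (cons s ch) = cons (r ◅◅ s) ch

  chain-++ : ∀ {U b xs b₁ ys b′} → Chain U b xs b₁ → Chain U b₁ ys b′ → Chain U b (xs ++ ys) b′
  chain-++ (nil r) ch = chain-from r ch
  chain-++ (cons r c₁) ch = cons r (chain-++ c₁ ch)

  chain-middle : ∀ {U b} xs {y ys b′} → Chain U b (xs ++ y ∷ ys) b′ → Chain U b xs (walk y) × Chain U (walk (α y)) ys b′
  chain-middle [] (cons r ch) = nil r , ch
  chain-middle (x ∷ xs) (cons r ch) with chain-middle xs ch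
  ... | p , q = cons r p , q

  chain-to : ∀ {U b xs b₁ b′} → Chain U b xs b₁ → Reg U b₁ b′ → Chain U b xs b′
  chain-to (nil s) r = nil (s ◅◅ r)
  chain-to (cons s ch) r = cons s (chain-to ch r)

  chain-collapse : ∀ {U} {S : Fin B → Fin B → Set} {b xs b′} → (∀ {x y} → Step U x y → S x y) →
      (∀ {x} → x ∈ xs → S (walk x) (walk (α x))) →
                   Chain U b xs b′ → Star S b b′
  chain-collapse s h (nil r) = Star.map s r
  chain-collapse s h (cons r ch) = Star.map s r ◅◅ (h (here refl) ◅ chain-collapse s (h ∘ there) ch)

  -- Circling a vertex crosses its live edges one after another, and consecutive ones border a
  -- common region.
  rest-chain : ∀ {U x xs} → Rest U x xs → Chain U (walk (α x)) xs (walk ω)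
  rest-chain {U} (end w) = nil (reg-sym {U} w)
  rest-chain {U} {x} (next (inj₁ refl) r) = cons (subst (Reg U _) (sym (walk-σ x)) ε) (rest-chain r)
  rest-chain {U} (next (inj₂ (w , w′)) r) = cons (reg-sym {U} w ◅◅ w′) (rest-chain r)

  Avoid : VSet → List (Fin m) → Fin n → Fin n → Set
  Avoid U Q u v = ∃[ d ] (LiveD U d × d ∉ Q × α d ∉ Q × u ≡ tail d × v ≡ hd d)

  avoid-sym : ∀ {U Q u v} → Avoid U Q u v → Avoid U Q v u
  avoid-sym {U} {Q} (d , l , p , q , refl , refl) = α d , liveD-α {U} l , q , (λ r → p (subst (_∈ Q) (α-inv d) r)) ,
      refl , sym (hd-α d)

  -- A closed curve through the regions separates the two ends of each edge it crosses.
  closed-chain-cuts : ∀ {U} Q → Chain U (walk ω) Q (walk ω) → Unique Q → (∀ {x y} → x ∈ Q → y ∈ Q → α x ≢ y) →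
                      (∀ {x} → x ∈ Q → LiveD U x) → ∀ {q} → q ∈ Q → ¬ Star (Avoid U Q) (tail q) (hd q)
  closed-chain-cuts {U} Q ch uq opp live {q} q∈ path with ∈-∃++ q∈
  ... | xs , ys , refl with chain-middle xs ch | unique-middle xs uq | ++-middle xs (λ {x} → opp {x} {q})
  ...   | before , after | q∉xs , q∉ys | opp-xs , _ , opp-ys =
    NoHandle.no-handle T T? T-α q q-kept
      (star-sym (NoHandle.face-step-sym T T? T-α) (chain-collapse into
          (λ m → _ , inj₂ ((inj₁ (∈-++⁺ˡ m)) , (λ { refl → q∉xs m }) , opp-xs m q∈) , refl , refl) before)
       ◅◅ star-sym (NoHandle.face-step-sym T T? T-α) (chain-collapse into
           (λ m → _ , inj₂ ((inj₁ (∈-++⁺ʳ xs (there m))) , (λ { refl → q∉ys m }) , opp-ys m q∈) , refl , refl) after))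
      (Star.map (λ { (d , l , p , p′ , e , e′) → d ,
          (λ { (inj₁ t) → not-touch-live {U} t l ; (inj₂ (inj₁ r , _)) → p r ; (inj₂ (inj₂ r , _)) → p′ r }) ,
          (λ { refl → p q∈ }) , (λ { refl → p′ q∈ }) , e , e′ }) path)
    where
    -- The cut consists of the touched edges, which makes walks into regions, and of the crossed
    -- edges other than `q`. The curve, opened at `q`, then joins the two sides of `q` within one
    -- region.
    T : Fin m → Set
    T d = Touch U d ⊎ ((d ∈ Q ⊎ α d ∈ Q) × d ≢ q × α d ≢ q)
    T? : ∀ d → Dec (T d)
    T? d = touch? U d ⊎-dec (((d ∈? Q) ⊎-dec (α d ∈? Q)) ×-dec (¬? (d ≟ q) ×-dec ¬? (α d ≟ q)))
    T-α : ∀ {d} → T d → T (α d)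
    T-α (inj₁ t) = inj₁ (touch-α {U} t)
    T-α {d} (inj₂ (m , p , p′)) = inj₂
        ((case m of λ { (inj₁ r) → inj₂ (subst (_∈ Q) (sym (α-inv d)) r) ; (inj₂ r) → inj₁ r }) ,
      p′ , λ e → p (trans (sym (α-inv d)) e))
    q-kept : ¬ T q
    q-kept (inj₁ t) = not-touch-live {U} t (live q∈)
    q-kept (inj₂ (_ , ne , _)) = ne refl
    into : ∀ {b b′} → Step U b b′ → NoHandle.FaceStep T T? T-α b b′
    into (d , t , e , e′) = d , inj₁ t , e , e′

  -- Splitting the graph along a closed curve

  -- Each live edge, live vertex and gray face survives in one of the parts, and the parts share
  -- live vertices only in `K`; so colourings of the parts that agree on `K` can be merged.
  record Split (U : VSet) (K : Fin n → Set) : Set where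
    field
      U₁ U₂  : VSet
      sub₁   : U ⊑ U₁
      sub₂   : U ⊑ U₂
      cfg₁   : Cfg U₁
      cfg₂   : Cfg U₂
      shared : ∀ {v} → Live U₁ v → Live U₂ v → K v
      kept   : ∀ {v} → K v → Live U₁ v × Live U₂ v
      edges  : ∀ {d} → LiveD U d → LiveD U₁ d ⊎ LiveD U₂ d
      verts  : ∀ {v} → Live U v → Live U₁ v ⊎ Live U₂ v
      faces  : ∀ {d} → Gray U d → Gray U₁ d ⊎ Gray U₂ d

  -- Q are the edges from K to side 2, Q′ those to side 1, and E the darts between
  -- vertices of K that face side 2.
  module Cutting {U : VSet} (C : Cfg U) (K : Fin n → Set) (K? : ∀ v → Dec (K v)) (K-live : ∀ {v} → K v → Live U v)
    (v₀ : Fin n) (Q Q′ : List (Fin m)) (E : Fin m → Set)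
    (chQ : Chain U (walk ω) Q (walk ω)) (uQ : Unique Q)
    (liveQ : ∀ {x} → x ∈ Q → LiveD U x) (tailQ : ∀ {x} → x ∈ Q → K (tail x)) (hdQ : ∀ {x} → x ∈ Q → ¬ K (hd x))
    (chQ′ : Chain U (walk ω) Q′ (walk ω))
    (liveQ′ : ∀ {x} → x ∈ Q′ → LiveD U x) (tailQ′ : ∀ {x} → x ∈ Q′ → K (tail x)) (hdQ′ : ∀ {x} → x ∈ Q′ → ¬ K (hd x))
    (disj : ∀ {x} → x ∈ Q′ → x ∉ Q)
    (K-conn : ∀ {v} → K v → Star (Avoid U Q) v₀ v)
    (allK : ∀ {d} → LiveD U d → K (tail d) → ¬ K (hd d) → d ∈ Q ⊎ d ∈ Q′)
    (tailE : ∀ {x} → E x → K (tail x))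
    (turnQ : ∀ {q} → q ∈ Q → ¬ White U (α q) → σ q ∈ Q ⊎ E (σ q))
    (turnE : ∀ {q} → E q → ¬ White U q → σ (α q) ∈ Q ⊎ E (σ (α q)))
    where
    open Cfg C

    -- Side 1 is what `v₀` reaches without crossing the curve. The first part deletes the far side,
    -- the second part the near side except for `K`.
    Near Side₁ Side₂ : Fin n → Set
    Near v = Star (Avoid U Q) v₀ v
    Side₁ v = Live U v × Near v × ¬ K v
    Side₂ v = Live U v × ¬ Near v

    abstract
      near? : ∀ v → Dec (Near v)
      near? v = star? (λ u w → any? λ d →
          liveD? U d ×-dec (¬? (d ∈? Q) ×-dec (¬? (α d ∈? Q) ×-dec ((u ≟ tail d) ×-dec (w ≟ hd d)))))
                      (avoid-sym {U} {Q}) v₀ v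

      side₁? : ∀ v → Dec (Side₁ v)
      side₁? v = (U v ≟ᵇ false) ×-dec (near? v ×-dec ¬? (K? v))

      side₂? : ∀ v → Dec (Side₂ v)
      side₂? v = (U v ≟ᵇ false) ×-dec ¬? (near? v)

    V₁ V₂ : VSet
    V₁ = dec-∪ U side₂?
    V₂ = dec-∪ U side₁?

    oppQ : ∀ {x y} → x ∈ Q → y ∈ Q → α x ≢ y
    oppQ x∈ y∈ e = hdQ x∈ (subst K (cong tail (sym e)) (tailQ y∈))

    -- Planarity is used here: `K` is near, so a near head would join the two ends of a crossed edge
    -- off the curve.
    far-hd : ∀ {q} → q ∈ Q → Side₂ (hd q)
    far-hd q∈ = proj₂ (liveQ q∈) , λ r → closed-chain-cuts Q chQ uQ oppQ liveQ q∈
      (star-sym (avoid-sym {U} {Q}) (K-conn (tailQ q∈)) ◅◅ r)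

    near-hd : ∀ {q} → q ∈ Q′ → Side₁ (hd q)
    near-hd {q} q∈ = proj₂ (liveQ′ q∈) ,
      (K-conn (tailQ′ q∈) ◅◅ ((q , liveQ′ q∈ , disj q∈ , (λ r → hdQ′ q∈ (tailQ r)) , refl , refl) ◅ ε)) , hdQ′ q∈

    leave : ∀ {d} → LiveD U d → Near (tail d) → ¬ Near (hd d) → d ∈ Q
    leave {d} ld p ¬q with d ∈? Q | α d ∈? Q
    ... | yes r | _ = r
    ... | no _ | yes r = contradiction (subst Near (sym (hd-α d)) p) (proj₂ (far-hd r))
    ... | no r | no r′ = contradiction (p ◅◅ ((d , ld , r , r′ , refl , refl) ◅ ε)) ¬q

    dead₁ : ∀ {v} → Live U v → Dead V₁ v → Side₂ v
    dead₁ l t with ∪-true⁻ {U = U} side₂? t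
    ... | inj₁ x = contradiction x (not-both-ld {U} l)
    ... | inj₂ x = x

    dead₂ : ∀ {v} → Live U v → Dead V₂ v → Side₁ v
    dead₂ l t with ∪-true⁻ {U = U} side₁? t
    ... | inj₁ x = contradiction x (not-both-ld {U} l)
    ... | inj₂ x = x

    s₁ : U ⊑ V₁
    s₁ = ⊑-∪ side₂?
    s₂ : U ⊑ V₂
    s₂ = ⊑-∪ side₁?

    live₁-near : ∀ {v} → Live V₁ v → Near v
    live₁-near {v} l with near? v
    ... | yes p = p
    ... | no ¬p = contradiction (proj₁ (∪-false⁻ {U = U} side₂? l) , ¬p) (proj₂ (∪-false⁻ {U = U} side₂? l))

    near-live₁ : ∀ {v} → Live U v → Near v → Live V₁ v
    near-live₁ l p = ∪-false⁺ {U = U} side₂? l (λ x → proj₂ x p)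

    far-live₂ : ∀ {v} → Live U v → ¬ Near v → Live V₂ v
    far-live₂ l p = ∪-false⁺ {U = U} side₁? l (λ x → p (proj₁ (proj₂ x)))

    K-live₂ : ∀ {v} → K v → Live V₂ v
    K-live₂ k = ∪-false⁺ {U = U} side₁? (K-live k) (λ x → proj₂ (proj₂ x) k)

    -- Deleting an end of every crossed edge opens the way along the curve, so the white region
    -- spreads over all regions it visits.
    chain-reach : ∀ {U′ L b} → U ⊑ U′ → (∀ {x} → x ∈ L → Touch U′ x) → Chain U (walk ω) L b → Reg U′ (walk ω) b
    chain-reach {U′} s t ch = chain-collapse (λ { (d , u , e , e′) → d , touch-mono s u , e , e′ })
            (λ m → _ , t m , refl , refl) ch

    chain-white : ∀ {U′} L → U ⊑ U′ → (∀ {x} → x ∈ L → Touch U′ x) → Chain U (walk ω) L (walk ω) →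
                  ∀ {x} → x ∈ L → White U′ x
    chain-white {U′} L s t ch x∈ with ∈-∃++ x∈
    ... | xs , ys , refl = chain-reach {U′} s (λ m → t (∈-++⁺ˡ m)) (proj₁ (chain-middle xs ch))

    touchQ : ∀ {x} → x ∈ Q → Touch V₁ x
    touchQ x∈ = inj₂ (∪-trueʳ {U = U} side₂? (far-hd x∈))

    touchQ′ : ∀ {x} → x ∈ Q′ → Touch V₂ x
    touchQ′ x∈ = inj₂ (∪-trueʳ {U = U} side₁? (near-hd x∈))

    whiteQ : ∀ {x} → x ∈ Q → White V₁ x
    whiteQ = chain-white Q s₁ touchQ chQ

    whiteQ′ : ∀ {x} → x ∈ Q′ → White V₂ x
    whiteQ′ = chain-white Q′ s₂ touchQ′ chQ′

    whiteαQ : ∀ {x} → x ∈ Q → White V₁ (α x)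
    whiteαQ x∈ = white-across {V₁} (touchQ x∈) (whiteQ x∈)

    whiteαQ′ : ∀ {x} → x ∈ Q′ → White V₂ (α x)
    whiteαQ′ x∈ = white-across {V₂} (touchQ′ x∈) (whiteQ′ x∈)

    back : ∀ {d} {U′ : VSet} → White U′ (α (α d)) → White U′ d
    back {d} {U′} = white-walk {U′} (cong walk (α-inv d))

    near-tail : ∀ {d} → Near (tail d) → Near (hd (α d))
    near-tail {d} = subst Near (sym (hd-α d))

    C₁ : Cfg V₁
    C₁ = extend-frontier C s₁ λ d l t l′ →
      back {d} {V₁} (whiteαQ (leave {α d} (liveD-α {U} {d} (l , live-anti {U} {V₁} s₁ l′)) (live₁-near l′)
        (λ p → proj₂ (dead₁ l t) (subst Near (hd-α d) p))))

    C₂ : Cfg V₂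
    C₂ = extend-frontier C s₂ front
      where
      front : ∀ d → Live U (tail d) → Dead V₂ (tail d) → Live V₂ (hd d) → White V₂ d
      front d l t l′ = cross (allK (liveD-α {U} {d} (l , live-anti {U} {V₂} s₂ l′)) K-end (¬K ∘ subst K (hd-α d)))
        where
        lh : Live U (hd d)
        lh = live-anti {U} {V₂} s₂ l′
        near : Near (tail d)
        near = proj₁ (proj₂ (dead₂ l t))
        ¬K : ¬ K (tail d)
        ¬K = proj₂ (proj₂ (dead₂ l t))
        K-end : K (hd d)
        K-end with K? (hd d) | near? (hd d)
        ... | yes k | _ = k
        ... | no ¬k | yes p = contradiction (lh , p , ¬k) (proj₂ (∪-false⁻ {U = U} side₁? l′))
        ... | no _ | no ¬p = contradiction (tailQ (leave (l , lh) near ¬p)) ¬K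
        cross : α d ∈ Q ⊎ α d ∈ Q′ → White V₂ d
        cross (inj₁ r) = contradiction (near-tail {d} near) (proj₂ (far-hd r))
        cross (inj₂ r) = back {d} {V₂} (whiteαQ′ r)

    OnSide₂ : Fin m → Set
    OnSide₂ d = Side₂ (tail d) ⊎ Side₂ (hd d) ⊎ E d

    -- A gray walk that arrives at `K` from side 2 passes on to the next dart of the rotation, which
    -- leads back to side 2 or runs inside `K` facing side 2.
    side-φ : ∀ {d} → Gray U d → OnSide₂ d → OnSide₂ (φ rot d)
    side-φ {d} g (inj₂ (inj₁ x)) = inj₁ (subst Side₂ (sym (tail-φ d)) x)
    side-φ {d} g (inj₂ (inj₂ x)) with turnE x (proj₁ g)
    ... | inj₁ r = inj₂ (inj₁ (far-hd r))
    ... | inj₂ r = inj₂ (inj₂ r)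
    side-φ {d} g (inj₁ x) with near? (hd d)
    ... | no ¬p = inj₁ (subst Side₂ (sym (tail-φ d)) (proj₂ (gray-live C g) , ¬p))
    ... | yes p with turnQ (leave {α d} (liveD-α {U} (gray-live C g)) p (λ q → proj₂ x (subst Near (hd-α d) q)))
                           (proj₁ g ∘ back {d} {U})
    ...   | inj₁ r = inj₂ (inj₁ (far-hd r))
    ...   | inj₂ r = inj₂ (inj₂ r)

    side-iter : ∀ k {d} → Gray U d → OnSide₂ d → OnSide₂ (iter (φ rot) k d) × Gray U (iter (φ rot) k d)
    side-iter zero g x = x , g
    side-iter (suc k) g x with side-iter k g x
    ... | x′ , g′ = side-φ g′ x′ , gray-walk C (sym (walk-φ _)) g′

    no-both : ∀ {d d′} → Gray U d → walk d ≡ walk d′ → Side₂ (tail d) → ¬ Side₁ (tail d′)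
    no-both {d} {d′} g e x (l , p , ¬k) with walk-orbit d d′ e
    ... | k , refl with side-iter k g (inj₁ x)
    ...   | inj₁ y , _ = proj₂ y p
    ...   | inj₂ (inj₁ y) , g′ = ¬k (tailQ (leave (gray-live C g′) p (proj₂ y)))
    ...   | inj₂ (inj₂ y) , _ = ¬k (tailE y)

    -- By `new-white`, a gray face that turned white in both parts would contain a deleted vertex of
    -- each side, but a gray walk that visits side 2 never meets side 1.
    one-side : ∀ {d} → Gray U d → Gray V₁ d ⊎ Gray V₂ d
    one-side {d} g@(¬w , l) with white? V₁ d | white? V₂ d
    ... | no ¬w₁ | _ = inj₁ (¬w₁ , not-white-live C₁ (live-in l) ¬w₁)
    ... | _ | no ¬w₂ = inj₂ (¬w₂ , not-white-live C₂ (live-in l) ¬w₂)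
    ... | yes w₁ | yes w₂ with new-white C s₁ w₁ | new-white C s₂ w₂
    ...   | inj₁ w | _ = contradiction w ¬w
    ...   | inj₂ _ | inj₁ w = contradiction w ¬w
    ...   | inj₂ (d₁ , e₁ , l₁ , t₁) | inj₂ (d₂ , e₂ , l₂ , t₂) =
            contradiction (dead₂ l₂ t₂) (no-both (gray-walk C (sym e₁) g) (trans e₁ (sym e₂)) (dead₁ l₁ t₁))

    split : Split U K
    split = record
      { U₁ = V₁ ; U₂ = V₂ ; sub₁ = s₁ ; sub₂ = s₂ ; cfg₁ = C₁ ; cfg₂ = C₂
      ; shared = λ {v} l₁ l₂ → case K? v of λ
          { (yes k) → k ; (no ¬k) → contradiction (live-anti {U} {V₁} s₁ l₁ , live₁-near l₁ , ¬k)
              (proj₂ (∪-false⁻ {U = U} side₁? l₂)) }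
      ; kept = λ k → near-live₁ (K-live k) (K-conn k) , K-live₂ k
      ; edges = edges
      ; verts = λ {v} l → case near? v of λ { (yes p) → inj₁ (near-live₁ l p) ; (no ¬p) → inj₂ (far-live₂ l ¬p) }
      ; faces = one-side
      }
      where
      edges : ∀ {d} → LiveD U d → LiveD V₁ d ⊎ LiveD V₂ d
      edges {d} ld@(l , l′) with near? (tail d) | near? (hd d)
      ... | yes p | yes q = inj₁ (near-live₁ l p , near-live₁ l′ q)
      ... | no ¬p | no ¬q = inj₂ (far-live₂ l ¬p , far-live₂ l′ ¬q)
      ... | yes p | no ¬q = inj₂ (K-live₂ (tailQ (leave ld p ¬q)) , far-live₂ l′ ¬q)
      ... | no ¬p | yes q = inj₂ (far-live₂ l ¬p ,
              K-live₂ (tailQ (leave {α d} (liveD-α {U} ld) q (λ r → ¬p (subst Near (hd-α d) r)))))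

  rest-before : ∀ {U x z zs} ys → Rest U x (ys ++ z ∷ zs) → ∀ {q} → q ∈ x ∷ ys →
                White U (α q) ⊎ σ q ∈ ys ⊎ σ q ≡ z
  rest-before [] (next (inj₁ e) r) (here refl) = inj₂ (inj₂ e)
  rest-before [] (next (inj₂ (w , _)) r) (here refl) = inj₁ w
  rest-before (y ∷ ys) (next (inj₁ e) r) (here refl) = inj₂ (inj₁ (here e))
  rest-before (y ∷ ys) (next (inj₂ (w , _)) r) (here refl) = inj₁ w
  rest-before (y ∷ ys) (next _ r) (there q∈) with rest-before ys r q∈
  ... | inj₁ w = inj₁ w
  ... | inj₂ (inj₁ p) = inj₂ (inj₁ (there p))
  ... | inj₂ (inj₂ p) = inj₂ (inj₂ p)

  rest-drop : ∀ {U x z zs} ys → Rest U x (ys ++ z ∷ zs) → Rest U z zs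
  rest-drop [] (next _ r) = r
  rest-drop (y ∷ ys) (next _ r) = rest-drop ys r

  rest-succ : ∀ {U x zs} → Rest U x zs → ∀ {q} → q ∈ x ∷ zs → White U (α q) ⊎ σ q ∈ zs
  rest-succ (end w) (here refl) = inj₁ w
  rest-succ (next (inj₁ e) r) (here refl) = inj₂ (here e)
  rest-succ (next (inj₂ (w , _)) r) (here refl) = inj₁ w
  rest-succ (next _ r) (there q∈) with rest-succ r q∈
  ... | inj₁ w = inj₁ w
  ... | inj₂ p = inj₂ (there p)

  not-loop : ∀ {d} → hd d ≢ tail d
  not-loop {d} = noLoop d

  same-edge : ∀ {d d′} → tail d ≡ tail d′ → hd d ≡ hd d′ → d ≡ d′
  same-edge = noMulti _ _

  later : ∀ {x w : Fin m} {xs} → x ∈ w ∷ xs → x ≢ w → x ∈ xs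
  later (here e) ne = contradiction e ne
  later (there p) ne = p

  -- Cut vertices and chords of the white boundary

  record CutVertex (U : VSet) (w w′ : Fin m) : Set where
    field
      split  : Split U (_≡ tail w)
    open Split split public
    field
      live₁  : LiveD U₁ w′
      white₁ : White U₁ w′
      dead₁  : Dead U₁ (hd w)
      live₂  : LiveD U₂ w
      white₂ : White U₂ w
      dead₂  : Dead U₂ (hd w′)

  -- The two white darts divide the rotation into two sectors. A curve around one of them closes up
  -- through the white region and cuts off what hangs on that sector.
  cut-vertex : ∀ {U} → Cfg U → ∀ {w w′} → LiveD U w → LiveD U w′ → White U w → White U w′ →
               tail w ≡ tail w′ → w ≢ w′ → CutVertex U w w′
  cut-vertex {U} C {w} {w′} lw lw′ ww ww′ e ne = go (rotation C w lw ww)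
    where
    go : Rotation U w → CutVertex U w w′
    go record { others = others ; run = run ; unique = unique ; at = at ; complete = complete }
      with ∈-∃++ (later (complete (sym e) lw′) (ne ∘ sym))
    ... | ts , us , refl = record
      { split = Cut.split
      ; live₁ = Cut.near-live₁ (proj₁ lw′) (K-conn (sym e)) ,
          Cut.near-live₁ (proj₂ lw′) (proj₁ (proj₂ (Cut.near-hd (here refl))))
      ; white₁ = reg-mono Cut.s₁ ww′
      ; dead₁ = ∪-trueʳ {U = U} Cut.side₂? (Cut.far-hd (here refl))
      ; live₂ = Cut.K-live₂ refl , Cut.far-live₂ (proj₂ lw) (proj₂ (Cut.far-hd (here refl)))
      ; white₂ = reg-mono Cut.s₂ ww
      ; dead₂ = ∪-trueʳ {U = U} Cut.side₁? (Cut.near-hd (here refl))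
      }
      where
      Q Q′ : List (Fin m)
      Q = w ∷ ts
      Q′ = w′ ∷ us
      halves : Unique Q × Unique Q′ × (∀ {x} → x ∈ Q → x ∉ Q′)
      halves = unique-++⁻ Q unique
      whole : Chain U (walk ω) (Q ++ Q′) (walk ω)
      whole = cons ww (rest-chain run)
      turn : ∀ {q} → q ∈ Q → ¬ White U (α q) → σ q ∈ Q ⊎ ⊥
      turn q∈ ¬w with rest-before ts run q∈
      ... | inj₁ x = contradiction x ¬w
      ... | inj₂ (inj₁ p) = inj₁ (there p)
      ... | inj₂ (inj₂ p) = contradiction (white-σ⁻ {U} (subst (White U) (sym p) ww′)) ¬w
      K-live : ∀ {v} → v ≡ tail w → Live U v
      K-live refl = proj₁ lw
      K-conn : ∀ {v} → v ≡ tail w → Star (Avoid U Q) (tail w) v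
      K-conn refl = ε
      module Cut where
        open Cutting C (_≡ tail w) (_≟ tail w) K-live (tail w) Q Q′ (λ _ → ⊥)
          (chain-to (proj₁ (chain-middle Q whole)) (reg-sym {U} ww′)) (proj₁ halves)
          (λ m → proj₂ (at (∈-++⁺ˡ m))) (λ m → proj₁ (at (∈-++⁺ˡ m)))
              (λ m q → not-loop (trans q (sym (proj₁ (at (∈-++⁺ˡ m))))))
          (cons ww′ (proj₂ (chain-middle Q whole)))
          (λ m → proj₂ (at (∈-++⁺ʳ Q m))) (λ m → proj₁ (at (∈-++⁺ʳ Q m)))
              (λ m q → not-loop (trans q (sym (proj₁ (at (∈-++⁺ʳ Q m))))))
          (λ p q → proj₂ (proj₂ halves) q p)
          K-conn (λ ld q _ → ∈-++⁻ Q (complete q ld)) (λ ()) turn (λ ()) public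

  record Chord (U : VSet) (e : Fin m) : Set where
    field
      split  : Split U (λ v → v ≡ tail e ⊎ v ≡ hd e)
    open Split split public
    field
      white₁ : White U₁ e
      white₂ : White U₂ (α e)
      {x₁ x₂} : Fin m
      dead₁  : tail x₁ ≡ tail e × Dead U₁ (hd x₁)
      dead₂  : tail x₂ ≡ tail e × Dead U₂ (hd x₂)
      live₁  : LiveD U x₁
      live₂  : LiveD U x₂

  -- One curve runs along each side of `e`: from the white region across a sector at `tail e` into
  -- the gray face beside `e`, then across a sector at `hd e` and back.
  chord : ∀ {U} → Cfg U → ∀ {e wa wb} → LiveD U e → ¬ White U e → ¬ White U (α e) →
          tail wa ≡ tail e → LiveD U wa → White U wa → tail wb ≡ hd e → LiveD U wb → White U wb → Chord U e
  chord {U} C {e} {wa} {wb} le ¬we ¬wαe qa la ha qb lb hb = go (rotation C wa la ha) (rotation C wb lb hb)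
    where
    go : Rotation U wa → Rotation U wb → Chord U e
    go Ra Rb with ∈-∃++ (later (Rotation.complete Ra (sym qa) le) (λ { refl → ¬we ha }))
                | ∈-∃++ (later (Rotation.complete Rb (sym qb) (liveD-α {U} le)) (λ { refl → ¬wαe hb }))
    go record { run = runa ; unique = ua ; at = ata ; complete = ca } record
        { run = runb ; unique = ub ; at = atb ; complete = cb }
      | ts , us , refl | zs , ss , refl = finish us refl (rest-drop ts runa)
      where
      T S : List (Fin m)
      T = wa ∷ ts
      S = wb ∷ zs
      K : Fin n → Set
      K v = v ≡ tail e ⊎ v ≡ hd e
      Q Q′ : List (Fin m)
      Q = T ++ ss
      Q′ = S ++ us
      a≢b : ∀ {x} → tail x ≡ tail e → tail x ≢ hd e
      a≢b p q = noLoop e (trans (sym q) p)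
      inT : ∀ {x} → x ∈ T → x ∈ T ++ e ∷ us
      inT = ∈-++⁺ˡ
      inU : ∀ {x} → x ∈ us → x ∈ T ++ e ∷ us
      inU m = ∈-++⁺ʳ T (there m)
      inZ : ∀ {x} → x ∈ S → x ∈ S ++ α e ∷ ss
      inZ = ∈-++⁺ˡ
      inS : ∀ {x} → x ∈ ss → x ∈ S ++ α e ∷ ss
      inS m = ∈-++⁺ʳ S (there m)
      tail-a : ∀ {x} → x ∈ T ++ e ∷ us → tail x ≡ tail e
      tail-a m = trans (proj₁ (ata m)) qa
      tail-b : ∀ {x} → x ∈ S ++ α e ∷ ss → tail x ≡ hd e
      tail-b m = trans (proj₁ (atb m)) qb
      e∉ : e ∉ T × e ∉ us
      e∉ = unique-middle T ua
      αe∉ : α e ∉ S × α e ∉ ss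
      αe∉ = unique-middle S ub
      hd-a : ∀ {x} → tail x ≡ tail e → x ≢ e → ¬ K (hd x)
      hd-a p ne (inj₁ q) = not-loop (trans q (sym p))
      hd-a p ne (inj₂ q) = ne (same-edge p q)
      hd-b : ∀ {x} → tail x ≡ hd e → x ≢ α e → ¬ K (hd x)
      hd-b p ne (inj₂ q) = not-loop (trans q (sym p))
      hd-b p ne (inj₁ q) = ne (same-edge p (trans q (sym (hd-α e))))
      unT : Unique T × Unique (e ∷ us) × (∀ {x} → x ∈ T → x ∉ e ∷ us)
      unT = unique-++⁻ T ua
      unS : Unique S × Unique (α e ∷ ss) × (∀ {x} → x ∈ S → x ∉ α e ∷ ss)
      unS = unique-++⁻ S ub
      wholeA : Chain U (walk ω) (T ++ e ∷ us) (walk ω)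
      wholeA = cons ha (rest-chain runa)
      wholeB : Chain U (walk ω) (S ++ α e ∷ ss) (walk ω)
      wholeB = cons hb (rest-chain runb)
      αα : walk (α (α e)) ≡ walk e
      αα = cong walk (α-inv e)
      chT : Chain U (walk ω) T (walk e)
      chT = proj₁ (chain-middle T wholeA)
      chS : Chain U (walk ω) S (walk (α e))
      chS = proj₁ (chain-middle S wholeB)
      uniq-tail : ∀ {x : Fin m} {xs} → Unique (x ∷ xs) → Unique xs
      uniq-tail (_ ∷ u) = u
      liveQ : ∀ {x} → x ∈ Q → LiveD U x
      liveQ m = [ proj₂ ∘ ata ∘ inT , proj₂ ∘ atb ∘ inS ]′ (∈-++⁻ T m)
      tailQ : ∀ {x} → x ∈ Q → K (tail x)
      tailQ m = [ inj₁ ∘ tail-a ∘ inT , inj₂ ∘ tail-b ∘ inS ]′ (∈-++⁻ T m)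
      hdQ : ∀ {x} → x ∈ Q → ¬ K (hd x)
      hdQ m = [ (λ k → hd-a (tail-a (inT k)) λ { refl → proj₁ e∉ k }) ,
          (λ k → hd-b (tail-b (inS k)) λ { refl → proj₂ αe∉ k }) ]′ (∈-++⁻ T m)
      liveQ′ : ∀ {x} → x ∈ Q′ → LiveD U x
      liveQ′ m = [ proj₂ ∘ atb ∘ inZ , proj₂ ∘ ata ∘ inU ]′ (∈-++⁻ S m)
      tailQ′ : ∀ {x} → x ∈ Q′ → K (tail x)
      tailQ′ m = [ inj₂ ∘ tail-b ∘ inZ , inj₁ ∘ tail-a ∘ inU ]′ (∈-++⁻ S m)
      hdQ′ : ∀ {x} → x ∈ Q′ → ¬ K (hd x)
      hdQ′ m = [ (λ k → hd-b (tail-b (inZ k)) λ { refl → proj₁ αe∉ k }) ,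
          (λ k → hd-a (tail-a (inU k)) λ { refl → proj₂ e∉ k }) ]′ (∈-++⁻ S m)
      disj : ∀ {x} → x ∈ Q′ → x ∉ Q
      disj m m′ with ∈-++⁻ S m | ∈-++⁻ T m′
      ... | inj₁ p | inj₁ q = a≢b (tail-a (inT q)) (tail-b (inZ p))
      ... | inj₁ p | inj₂ q = proj₂ (proj₂ unS) p (there q)
      ... | inj₂ p | inj₁ q = proj₂ (proj₂ unT) q (there p)
      ... | inj₂ p | inj₂ q = a≢b (tail-a (inU p)) (tail-b (inS q))
      K-conn : ∀ {v} → K v → Star (Avoid U Q) (tail e) v
      K-conn (inj₁ refl) = ε
      K-conn (inj₂ refl) = (e , le , (λ r → hdQ r (inj₂ refl)) , (λ r → hdQ r (inj₁ (hd-α e))) , refl , refl) ◅ ε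
      allK : ∀ {d} → LiveD U d → K (tail d) → ¬ K (hd d) → d ∈ Q ⊎ d ∈ Q′
      allK ld (inj₁ p) ¬k with ∈-++⁻ T (ca (trans p (sym qa)) ld)
      ... | inj₁ q = inj₁ (∈-++⁺ˡ q)
      ... | inj₂ (here refl) = contradiction (inj₂ refl) ¬k
      ... | inj₂ (there q) = inj₂ (∈-++⁺ʳ S q)
      allK ld (inj₂ p) ¬k with ∈-++⁻ S (cb (trans p (sym qb)) ld)
      ... | inj₁ q = inj₂ (∈-++⁺ˡ q)
      ... | inj₂ (here refl) = contradiction (inj₁ (hd-α e)) ¬k
      ... | inj₂ (there q) = inj₁ (∈-++⁺ʳ T q)
      turnQ : ∀ {q} → q ∈ Q → ¬ White U (α q) → σ q ∈ Q ⊎ σ q ≡ e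
      turnQ m ¬w with ∈-++⁻ T m
      ... | inj₁ p with rest-before ts runa p
      ...   | inj₁ w = contradiction w ¬w
      ...   | inj₂ (inj₁ r) = inj₁ (∈-++⁺ˡ {xs = T} (there r))
      ...   | inj₂ (inj₂ r) = inj₂ r
      turnQ m ¬w | inj₂ p with rest-succ (rest-drop zs runb) (there p)
      ...   | inj₁ w = contradiction w ¬w
      ...   | inj₂ r = inj₁ (∈-++⁺ʳ T r)
      turnE : ∀ {q} → q ≡ e → ¬ White U q → σ (α q) ∈ Q ⊎ σ (α q) ≡ e
      turnE refl ¬w with rest-succ (rest-drop zs runb) (here refl)
      ... | inj₁ w = contradiction (white-walk {U} αα w) ¬w
      ... | inj₂ r = inj₁ (∈-++⁺ʳ T r)
      K-live : ∀ {v} → K v → Live U v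
      K-live (inj₁ refl) = proj₁ le
      K-live (inj₂ refl) = proj₂ le
      E-tail : ∀ {x} → x ≡ e → K (tail x)
      E-tail refl = inj₁ refl
      module Cut = Cutting C K (λ v → (v ≟ tail e) ⊎-dec (v ≟ hd e)) K-live
          (tail e) Q Q′ (_≡ e)
          (chain-++ chT (subst (λ b → Chain U b ss (walk ω)) αα (proj₂ (chain-middle S wholeB))))
          (Uniq.++⁺ (proj₁ unT) (uniq-tail (proj₁ (proj₂ unS))) (λ (p , q) → a≢b (tail-a (inT p)) (tail-b (inS q))))
          liveQ tailQ hdQ (chain-++ chS (proj₂ (chain-middle T wholeA))) liveQ′ tailQ′ hdQ′ disj K-conn allK
          E-tail turnQ turnE
      finish : ∀ us′ → us′ ≡ us → Rest U e us′ → Chord U e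
      -- Without a live dart after `e` in the rotation, `α e` would be white. The dart found here
      -- supplies the neighbour of `tail e` that is deleted in the second part.
      finish [] _ (end w) = contradiction w ¬wαe
      finish (u ∷ _) refl r = record
        { split = Cut.split
        ; white₁ = Cut.chain-reach Cut.s₁ (λ m → Cut.touchQ (∈-++⁺ˡ m)) chT
        ; white₂ = Cut.chain-reach Cut.s₂ (λ m → Cut.touchQ′ (∈-++⁺ˡ m)) chS
        ; x₁ = wa ; x₂ = u
        ; dead₁ = qa , ∪-trueʳ {U = U} Cut.side₂? (Cut.far-hd (here refl))
        ; dead₂ = tail-a (inU (here refl)) , ∪-trueʳ {U = U} Cut.side₁? (Cut.near-hd (∈-++⁺ʳ S (here refl)))
        ; live₁ = la
        ; live₂ = proj₂ (ata (inU (here refl)))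
        }

  -- Partial colourings and their extension

  UniqueMax : (Fin n → ℕ) → Fin B → Set
  UniqueMax col b = ∃[ d₀ ] (walk d₀ ≡ b × (∀ d → walk d ≡ b →
    col (tail d) ≤ col (tail d₀) × (col (tail d) ≡ col (tail d₀) → tail d ≡ tail d₀)))

  unique-max-cong : ∀ (col col′ : Fin n → ℕ) {b} → (∀ d → walk d ≡ b → col (tail d) ≡ col′ (tail d)) →
                    UniqueMax col b → UniqueMax col′ b
  unique-max-cong col col′ same (d₀ , e , h) = d₀ , e , λ d q →
    subst₂ _≤_ (same d q) (same d₀ e) (proj₁ (h d q)) ,
    λ r → proj₂ (h d q) (trans (same d q) (trans r (sym (same d₀ e))))

  -- Because of `low`, a deleted vertex that gets 4 is the only maximum on every face it has merged
  -- into the white region.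
  record Good (U : VSet) (col : Fin n → ℕ) : Set where
    field
      range  : ∀ v → 1 ≤ col v × col v ≤ 4
      low    : ∀ d → Live U (tail d) → White U d → col (tail d) ≤ 3
      proper : ∀ d → LiveD U d → col (tail d) ≢ col (hd d)
      maxima : ∀ d → Gray U d → UniqueMax col (walk d)
  open Good

  colour-3 : ∀ {U col} → Good U col → ∀ {d} → Live U (tail d) → White U d → 1 ≤ col (tail d) × col (tail d) ≤ 3
  colour-3 g l w = proj₁ (range g _) , low g _ l w

  -- By `new-white` a gray face turns white only if it contains a newly deleted vertex, so all
  -- conditions reduce to conditions at those vertices.
  lift : ∀ {U U′} → Cfg U → Cfg U′ → U ⊑ U′ → ∀ {col col′} → Good U′ col′ →
         (∀ v → Live U′ v → col′ v ≡ col v) → (∀ v → 1 ≤ col v × col v ≤ 4) →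
         (∀ d → Live U (tail d) → Dead U′ (tail d) → White U d → col (tail d) ≤ 3) →
         (∀ d → LiveD U d → Dead U′ (tail d) → col (tail d) ≢ col (hd d)) →
         (∀ d → Gray U d → Dead U′ (tail d) → UniqueMax col (walk d)) → Good U col
  lift {U} {U′} C C′ s {col} {col′} g agree rng low′ proper′ maxima′ = record
    { range = rng ; low = low″ ; proper = proper″ ; maxima = maxima″ }
    where
    low″ : ∀ d → Live U (tail d) → White U d → col (tail d) ≤ 3
    low″ d l w with live-or-dead U′ (tail d)
    ... | inj₁ l′ = subst (_≤ 3) (agree _ l′) (low g d l′ (reg-mono s w))
    ... | inj₂ t = low′ d l t w
    proper″ : ∀ d → LiveD U d → col (tail d) ≢ col (hd d)
    proper″ d ld with touch-or-live U′ d
    ... | inj₁ (inj₁ t) = proper′ d ld t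
    ... | inj₁ (inj₂ t) = λ e → proper′ (α d) (liveD-α {U} ld) t (trans (sym e) (cong col (sym (hd-α d))))
    ... | inj₂ (p , q) = λ e → proper g d (p , q) (trans (agree _ p) (trans e (sym (agree _ q))))
    maxima″ : ∀ d → Gray U d → UniqueMax col (walk d)
    maxima″ d gr with white? U′ d
    ... | yes w with new-white C s w
    ...   | inj₁ w′ = contradiction w′ (proj₁ gr)
    ...   | inj₂ (d₁ , e , _ , t) = subst (UniqueMax col) e (maxima′ d₁ (gray-walk C (sym e) gr) t)
    maxima″ d gr | no ¬w = unique-max-cong col′ col (λ d₁ e → agree _ (proj₂ (gray-walk C′ (sym e) gr′))) (maxima g d gr′)
      where
      gr′ : Gray U′ d
      gr′ = ¬w , not-white-live C′ (Cfg.live-in C (proj₂ gr)) ¬w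

  module Merging {U : VSet} {K : Fin n → Set} (C : Cfg U) (S : Split U K) where
    open Split S

    merge : (Fin n → ℕ) → (Fin n → ℕ) → Fin n → ℕ
    merge col₁ col₂ v = if U₁ v then col₂ v else col₁ v

    merge₁ : ∀ col₁ col₂ {v} → Live U₁ v → col₁ v ≡ merge col₁ col₂ v
    merge₁ col₁ col₂ l rewrite l = refl

    merge₂ : ∀ col₁ col₂ → (∀ v → K v → col₁ v ≡ col₂ v) → ∀ {v} → Live U₂ v → col₂ v ≡ merge col₁ col₂ v
    merge₂ col₁ col₂ agree {v} l with live-or-dead U₁ v
    ... | inj₁ l₁ = trans (sym (agree v (shared l₁ l))) (merge₁ col₁ col₂ l₁)
    ... | inj₂ t rewrite t = refl

    merged-good : ∀ {col₁ col₂} → Good U₁ col₁ → Good U₂ col₂ → (∀ v → K v → col₁ v ≡ col₂ v) → Good U (merge col₁ col₂)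
    merged-good {col₁} {col₂} g₁ g₂ agree = record { range = rng ; low = lo ; proper = pr ; maxima = mx }
      where
      col : Fin n → ℕ
      col = merge col₁ col₂
      m₁ : ∀ {v} → Live U₁ v → col₁ v ≡ col v
      m₁ = merge₁ col₁ col₂
      m₂ : ∀ {v} → Live U₂ v → col₂ v ≡ col v
      m₂ = merge₂ col₁ col₂ agree
      rng : ∀ v → 1 ≤ col v × col v ≤ 4
      rng v with U₁ v
      ... | true = range g₂ v
      ... | false = range g₁ v
      lo : ∀ d → Live U (tail d) → White U d → col (tail d) ≤ 3
      lo d l w with verts l
      ... | inj₁ l₁ = subst (_≤ 3) (m₁ l₁) (low g₁ d l₁ (reg-mono sub₁ w))
      ... | inj₂ l₂ = subst (_≤ 3) (m₂ l₂) (low g₂ d l₂ (reg-mono sub₂ w))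
      pr : ∀ d → LiveD U d → col (tail d) ≢ col (hd d)
      pr d ld with edges ld
      ... | inj₁ (p , q) = λ e → proper g₁ d (p , q) (trans (m₁ p) (trans e (sym (m₁ q))))
      ... | inj₂ (p , q) = λ e → proper g₂ d (p , q) (trans (m₂ p) (trans e (sym (m₂ q))))
      mx : ∀ d → Gray U d → UniqueMax col (walk d)
      mx d gr with faces gr
      ... | inj₁ gr₁ = unique-max-cong col₁ col (λ d₁ e → m₁ (proj₂ (gray-walk cfg₁ (sym e) gr₁))) (maxima g₁ d gr₁)
      ... | inj₂ gr₂ = unique-max-cong col₂ col (λ d₁ e → m₂ (proj₂ (gray-walk cfg₂ (sym e) gr₂))) (maxima g₂ d gr₂)

  -- Deleting white vertices, alone or with an inner vertex

  WhiteV : VSet → Fin n → Set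
  WhiteV U v = ∃[ w ] (tail w ≡ v × LiveD U w × White U w)

  abstract
    whiteV? : ∀ U v → Dec (WhiteV U v)
    whiteV? U v = any? λ w → (tail w ≟ v) ×-dec (liveD? U w ×-dec white? U w)

  -- Turning on from a white dart at this vertex would reach a white live one.
  gray-inner : ∀ {U} → Cfg U → ∀ {d} → Gray U d → ¬ WhiteV U (tail d) → ∀ d′ → tail d′ ≡ tail d → ¬ White U d′
  gray-inner {U} C {d} gr ¬wv d′ e w with live-white-at C {d′} {d} w e (gray-live C gr)
  ... | x , q , lx , wx = ¬wv (x , q , lx , wx)

  Hits : Fin n → Fin m → Set
  Hits v d = ∃[ d′ ] (walk d′ ≡ walk d × tail d′ ≡ v)

  module Remove {U : VSet} (C : Cfg U) (A : Fin n → Set) (A? : ∀ v → Dec (A v))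
                (A-white : ∀ {v} → A v → WhiteV U v) where

    A-live : ∀ {v} → A v → Live U v
    A-live a with A-white a
    ... | w , refl , (l , _) , _ = l

    dead-new : ∀ {P : Fin n → Set} (P? : ∀ v → Dec (P v)) {v} → Live U v → Dead (dec-∪ U P?) v → P v
    dead-new P? l t with ∪-true⁻ {U = U} P? t
    ... | inj₁ x = contradiction x (not-both-ld {U} l)
    ... | inj₂ p = p

    module Plain where
      U′ : VSet
      U′ = dec-∪ U A?

      sub : U ⊑ U′
      sub = ⊑-∪ A?

      cfg : Cfg U′
      cfg = extend C sub λ v l t → case A-white (dead-new A? l t) of λ { (w , e , _ , ww) → w , e , reg-mono sub ww }

      fewer : ∀ {v} → A v → count U < count U′
      fewer a = count-strict sub _ (A-live a) (∪-trueʳ {U = U} A? a)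

      live : ∀ {v} → Live U v → ¬ A v → Live U′ v
      live = ∪-false⁺ {U = U} A?

      colour : (Fin n → ℕ) → (Fin n → ℕ) → Fin n → ℕ
      colour cA col′ v = if does (A? v) then cA v else col′ v

      colour-in : ∀ cA col′ {v} → A v → colour cA col′ v ≡ cA v
      colour-in cA col′ {v} a rewrite dec-true (A? v) a = refl

      colour-out : ∀ cA col′ {v} → ¬ A v → colour cA col′ v ≡ col′ v
      colour-out cA col′ {v} a rewrite dec-false (A? v) a = refl

      colour-live : ∀ cA col′ {v} → Live U′ v → colour cA col′ v ≡ col′ v
      colour-live cA col′ l = colour-out cA col′ (proj₂ (∪-false⁻ {U = U} A? l))

      -- No deleted vertex gets 4 here, so a gray face at `A` has to lie within `A` and find its
      -- maximum there.
      good : ∀ {cA col′} → Good U′ col′ → (∀ {v} → A v → 1 ≤ cA v × cA v ≤ 3) →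
             (∀ d → LiveD U d → A (tail d) → (A (hd d) × cA (tail d) ≢ cA (hd d)) ⊎
                 (Live U′ (hd d) × cA (tail d) ≢ col′ (hd d))) →
             (∀ d → Gray U d → A (tail d) → (∀ d′ → walk d′ ≡ walk d → A (tail d′)) × UniqueMax cA (walk d)) →
             Good U (colour cA col′)
      good {cA} {col′} g cA-range cA-proper cA-max = lift C cfg sub g
        (λ v l → sym (colour-live cA col′ l)) rng
        (λ d l t _ → subst (_≤ 3) (sym (colour-in cA col′ (dead-new A? l t))) (proj₂ (cA-range (dead-new A? l t)))) pr mx
        where
        rng : ∀ v → 1 ≤ colour cA col′ v × colour cA col′ v ≤ 4
        rng v with A? v
        ... | yes a = proj₁ (cA-range a) , m≤n⇒m≤1+n (proj₂ (cA-range a))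
        ... | no _ = range g v
        pr : ∀ d → LiveD U d → Dead U′ (tail d) → colour cA col′ (tail d) ≢ colour cA col′ (hd d)
        pr d ld t e with dead-new A? (proj₁ ld) t
        ... | a with cA-proper d ld a
        ...   | inj₁ (b , ne) = ne (trans (sym (colour-in cA col′ a)) (trans e (colour-in cA col′ b)))
        ...   | inj₂ (l , ne) = ne (trans (sym (colour-in cA col′ a)) (trans e (colour-live cA col′ l)))
        mx : ∀ d → Gray U d → Dead U′ (tail d) → UniqueMax (colour cA col′) (walk d)
        mx d gr t with cA-max d gr (dead-new A? (proj₂ gr) t)
        ... | all , um = unique-max-cong cA (colour cA col′) (λ d′ e → sym (colour-in cA col′ (all d′ e))) um

    -- Besides A, an inner vertex r is deleted and gets colour 4; it lies on all
    -- gray faces at A, so all faces that become white have their maximum at r.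
    module WithTop (dA dr : Fin m) (dA-in : A (tail dA)) (gray-r : Gray U dr) (inner : ¬ WhiteV U (tail dr))
                   (same : walk dA ≡ walk dr)
                   (meets : ∀ d → Gray U d → A (tail d) → Hits (tail dr) d) where
      r : Fin n
      r = tail dr

      abstract
        P? : ∀ v → Dec (A v ⊎ v ≡ r)
        P? v = A? v ⊎-dec (v ≟ r)

      U′ : VSet
      U′ = dec-∪ U P?

      sub : U ⊑ U′
      sub = ⊑-∪ P?

      A-dead : ∀ {v} → A v → Dead U′ v
      A-dead a = ∪-trueʳ {U = U} P? (inj₁ a)

      r-dead : Dead U′ r
      r-dead = ∪-trueʳ {U = U} P? (inj₂ refl)

      r-white : White U′ dr
      r-white = white-walk {U′} same (case A-white dA-in of λ { (w , e , _ , ww) →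
        spread C sub e (subst (Dead U′) (sym e) (A-dead dA-in)) (reg-mono sub ww) })

      cfg : Cfg U′
      cfg = extend C sub λ v l t → case dead-new P? l t of λ
        { (inj₁ a) → case A-white a of λ { (w , e , _ , ww) → w , e , reg-mono sub ww }
        ; (inj₂ e) → dr , sym e , r-white }

      fewer : count U < count U′
      fewer = count-strict sub _ (A-live dA-in) (A-dead dA-in)

      live : ∀ {v} → Live U v → ¬ A v → v ≢ r → Live U′ v
      live l ¬a ne = ∪-false⁺ {U = U} P? l [ ¬a , ne ]′

      white≢r : ∀ {v} → WhiteV U v → v ≢ r
      white≢r w refl = inner w

      r∉A : ¬ A r
      r∉A a = inner (A-white a)

      colour : (Fin n → ℕ) → (Fin n → ℕ) → Fin n → ℕ
      colour cA col′ v = if does (v ≟ r) then 4 else (if does (A? v) then cA v else col′ v)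

      colour-r : ∀ cA col′ {v} → v ≡ r → colour cA col′ v ≡ 4
      colour-r cA col′ {v} e rewrite dec-true (v ≟ r) e = refl

      colour-in : ∀ cA col′ {v} → A v → colour cA col′ v ≡ cA v
      colour-in cA col′ {v} a rewrite dec-false (v ≟ r) (λ { refl → r∉A a }) | dec-true (A? v) a = refl

      colour-live : ∀ cA col′ {v} → Live U′ v → colour cA col′ v ≡ col′ v
      colour-live cA col′ {v} l
        rewrite dec-false (v ≟ r) (λ e → proj₂ (∪-false⁻ {U = U} P? l) (inj₂ e))
              | dec-false (A? v) (λ a → proj₂ (∪-false⁻ {U = U} P? l) (inj₁ a)) = refl

      ProperAt : (Fin n → ℕ) → (Fin n → ℕ) → Fin m → Set
      ProperAt cA col′ d = hd d ≡ r ⊎ (A (hd d) × cA (tail d) ≢ cA (hd d)) ⊎ (Live U′ (hd d) × cA (tail d) ≢ col′ (hd d))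

      good : ∀ {cA col′} → Good U′ col′ → (∀ {v} → A v → 1 ≤ cA v × cA v ≤ 3) →
             (∀ d → LiveD U d → A (tail d) → ProperAt cA col′ d) →
             Good U (colour cA col′)
      good {cA} {col′} g cA-range cA-proper = lift C cfg sub g
        (λ v l → sym (colour-live cA col′ l)) rng lo pr mx
        where
        col : Fin n → ℕ
        col = colour cA col′
        rng : ∀ v → 1 ≤ col v × col v ≤ 4
        rng v with v ≟ r | A? v
        ... | yes _ | _ = s≤s z≤n , ≤-refl
        ... | no _ | yes a = proj₁ (cA-range a) , m≤n⇒m≤1+n (proj₂ (cA-range a))
        ... | no _ | no _ = range g v
        low-A : ∀ {v} → A v → col v ≤ 3
        low-A a = subst (_≤ 3) (sym (colour-in cA col′ a)) (proj₂ (cA-range a))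
        lo : ∀ d → Live U (tail d) → Dead U′ (tail d) → White U d → col (tail d) ≤ 3
        lo d l t w with dead-new P? l t
        ... | inj₁ a = low-A a
        ... | inj₂ e = contradiction w (gray-inner C gray-r inner d e)
        r-spread : ∀ {d} → tail d ≡ r → White U′ d
        r-spread e = spread C sub (sym e) r-dead r-white
        -- Once `r` is deleted all darts at it are white, so its live neighbours stay below 4.
        low-r : ∀ {d} → tail d ≡ r → LiveD U d → col (hd d) ≤ 3
        low-r {d} e ld with live-or-dead U′ (hd d)
        ... | inj₁ l = subst (_≤ 3) (sym (colour-live cA col′ l))
                (low g (α d) l (white-across {U′} (inj₁ (subst (Dead U′) (sym e) r-dead)) (r-spread e)))
        ... | inj₂ t with dead-new P? (proj₂ ld) t
        ...   | inj₁ a = low-A a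
        ...   | inj₂ e′ = contradiction (trans e′ (sym e)) (noLoop d)
        not-4 : ∀ {x} → x ≤ 3 → 4 ≢ x
        not-4 le refl = 1+n≰n le
        pr : ∀ d → LiveD U d → Dead U′ (tail d) → col (tail d) ≢ col (hd d)
        pr d ld t e with dead-new P? (proj₁ ld) t
        ... | inj₂ q = not-4 (low-r q ld) (trans (sym (colour-r cA col′ q)) e)
        ... | inj₁ a with cA-proper d ld a
        ...   | inj₁ q = not-4 (low-A a) (sym (trans e (colour-r cA col′ q)))
        ...   | inj₂ (inj₁ (b , ne)) = ne (trans (sym (colour-in cA col′ a)) (trans e (colour-in cA col′ b)))
        ...   | inj₂ (inj₂ (l , ne)) = ne (trans (sym (colour-in cA col′ a)) (trans e (colour-live cA col′ l)))
        -- A face through `r` has become white by its deletion, so its live vertices are below 4 and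
        -- `r` is the only 4.
        top : ∀ d → Gray U d → Hits r d → UniqueMax col (walk d)
        top d gr (d₀ , q , e₀) = d₀ , q , λ d₁ q₁ → at d₁ q₁
          where
          max : col (tail d₀) ≡ 4
          max = colour-r cA col′ e₀
          from-low : ∀ {v} → col v ≤ 3 → col v ≤ col (tail d₀) × (col v ≡ col (tail d₀) → v ≡ tail d₀)
          from-low le = subst (_ ≤_) (sym max) (m≤n⇒m≤1+n le) , λ x → contradiction (trans (sym max) (sym x)) (not-4 le)
          at : ∀ d₁ → walk d₁ ≡ walk d → col (tail d₁) ≤ col (tail d₀) × (col (tail d₁) ≡ col (tail d₀) → tail d₁ ≡ tail d₀)
          at d₁ q₁ with live-or-dead U′ (tail d₁)
          ... | inj₁ l = from-low (subst (_≤ 3) (sym (colour-live cA col′ l))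
                  (low g d₁ l (white-walk {U′} (trans q (sym q₁)) (r-spread e₀))))
          ... | inj₂ t with dead-new P? (proj₂ (gray-walk C (sym q₁) gr)) t
          ...   | inj₁ a = from-low (low-A a)
          ...   | inj₂ e = ≤-reflexive (cong col (trans e (sym e₀))) , λ _ → trans e (sym e₀)
        mx : ∀ d → Gray U d → Dead U′ (tail d) → UniqueMax col (walk d)
        mx d gr t with dead-new P? (proj₂ gr) t
        ... | inj₁ a = top d gr (meets d gr a)
        ... | inj₂ e = top d gr (d , refl , e)

  -- White boundaries without cut vertices and chords

  CutFree ChordFree : VSet → Set
  CutFree U = ∀ {w w′} → LiveD U w → LiveD U w′ → White U w → White U w′ → tail w ≡ tail w′ → w ≡ w′
  ChordFree U = ∀ {e} → LiveD U e → ¬ White U e → WhiteV U (tail e) → WhiteV U (hd e) → White U (α e)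

  few-darts : ∀ {v} → ¬ InX G v → ∀ {xs} → Unique xs → (∀ {x} → x ∈ xs → tail x ≡ v) → length xs ≤ 3
  few-darts {v} ¬x u h = ≤-trans (length-⊆ u (λ m → ∈-filter⁺ (λ d → tail d ≟ v) (∈-allFin _) (h m))) (≤-pred (≰⇒> ¬x))

  -- If `α q` is white, the dart after `q` is white as well; when only the first dart of the
  -- rotation is white, `q` must therefore be the last one.
  no-white-pair : ∀ {U x xs} → Rest U x xs → (∀ {y} → y ∈ xs → ¬ White U y) → ∀ {q q′} → q ∈ x ∷ xs → q′ ∈ x ∷ xs →
                  White U (α q) → White U (α q′) → q ≡ q′
  no-white-pair (end _) h (here refl) (here refl) w w′ = refl
  no-white-pair {U} (next (inj₁ refl) r) h (here refl) q′ w w′ = contradiction (white-σ {U} w) (h (here refl))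
  no-white-pair (next (inj₂ (_ , wy)) r) h (here refl) q′ w w′ = contradiction wy (h (here refl))
  no-white-pair {U} (next (inj₁ refl) r) h (there q) (here refl) w w′ = contradiction (white-σ {U} w′) (h (here refl))
  no-white-pair (next (inj₂ (_ , wy)) r) h (there q) (here refl) w w′ = contradiction wy (h (here refl))
  no-white-pair (next _ r) h (there q) (there q′) w w′ = no-white-pair r (h ∘ there) q q′ w w′

  module Free {U : VSet} (C : Cfg U) (cut-free : CutFree U) (chord-free : ChordFree U) where

    others-gray : ∀ {w} → LiveD U w → White U w → (R : Rotation U w) → ∀ {y} → y ∈ Rotation.others R → ¬ White U y
    others-gray lw ww record { unique = a ∷ _ ; at = at } y∈ wy =
      All.lookup a y∈ (cut-free lw (proj₂ (at (there y∈))) ww wy (sym (proj₁ (at (there y∈)))))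

    next-white : ∀ {d} → LiveD U d → White U d → ∃[ d′ ] (tail d′ ≡ hd d × LiveD U d′ × White U d′)
    next-white {d} ld wd = live-white-at C {φ rot d} {α d} (white-φ {U} wd) (tail-φ d) (liveD-α {U} ld)

    -- With `cut-free` and `next-white` this makes the white live darts a union of directed cycles
    -- without common vertices.
    unique-into : ∀ {d d′} → LiveD U d → LiveD U d′ → White U d → White U d′ → hd d ≡ hd d′ → d ≡ d′
    unique-into {d} {d′} ld ld′ wd wd′ e with next-white ld wd
    ... | w , q , lw , ww = α-inj (no-white-pair (Rotation.run R) (others-gray lw ww R)
            (Rotation.complete R (sym q) (liveD-α {U} ld)) (Rotation.complete R (trans (sym e) (sym q)) (liveD-α {U} ld′))
            (white-walk {U} (cong walk (sym (α-inv d))) wd) (white-walk {U} (cong walk (sym (α-inv d′))) wd′))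
      where
      R : Rotation U w
      R = rotation C w lw ww

    -- Data for deleting the white vertex x = tail t together with an inner
    -- vertex on all gray faces at x; the other neighbours of x are along t and g.
    record Removable (t : Fin m) : Set where
      field
        g dx dr : Fin m
        g-at    : tail g ≡ tail t
        g-live  : LiveD U g
        g-white : White U (α g)
        dx-at   : tail dx ≡ tail t
        gray-r  : Gray U dr
        inner   : ¬ WhiteV U (tail dr)
        same    : walk dx ≡ walk dr
        meets   : ∀ d → Gray U d → tail d ≡ tail t → Hits (tail dr) d
        nbrs    : ∀ d → LiveD U d → tail d ≡ tail t → d ≡ t ⊎ d ≡ g ⊎ hd d ≡ tail dr

    Lone : Fin m → Set
    Lone t = White U (α t) × (∀ d → LiveD U d → tail d ≡ tail t → d ≡ t)

    CycleFace : Fin m → Set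
    CycleFace d₀ = Gray U d₀ × (∀ d → walk d ≡ walk d₀ → White U (α d))

    -- The outcomes for one, two or three live neighbours; with two, the gray face may lack an inner
    -- vertex, and `CycleFace` is left.
    Small : Fin m → Set
    Small t = Lone t ⊎ Removable t ⊎ ∃[ d₀ ] CycleFace d₀

    -- If the only gray face at the vertex has no inner vertex, all its edges join white vertices,
    -- and `chord-free` makes their other sides white.
    two : ∀ t t′ → LiveD U t → White U t → LiveD U t′ → tail t′ ≡ tail t → ¬ White U t′ → White U (α t′) →
          (∀ d → LiveD U d → tail d ≡ tail t → d ≡ t ⊎ d ≡ t′) → Small t
    two t t′ lt wt lt′ e′ ¬w wα all with any? (λ d → (walk d ≟ walk t′) ×-dec ¬? (whiteV? U (tail d)))
    ... | yes (dr , q , ¬wv) = inj₂ (inj₁ record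
          { g = t′ ; dx = t′ ; dr = dr ; g-at = e′ ; g-live = lt′ ; g-white = wα ; dx-at = e′
          ; gray-r = gray-walk C (sym q) (¬w , proj₁ lt′) ; inner = ¬wv ; same = sym q
          ; meets = λ d gr e → case all d (gray-live C gr) e of λ
              { (inj₁ refl) → contradiction wt (proj₁ gr) ; (inj₂ refl) → dr , q , refl }
          ; nbrs = λ d ld e → case all d ld e of λ { (inj₁ p) → inj₁ p ; (inj₂ p) → inj₂ (inj₁ p) } })
    ... | no none = inj₂ (inj₂ (t′ , (¬w , proj₁ lt′) , λ d q →
            chord-free (gray-live C (gr d q)) (proj₁ (gr d q)) (wv d q)
              (subst (WhiteV U) (tail-φ d) (wv (φ rot d) (trans (walk-φ d) q)))))
      where
      gr : ∀ d → walk d ≡ walk t′ → Gray U d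
      gr d q = gray-walk C (sym q) (¬w , proj₁ lt′)
      wv : ∀ d → walk d ≡ walk t′ → WhiteV U (tail d)
      wv d q with whiteV? U (tail d)
      ... | yes p = p
      ... | no ¬p = contradiction (d , q , ¬p) none

    -- The middle neighbour lies on both gray faces, and it is inner because an edge to a white
    -- vertex would be a chord.
    three : ∀ t t′ t″ → LiveD U t → White U t → LiveD U t′ → tail t′ ≡ tail t → LiveD U t″ → tail t″ ≡ tail t →
            ¬ White U t′ → ¬ White U t″ → σ t′ ≡ t″ → White U (α t″) →
            (∀ d → LiveD U d → tail d ≡ tail t → d ≡ t ⊎ d ≡ t′ ⊎ d ≡ t″) → Small t
    three t t′ t″ lt wt lt′ e′ lt″ e″ ¬w ¬w″ q wα all with whiteV? U (hd t′)
    ... | yes wv = contradiction (subst (White U) q (white-σ {U} (chord-free lt′ ¬w (t , sym e′ , lt , wt) wv))) ¬w″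
    ... | no ¬wv = inj₂ (inj₁ record
          { g = t″ ; dx = t′ ; dr = φ rot t′ ; g-at = e″ ; g-live = lt″ ; g-white = wα ; dx-at = e′
          ; gray-r = gray-walk C (sym (walk-φ t′)) (¬w , proj₁ lt′) ; inner = ¬wv ∘ subst (WhiteV U) (tail-φ t′)
          ; same = sym (walk-φ t′)
          ; meets = λ d gr e → case all d (gray-live C gr) e of λ
              { (inj₁ refl) → contradiction wt (proj₁ gr)
              ; (inj₂ (inj₁ refl)) → φ rot t′ , walk-φ t′ , refl
              ; (inj₂ (inj₂ refl)) → α t′ , trans (sym (walk-σ t′)) (cong walk q) , sym (tail-φ t′) }
          ; nbrs = λ d ld e → case all d ld e of λ
              { (inj₁ p) → inj₁ p
              ; (inj₂ (inj₁ refl)) → inj₂ (inj₂ (sym (tail-φ t′)))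
              ; (inj₂ (inj₂ p)) → inj₂ (inj₁ p) } })

    small-rotation : ∀ t → LiveD U t → White U t → (R : Rotation U t) → length (t ∷ Rotation.others R) ≤ 3 → Small t
    small-rotation t lt wt R@record { others = [] ; run = end w ; complete = complete } _ =
      inj₁ (w , λ d ld e → case complete e ld of λ { (here p) → p })
    small-rotation t lt wt R@record { others = t′ ∷ [] ; run = next _ (end w) ; at = at ; complete = complete } _ =
      two t t′ lt wt (proj₂ (at (there (here refl)))) (proj₁ (at (there (here refl)))) (others-gray lt wt R (here refl)) w
        λ d ld e → case complete e ld of λ { (here p) → inj₁ p ; (there (here p)) → inj₂ p }
    small-rotation t lt wt R@record { others = t′ ∷ t″ ∷ [] ; run = next _ (next nx (end w)) ; at = at ; complete =
        complete } _ =
      three t t′ t″ lt wt (proj₂ (at (there (here refl)))) (proj₁ (at (there (here refl))))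
        (proj₂ (at (there (there (here refl))))) (proj₁ (at (there (there (here refl)))))
        (others-gray lt wt R (here refl)) (others-gray lt wt R (there (here refl)))
        (case nx of λ { (inj₁ q) → q ; (inj₂ (_ , w″)) → contradiction w″ (others-gray lt wt R (there (here refl))) }) w
        λ d ld e → case complete e ld of λ { (here p) → inj₁ p ; (there (here p)) →
            inj₂ (inj₁ p) ; (there (there (here p))) → inj₂ (inj₂ p) }
    small-rotation t lt wt record { others = _ ∷ _ ∷ _ ∷ _ } (s≤s (s≤s (s≤s ())))

    small : ∀ t → LiveD U t → White U t → ¬ InX G (tail t) → Small t
    small t lt wt ¬x = small-rotation t lt wt R (few-darts ¬x (Rotation.unique R) (λ m → proj₁ (Rotation.at R m)))
      where
      R : Rotation U t
      R = rotation C t lt wt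

    -- The edge is white on both sides, so a further live dart at its end would give a second white
    -- dart there.
    lone : ∀ {t t′} → LiveD U t → White U t → LiveD U t′ → White U t′ → tail t′ ≡ hd t → hd t′ ≡ tail t → Lone t′
    lone {t} {t′} lt wt lt′ wt′ p q = subst (White U) (sym αt′) wt , λ d ld e →
      only (Rotation.complete R e ld)
      where
      αt′ : α t′ ≡ t
      αt′ = same-edge q (trans (hd-α t′) p)
      R : Rotation U t′
      R = rotation C t′ lt′ wt′
      single : ∀ {xs} → Rest U t′ xs → (∀ {y} → y ∈ xs → ¬ White U y) → ∀ {x} → x ∈ t′ ∷ xs → x ≡ t′
      single (end _) h (here p) = p
      single (next (inj₁ refl) _) h _ = contradiction (white-σ {U} (subst (White U) (sym αt′) wt)) (h (here refl))
      single (next (inj₂ (_ , wy)) _) h _ = contradiction wy (h (here refl))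
      only : ∀ {x} → x ∈ t′ ∷ Rotation.others R → x ≡ t′
      only = single (Rotation.run R) (others-gray lt′ wt′ R)

    -- The sequence 3, then 1 and 2 in turn, starting with either. Around a cycle of any length
    -- above one it is proper whatever the parity, and 3 occurs once; the flag allows a prescribed
    -- colour to be met.
    pat : Bool → ℕ → ℕ
    alt : Bool → ℕ → ℕ
    pat b zero = 3
    pat b (suc i) = alt b i
    alt true zero = 1
    alt false zero = 2
    alt true (suc i) = alt false i
    alt false (suc i) = alt true i

    alt-range : ∀ b i → 1 ≤ alt b i × alt b i ≤ 2
    alt-range true zero = s≤s z≤n , s≤s z≤n
    alt-range false zero = s≤s z≤n , ≤-refl
    alt-range true (suc i) = alt-range false i
    alt-range false (suc i) = alt-range true i

    alt-step : ∀ b i → alt b i ≢ alt b (suc i)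
    alt-step true zero = λ ()
    alt-step false zero = λ ()
    alt-step true (suc i) = alt-step false i
    alt-step false (suc i) = alt-step true i

    alt-any : ∀ i {c} → 1 ≤ c → c ≤ 2 → ∃[ b ] alt b i ≡ c
    alt-any zero {1} _ _ = true , refl
    alt-any zero {2} _ _ = false , refl
    alt-any zero {suc (suc (suc _))} _ (s≤s (s≤s ()))
    alt-any (suc i) p q with alt-any i p q
    ... | true , e = false , e
    ... | false , e = true , e

    alt≢3 : ∀ b i → alt b i ≢ 3
    alt≢3 b i e = 1+n≰n (subst (_≤ 2) e (proj₂ (alt-range b i)))

    pat-range : ∀ b i → 1 ≤ pat b i × pat b i ≤ 3
    pat-range b zero = s≤s z≤n , ≤-refl
    pat-range b (suc i) = proj₁ (alt-range b i) , m≤n⇒m≤1+n (proj₂ (alt-range b i))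

    pat-step : ∀ b i → pat b i ≢ pat b (suc i)
    pat-step b zero e = alt≢3 b zero (sym e)
    pat-step b (suc i) = alt-step b i

    φ-inj : ∀ {d d′} → φ rot d ≡ φ rot d′ → d ≡ d′
    φ-inj e = α-inj (σ-inj e)

    open Orbit (φ rot) φ-inj

    walk-iter : ∀ k d → walk (iter (φ rot) k d) ≡ walk d
    walk-iter zero d = refl
    walk-iter (suc k) d = trans (walk-φ _) (walk-iter k d)

    pred : ∀ d → ∃[ d′ ] φ rot d′ ≡ d
    pred d = iter (φ rot) (proj₁ (returns d)) d , proj₂ (returns d)

    -- A gray face all of whose edges are white on the other side is a component of G − U.
    module CycleComponent (d₀ : Fin m) (cyc : CycleFace d₀) where

      OnFace : Fin m → Set
      OnFace d = walk d ≡ walk d₀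

      face-gray : ∀ {d} → OnFace d → Gray U d
      face-gray q = gray-walk C (sym q) (proj₁ cyc)

      entering : ∀ {d} → OnFace d → ∃[ p ] (OnFace p × φ rot p ≡ d)
      entering {d} q with pred d
      ... | p , e = p , trans (sym (walk-φ p)) (trans (cong walk e) q) , e

      -- In the rotation `α p` is followed by `d`, whose other side is white; one more live dart
      -- would be a second white one at this vertex.
      two-darts : ∀ {d p x} → OnFace d → OnFace p → φ rot p ≡ d → LiveD U x → tail x ≡ tail d → x ≡ α p ⊎ x ≡ d
      two-darts {d} {p} {x} qd qp e lx ex = go (Rotation.run R) (others-gray lw ww R)
          (Rotation.complete R (trans ex (sym ew)) lx)
        where
        lw : LiveD U (α p)
        lw = liveD-α {U} (gray-live C (face-gray qp))
        ww : White U (α p)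
        ww = proj₂ cyc p qp
        ew : tail (α p) ≡ tail d
        ew = trans (sym (tail-φ p)) (cong tail e)
        R : Rotation U (α p)
        R = rotation C (α p) lw ww
        tail-end : ∀ {ys} → Rest U d ys → (∀ {y} → y ∈ ys → ¬ White U y) → x ∈ d ∷ ys → x ≡ d
        tail-end _ h (here r) = r
        tail-end (next (inj₁ refl) _) h _ = contradiction (white-σ {U} (proj₂ cyc d qd)) (h (here refl))
        tail-end (next (inj₂ (_ , wz)) _) h _ = contradiction wz (h (here refl))
        go : ∀ {xs} → Rest U (α p) xs → (∀ {y} → y ∈ xs → ¬ White U y) → x ∈ α p ∷ xs → x ≡ α p ⊎ x ≡ d
        go _ h (here r) = inj₁ r
        go (next (inj₁ q) r) h (there m) with trans (sym q) e
        ... | refl = inj₂ (tail-end r (h ∘ there) m)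
        go (next (inj₂ (w , _)) r) h (there m) = contradiction (white-walk {U} (cong walk (α-inv p)) w)
            (proj₁ (face-gray qp))

      face-at : ∀ {d x} → OnFace d → Gray U x → tail x ≡ tail d → x ≡ d
      face-at qd gx e with entering qd
      ... | p , qp , ep with two-darts qd qp ep (gray-live C gx) e
      ...   | inj₁ refl = contradiction (proj₂ cyc p qp) (proj₁ gx)
      ...   | inj₂ r = r

      A : Fin n → Set
      A v = ∃[ d ] (OnFace d × tail d ≡ v)

      abstract
        A? : ∀ v → Dec (A v)
        A? v = any? λ d → (walk d ≟ walk d₀) ×-dec (tail d ≟ v)

      A-white : ∀ {v} → A v → WhiteV U v
      A-white (d , q , refl) with entering q
      ... | p , qp , e = α p , trans (sym (tail-φ p)) (cong tail e) , liveD-α {U} (gray-live C (face-gray qp)) ,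
          proj₂ cyc p qp

      open Remove C A A? A-white public
      open Plain public

      module Pattern (s : Fin m) (on : OnFace s) (b : Bool) where

        abstract
          position : ∀ {d} → OnFace d → ∃[ i ] (i < len s × iter (φ rot) i s ≡ d)
          position {d} q with walk-orbit s d (trans on (sym q))
          ... | k , e with iter-reduce s k
          ...   | i , i<l , e′ = i , i<l , trans (sym e′) e

        cA : Fin n → ℕ
        cA v with A? v
        ... | yes (d , q , _) = pat b (proj₁ (position q))
        ... | no _ = 1

        on-iter : ∀ i → OnFace (iter (φ rot) i s)
        on-iter i = trans (walk-iter i s) on

        same-index : ∀ {i j} → i < len s → j < len s → iter (φ rot) i s ≡ iter (φ rot) j s → i ≡ j
        same-index {i} {j} i<l j<l e with <-cmp i j
        ... | tri< lt _ _ = contradiction e (iter-distinct s i j lt j<l)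
        ... | tri≈ _ q _ = q
        ... | tri> _ _ gt = contradiction (sym e) (iter-distinct s j i gt i<l)

        cA-at : ∀ i → i < len s → cA (tail (iter (φ rot) i s)) ≡ pat b i
        cA-at i i<l with A? (tail (iter (φ rot) i s))
        ... | no ¬a = contradiction (iter (φ rot) i s , on-iter i , refl) ¬a
        ... | yes (d , q , e) with position q
        ...   | j , j<l , r = cong (pat b) (same-index j<l i<l (trans r (face-at (on-iter i) (face-gray q) e)))

        cA-dart : ∀ {d} → OnFace d → ∃[ i ] (i < len s × iter (φ rot) i s ≡ d × cA (tail d) ≡ pat b i)
        cA-dart q with position q
        ... | i , i<l , refl = i , i<l , refl , cA-at i i<l

        cA-range : ∀ {v} → A v → 1 ≤ cA v × cA v ≤ 3
        cA-range (d , q , refl) with cA-dart q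
        ... | i , _ , _ , e = subst (λ c → 1 ≤ c × c ≤ 3) (sym e) (pat-range b i)

        cA-step : ∀ {d} → OnFace d → cA (tail d) ≢ cA (tail (φ rot d))
        cA-step {d} q with position q
        ... | i , i<l , refl with m≤n⇒m<n∨m≡n i<l
        ...   | inj₁ lt = λ e → pat-step b i (trans (sym (cA-at i i<l)) (trans e (cA-at (suc i) lt)))
        ...   | inj₂ eq = λ e → last i eq (trans (sym (cA-at i i<l))
            (trans e (trans (cong (cA ∘ tail) back) (cA-at 0 (s≤s z≤n)))))
          where
          back : iter (φ rot) (suc i) s ≡ s
          back = trans (cong (λ k → iter (φ rot) k s) eq) (iter-len s)
          -- The closing step returns to the 3 at the start. The last position carries 1 or 2, since
          -- length one would be a loop.
          last : ∀ i → suc i ≡ len s → pat b i ≢ 3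
          last zero eq′ _ = not-loop (trans (sym (tail-φ s))
              (cong tail (trans (cong (λ k → iter (φ rot) k s) eq′) (iter-len s))))
          last (suc i) _ = alt≢3 b i

        cA-proper : ∀ d → LiveD U d → A (tail d) → A (hd d) × cA (tail d) ≢ cA (hd d)
        cA-proper x lx (d , q , e) with entering q
        ... | p , qp , ep with two-darts q qp ep lx (sym e)
        ...   | inj₂ refl = (φ rot d , trans (walk-φ d) q , tail-φ d) , λ r → cA-step q (trans r (cong cA (sym (tail-φ d))))
        ...   | inj₁ refl = (p , qp , sym (hd-α p)) , λ r → cA-step qp
                  (sym (trans (cong cA (trans (cong tail ep) e)) (trans r (cong cA (hd-α p)))))

        cA-max : ∀ d → Gray U d → A (tail d) → (∀ d′ → walk d′ ≡ walk d → A (tail d′)) × UniqueMax cA (walk d)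
        cA-max x gx (d , q , e) with face-at q gx (sym e)
        ... | refl = (λ d′ r → d′ , trans r q , refl) , s , trans on (sym q) , top
          where
          top : ∀ d′ → walk d′ ≡ walk d → cA (tail d′) ≤ cA (tail s) × (cA (tail d′) ≡ cA (tail s) → tail d′ ≡ tail s)
          top d′ r with cA-dart (trans r q)
          ... | zero , _ , e₀ , _ = ≤-reflexive (cong (cA ∘ tail) (sym e₀)) , λ _ → cong tail (sym e₀)
          ... | suc i , _ , _ , c = subst₂ _≤_ (sym c) (sym (cA-at 0 (s≤s z≤n))) (proj₂ (pat-range b (suc i))) ,
                λ z → contradiction (trans (sym c) (trans z (cA-at 0 (s≤s z≤n)))) (alt≢3 b i)

        cycle-good : ∀ {col′} → Good U′ col′ → Good U (colour cA col′)
        cycle-good g = good g cA-range (λ d ld a → inj₁ (cA-proper d ld a)) cA-max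

  -- The induction with a precoloured edge

  Colour : ℕ → Set
  Colour x = 1 ≤ x × x ≤ 3

  avoid : ∀ x y → ∃[ z ] (Colour z × z ≢ x × z ≢ y)
  avoid x y with x ≟ⁿ 1 | y ≟ⁿ 1 | x ≟ⁿ 2 | y ≟ⁿ 2
  ... | no p | no q | _ | _ = 1 , (s≤s z≤n , s≤s z≤n) , (p ∘ sym) , (q ∘ sym)
  ... | yes refl | _ | _ | no q = 2 , (s≤s z≤n , s≤s (s≤s z≤n)) , (λ ()) , (q ∘ sym)
  ... | yes refl | _ | _ | yes refl = 3 , (s≤s z≤n , ≤-refl) , (λ ()) , (λ ())
  ... | no _ | yes refl | no q | _ = 2 , (s≤s z≤n , s≤s (s≤s z≤n)) , (q ∘ sym) , (λ ())
  ... | no _ | yes refl | yes refl | _ = 3 , (s≤s z≤n , ≤-refl) , (λ ()) , (λ ())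

  -- The recursion precolours an edge with an end that has room left: its degree
  -- in G − U is at most 2, or it belongs to X.
  Slack : VSet → Fin n → Set
  Slack U v = InX G v ⊎ ∃[ d ] (tail d ≡ v × Dead U (hd d))

  record Precoloured (U : VSet) : Set where
    field
      e         : Fin m
      live      : LiveD U e
      white     : White U e
      α̂ β̂       : ℕ
      α̂-colour  : Colour α̂
      β̂-colour  : Colour β̂
      different : α̂ ≢ β̂
      slack     : Slack U (tail e) ⊎ Slack U (hd e)

  Fits : ∀ {U} → Maybe (Precoloured U) → (Fin n → ℕ) → Set
  Fits nothing col = ⊤
  Fits (just p) col = col (tail e) ≡ α̂ × col (hd e) ≡ β̂
    where open Precoloured p

  Solved : (U : VSet) → Maybe (Precoloured U) → Set
  Solved U p = ∃[ col ] (Good U col × Fits p col)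

  slack-mono : ∀ {U U′ v} → U ⊑ U′ → Slack U v → Slack U′ v
  slack-mono s (inj₁ x) = inj₁ x
  slack-mono s (inj₂ (d , e , t)) = inj₂ (d , e , s _ t)

  restrict : ∀ {U U′} → U ⊑ U′ → (p : Precoloured U) → LiveD U′ (Precoloured.e p) → Precoloured U′
  restrict s p l = record
    { e = e ; live = l ; white = reg-mono s white ; α̂ = α̂ ; β̂ = β̂ ; α̂-colour = α̂-colour ; β̂-colour = β̂-colour
    ; different = different ; slack = [ inj₁ ∘ slack-mono s , inj₂ ∘ slack-mono s ]′ slack }
    where open Precoloured p

  module Inductive {U : VSet} (C : Cfg U) (IH : ∀ U′ → Cfg U′ → count U < count U′ → ∀ p → Solved U′ p) where
    open Cfg C

    Completes : (V V′ : VSet) → (Fin n → Set) → Set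
    Completes V V′ K = ∀ col → Good V col → ∃[ col′ ] (Good V′ col′ × (∀ v → K v → col v ≡ col′ v))

    -- The part containing the precoloured edge is coloured first and the other is fitted to it on
    -- `K`; either part can be the first.
    module SplitStep {K : Fin n → Set} (S : Split U K)
      (less₁ : count U < count (Split.U₁ S)) (less₂ : count U < count (Split.U₂ S))
      (then₂ : Completes (Split.U₁ S) (Split.U₂ S) K) (then₁ : Completes (Split.U₂ S) (Split.U₁ S) K) where
      open Split S
      open Merging C S

      from₁ : ∀ p → ∃[ col ] (Good U col × ∃[ col₁ ] (Fits p col₁ × (∀ {v} → Live U₁ v → col₁ v ≡ col v)))
      from₁ p with IH U₁ cfg₁ less₁ p
      ... | col₁ , g₁ , f₁ with then₂ col₁ g₁
      ...   | col₂ , g₂ , agree = merge col₁ col₂ , merged-good g₁ g₂ agree , col₁ , f₁ , merge₁ col₁ col₂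

      from₂ : ∀ p → ∃[ col ] (Good U col × ∃[ col₂ ] (Fits p col₂ × (∀ {v} → Live U₂ v → col₂ v ≡ col v)))
      from₂ p with IH U₂ cfg₂ less₂ p
      ... | col₂ , g₂ , f₂ with then₁ col₂ g₂
      ...   | col₁ , g₁ , agree = merge col₁ col₂ , merged-good g₁ g₂ agree′ , col₂ , f₂ , merge₂ col₁ col₂ agree′
        where
        agree′ : ∀ v → K v → col₁ v ≡ col₂ v
        agree′ v k = sym (agree v k)

      solve : ∀ p → Solved U p
      solve nothing with from₁ nothing
      ... | col , g , _ = col , g , tt
      solve (just p) with edges (Precoloured.live p)
      ... | inj₁ l with from₁ (just (restrict sub₁ p l))
      ...   | col , g , col₁ , (f , f′) , same = col , g , trans (sym (same (proj₁ l))) f , trans (sym (same (proj₂ l))) f′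
      solve (just p) | inj₂ l with from₂ (just (restrict sub₂ p l))
      ...   | col , g , col₁ , (f , f′) , same = col , g , trans (sym (same (proj₁ l))) f , trans (sym (same (proj₂ l))) f′

    -- Prescribing one vertex amounts to precolouring a white edge at it, with any other colour at
    -- the far end; the neighbour lost to the other part gives slack.
    solve-cut : ∀ {w w′} → tail w ≡ tail w′ → LiveD U w → LiveD U w′ → CutVertex U w w′ → ∀ p → Solved U p
    solve-cut {w} {w′} e lw lw′ V = SplitStep.solve split
      (count-strict sub₁ (hd w) (proj₂ lw) dead₁) (count-strict sub₂ (hd w′) (proj₂ lw′) dead₂) then₂ then₁
      where
      open CutVertex V
      less₁ : count U < count U₁
      less₁ = count-strict sub₁ (hd w) (proj₂ lw) dead₁
      less₂ : count U < count U₂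
      less₂ = count-strict sub₂ (hd w′) (proj₂ lw′) dead₂
      then₂ : Completes U₁ U₂ (_≡ tail w)
      then₂ col₁ g₁ with avoid (col₁ (tail w)) (col₁ (tail w))
      ... | z , z-colour , z≢ , _ with IH U₂ cfg₂ less₂ (just record
              { e = w ; live = live₂ ; white = white₂ ; α̂ = col₁ (tail w) ; β̂ = z
              ; α̂-colour = subst (Colour ∘ col₁) (sym e) (colour-3 g₁ (proj₁ live₁) white₁)
              ; β̂-colour = z-colour ; different = z≢ ∘ sym ; slack = inj₁ (inj₂ (w′ , sym e , dead₂)) })
      ...   | col₂ , g₂ , f , _ = col₂ , g₂ , λ { v refl → sym f }
      then₁ : Completes U₂ U₁ (_≡ tail w)
      then₁ col₂ g₂ with avoid (col₂ (tail w)) (col₂ (tail w))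
      ... | z , z-colour , z≢ , _ with IH U₁ cfg₁ less₁ (just record
              { e = w′ ; live = live₁ ; white = white₁ ; α̂ = col₂ (tail w) ; β̂ = z
              ; α̂-colour = colour-3 g₂ (proj₁ live₂) white₂
              ; β̂-colour = z-colour ; different = z≢ ∘ sym ; slack = inj₁ (inj₂ (w , e , dead₁)) })
      ...   | col₁ , g₁ , f , _ = col₁ , g₁ , λ { v refl → sym (trans (cong col₁ e) f) }

    -- The chord is a white edge in each part, and its colours in one part are prescribed in the
    -- other. `dead₁` and `dead₂` are the lost neighbours of `tail e` that give slack.
    solve-chord : ∀ {e} → WhiteV U (tail e) → WhiteV U (hd e) → Chord U e → ∀ p → Solved U p
    solve-chord {e} (wa , qa , la , ha) (wb , qb , lb , hb) V =
      SplitStep.solve split less₁ less₂ then₂ then₁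
      where
      open Chord V
      less₁ : count U < count U₁
      less₁ = count-strict sub₁ _ (proj₂ live₁) (proj₂ dead₁)
      less₂ : count U < count U₂
      less₂ = count-strict sub₂ _ (proj₂ live₂) (proj₂ dead₂)
      le₁ : LiveD U₁ e
      le₁ = proj₁ (kept (inj₁ refl)) , proj₁ (kept (inj₂ refl))
      le₂ : LiveD U₂ (α e)
      le₂ = proj₂ (kept (inj₂ refl)) , subst (Live U₂) (sym (hd-α e)) (proj₂ (kept (inj₁ refl)))
      colour-at : ∀ {U′} → U ⊑ U′ → ∀ {col} → Good U′ col → ∀ {v} → WhiteV U v → Live U′ v → Colour (col v)
      colour-at s g (w , refl , _ , ww) l = colour-3 g l (reg-mono s ww)
      then₂ : Completes U₁ U₂ (λ v → v ≡ tail e ⊎ v ≡ hd e)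
      then₂ col₁ g₁ with IH U₂ cfg₂ less₂ (just record
              { e = α e ; live = le₂ ; white = white₂ ; α̂ = col₁ (hd e) ; β̂ = col₁ (tail e)
              ; α̂-colour = colour-at sub₁ g₁ (wb , qb , lb , hb) (proj₂ le₁)
              ; β̂-colour = colour-at sub₁ g₁ (wa , qa , la , ha) (proj₁ le₁)
              ; different = λ q → proper g₁ e le₁ (sym q)
              ; slack = inj₂ (inj₂ (x₂ , trans (proj₁ dead₂) (sym (hd-α e)) , proj₂ dead₂)) })
      ... | col₂ , g₂ , f , f′ = col₂ , g₂ , λ { v (inj₁ refl) →
          sym (trans (cong col₂ (sym (hd-α e))) f′) ; v (inj₂ refl) → sym f }
      then₁ : Completes U₂ U₁ (λ v → v ≡ tail e ⊎ v ≡ hd e)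
      then₁ col₂ g₂ with IH U₁ cfg₁ less₁ (just record
              { e = e ; live = le₁ ; white = white₁ ; α̂ = col₂ (tail e) ; β̂ = col₂ (hd e)
              ; α̂-colour = colour-at sub₂ g₂ (wa , qa , la , ha) (proj₂ (kept (inj₁ refl)))
              ; β̂-colour = colour-at sub₂ g₂ (wb , qb , lb , hb) (proj₂ (kept (inj₂ refl)))
              ; different = λ q → proper g₂ (α e) le₂ (trans (sym q) (cong col₂ (sym (hd-α e))))
              ; slack = inj₁ (inj₂ (x₁ , proj₁ dead₁ , proj₂ dead₁)) })
      ... | col₁ , g₁ , f , f′ = col₁ , g₁ , λ { v (inj₁ refl) → sym f ; v (inj₂ refl) → sym f′ }

    module Block (cut-free : CutFree U) (chord-free : ChordFree U) where
      open Free C cut-free chord-free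

      white-end : ∀ {d} → LiveD U d → White U d → WhiteV U (hd d)
      white-end ld wd with next-white ld wd
      ... | d′ , e , l , w = d′ , e , l , w

      Apart : Maybe (Precoloured U) → (Fin n → Set) → Set
      Apart nothing A = ⊤
      Apart (just p) A = ¬ A (tail (Precoloured.e p)) × ¬ A (hd (Precoloured.e p))

      ends-white : ∀ (p : Precoloured U) → WhiteV U (tail (Precoloured.e p)) × WhiteV U (hd (Precoloured.e p))
      ends-white p = (e , refl , live , white) , white-end live white
        where open Precoloured p

      narrow : ∀ {U′} → U ⊑ U′ → (A : Fin n → Set) → (∀ {v} → WhiteV U v → ¬ A v → Live U′ v) → ∀ p → Apart p A →
          Maybe (Precoloured U′)
      narrow s A keep nothing _ = nothing
      narrow s A keep (just p) (x , y) = just (restrict s p (keep (proj₁ (ends-white p)) x , keep (proj₂ (ends-white p)) y))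

      narrow-fits : ∀ {U′} (s : U ⊑ U′) (A : Fin n → Set) (keep : ∀ {v} → WhiteV U v → ¬ A v → Live U′ v) p
          (ap : Apart p A) →
                    ∀ {col col′} → (∀ {v} → Live U′ v → col v ≡ col′ v) → Fits (narrow s A keep p ap) col′ → Fits p col
      narrow-fits s A keep nothing ap same f = tt
      narrow-fits s A keep (just p) (x , y) same (f , f′) =
        trans (same (keep (proj₁ (ends-white p)) x)) f , trans (same (keep (proj₂ (ends-white p)) y)) f′

      module RemoveOne (t : Fin m) (lt : LiveD U t) (wt : White U t) (rm : Removable t) where
        open Removable rm using (g; dx; dr; dx-at; gray-r; inner; same; meets; nbrs; g-at)
        t-white : ∀ {v} → v ≡ tail t → WhiteV U v
        t-white refl = t , refl , lt , wt
        open Remove C (_≡ tail t) (_≟ tail t) t-white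
        open WithTop dx dr dx-at gray-r inner same meets public

        keep : ∀ {v} → WhiteV U v → v ≢ tail t → Live U′ v
        keep wv ne = live (white-live wv) ne (white≢r wv)
          where
          white-live : ∀ {v} → WhiteV U v → Live U v
          white-live (_ , refl , (l , _) , _) = l

        -- `T` restricts the colour of the deleted vertex: it is trivial for a free vertex and an
        -- equation for an end of the precoloured edge.
        solve-one : (T : ℕ → Set) → ∀ p →
          (∀ col′ → Good U′ col′ → Fits p col′ → ∃[ z ] (Colour z × T z × z ≢ col′ (hd t) × z ≢ col′ (hd g))) →
          ∃[ col ] (Good U col × ∃[ col′ ] ((Good U′ col′ × Fits p col′) × (∀ {v} → Live U′ v → col v ≡ col′ v) ×
              T (col (tail t))))
        solve-one T p choose with IH U′ cfg fewer p
        ... | col′ , g′ , f′ with choose col′ g′ f′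
        ...   | z , z-colour , tz , z₁ , z₂ = colour (λ _ → z) col′ , good g′ (λ _ → z-colour) pr , col′ , (g′ , f′) ,
                  colour-live (λ _ → z) col′ , subst T (sym (colour-in (λ _ → z) col′ refl)) tz
          where
          other-end : ∀ d → LiveD U d → tail d ≡ tail t → z ≢ col′ (hd d) → ProperAt (λ _ → z) col′ d
          other-end d ld e ne with hd d ≟ r
          ... | yes q = inj₁ q
          ... | no ¬q = inj₂ (inj₂ (live (proj₂ ld) (λ q → not-loop (trans q (sym e))) ¬q , ne))
          pr : ∀ d → LiveD U d → tail d ≡ tail t → ProperAt (λ _ → z) col′ d
          pr d ld e with nbrs d ld e
          ... | inj₁ refl = other-end d ld e z₁
          ... | inj₂ (inj₁ refl) = other-end d ld e z₂
          ... | inj₂ (inj₂ q) = inj₁ q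

      -- Three colours face the two neighbours along `t` and `g`; a remaining neighbour can only be
      -- the inner vertex of colour 4.
      reduce-removable : ∀ t → LiveD U t → White U t → Removable t → ∀ p → Apart p (_≡ tail t) → Solved U p
      reduce-removable t lt wt rm p ap with R.solve-one (λ _ → ⊤) (narrow R.sub (_≡ tail t) R.keep p ap)
          (λ col′ _ _ → case avoid (col′ (hd t)) (col′ (hd (Removable.g rm))) of
              λ { (z , zc , z₁ , z₂) → z , zc , tt , z₁ , z₂ })
        where module R = RemoveOne t lt wt rm
      ... | col , good , col′ , (_ , f) , agree , _ = col , good ,
            narrow-fits (RemoveOne.sub t lt wt rm) (_≡ tail t) (RemoveOne.keep t lt wt rm) p ap {col} {col′} agree f

      reduce-lone : ∀ t → LiveD U t → White U t → Lone t → ∀ p → Apart p (_≡ tail t) → Solved U p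
      reduce-lone t lt wt (_ , only) p ap = result (IH U′ cfg (fewer refl) (narrow sub (_≡ tail t) keep p ap))
        where
        t-white : ∀ {v} → v ≡ tail t → WhiteV U v
        t-white refl = t , refl , lt , wt
        open Remove C (_≡ tail t) (_≟ tail t) t-white
        open Plain
        keep : ∀ {v} → WhiteV U v → v ≢ tail t → Live U′ v
        keep (_ , refl , (l , _) , _) ne = live l ne
        result : Solved U′ (narrow sub (_≡ tail t) keep p ap) → Solved U p
        result (col′ , g′ , f) with avoid (col′ (hd t)) (col′ (hd t))
        ... | z , zc , z≢ , _ = colour (λ _ → z) col′ ,
              good g′ (λ _ → zc) (λ d ld e → case only d ld e of λ { refl → inj₂ (live (proj₂ ld) not-loop , z≢) })
                (λ d gr e → case only d (gray-live C gr) e of λ { refl → contradiction wt (proj₁ gr) }) ,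
              narrow-fits sub (_≡ tail t) keep p ap {colour (λ _ → z) col′} {col′} (colour-live (λ _ → z) col′) f

      -- The cycle and the rest are coloured independently. A precoloured edge on the cycle
      -- prescribes two consecutive colours: the 3 is placed at the end that asks for it, or just
      -- before the edge if neither does.
      solve-cycle : ∀ d₀ → CycleFace d₀ → ∀ p → Solved U p
      solve-cycle d₀ cyc nothing with IH U′ cfg (fewer (d₀ , refl , refl)) nothing
        where open CycleComponent d₀ cyc
      ... | col′ , g′ , _ = _ , CycleComponent.Pattern.cycle-good d₀ cyc d₀ refl true g′ , tt
      solve-cycle d₀ cyc (just p) = byFace (walk (α e) ≟ walk d₀)
        where
        open Precoloured p
        open CycleComponent d₀ cyc renaming (live to keep-live)
        open Orbit (φ rot) φ-inj
        tail∉ : ¬ OnFace (α e) → ¬ A (tail e)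
        tail∉ off (d , q , r) with entering q
        ... | p₁ , qp , ep with two-darts q qp ep live (sym r)
        ...   | inj₂ refl = proj₁ (face-gray q) white
        ...   | inj₁ refl = off (trans (cong walk (α-inv p₁)) qp)
        hd∉ : ¬ OnFace (α e) → ¬ A (hd e)
        hd∉ off (d , q , r) with entering q
        ... | p₁ , qp , ep with two-darts q qp ep (liveD-α {U} live) (sym r)
        ...   | inj₂ refl = off q
        ...   | inj₁ s = proj₁ (face-gray qp) (subst (White U) (α-inj s) white)

        tail-e : tail e ≡ tail (φ rot (α e))
        tail-e = sym (trans (tail-φ (α e)) (hd-α e))

        at-face : ∀ s (on : OnFace s) b → OnFace (α e) → Pattern.cA s on b (tail e) ≡ α̂ →
            Pattern.cA s on b (hd e) ≡ β̂ → Solved U (just p)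
        at-face s on b one eα eβ with IH U′ cfg (fewer (d₀ , refl , refl)) nothing
        ... | col′ , g′ , _ = colour (Pattern.cA s on b) col′ , Pattern.cycle-good s on b g′ ,
              trans (colour-in (Pattern.cA s on b) col′ (φ rot (α e) , trans (walk-φ (α e)) one , sym tail-e)) eα ,
              trans (colour-in (Pattern.cA s on b) col′ (α e , one , refl)) eβ

        below-3 : ∀ {x} → Colour x → x ≢ 3 → x ≤ 2
        below-3 (_ , q) ne = ≤-pred (≤∧≢⇒< q ne)

        no-fix : ∀ d → φ rot d ≢ d
        no-fix d q = not-loop (trans (sym (tail-φ d)) (cong tail q))

        1<len : ∀ s → 1 < len s
        1<len s with m≤n⇒m<n∨m≡n (s≤s (z≤n {proj₁ (period s)}))
        ... | inj₁ lt = lt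
        ... | inj₂ eq = contradiction (trans (cong (λ k → iter (φ rot) k s) eq) (iter-len s)) (no-fix s)

        other-alt : ∀ b {x y} → alt b 0 ≡ y → 1 ≤ x → x ≤ 2 → x ≢ y → alt b 1 ≡ x
        other-alt true {1} refl _ _ ne = contradiction refl ne
        other-alt true {2} refl _ _ _ = refl
        other-alt false {1} refl _ _ _ = refl
        other-alt false {2} refl _ _ ne = contradiction refl ne
        other-alt _ {suc (suc (suc _))} _ _ (s≤s (s≤s ()))

        start-at-hd : OnFace (α e) → β̂ ≡ 3 → Solved U (just p)
        start-at-hd one β≡3 with alt-any 0 (proj₁ α̂-colour) (below-3 α̂-colour (λ q → different (trans q (sym β≡3))))
        ... | b , eq = at-face (α e) one b one
              (trans (cong cA tail-e) (trans (cA-at 1 (1<len (α e))) eq)) (trans (cA-at 0 (s≤s z≤n)) (sym β≡3))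
          where open Pattern (α e) one b

        start-at-tail : OnFace (α e) → α̂ ≡ 3 → Solved U (just p)
        start-at-tail one α≡3 = go (Pattern.position s on true {α e} one)
          where
          s : Fin m
          s = φ rot (α e)
          on : OnFace s
          on = trans (walk-φ (α e)) one
          go : ∃[ i ] (i < len s × iter (φ rot) i s ≡ α e) → Solved U (just p)
          go (zero , _ , q) = contradiction q (no-fix (α e))
          go (suc j , lt , q) with alt-any j (proj₁ β̂-colour) (below-3 β̂-colour (λ r → different (trans α≡3 (sym r))))
          ... | b , eq = at-face s on b one (trans (cong cA tail-e) (trans (cA-at 0 (s≤s z≤n)) (sym α≡3)))
                (trans (cong (cA ∘ tail) (sym q)) (trans (cA-at (suc j) lt) eq))
            where open Pattern s on b

        start-before : OnFace (α e) → α̂ ≢ 3 → β̂ ≢ 3 → Solved U (just p)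
        start-before one α≢3 β≢3 = go (pred (α e))
          where
          go : ∃[ s ] (φ rot s ≡ α e) → Solved U (just p)
          go (s , q) with alt-any 0 (proj₁ β̂-colour) (below-3 β̂-colour β≢3)
          ... | b , eq = at-face s on b one
                (trans (cong cA (trans tail-e (cong (tail ∘ φ rot) (sym q)))) (trans (cA-at 2 2<len)
                  (other-alt b eq (proj₁ α̂-colour) (below-3 α̂-colour α≢3) different)))
                (trans (cong (cA ∘ tail) (sym q)) (trans (cA-at 1 (1<len s)) eq))
            where
            on : OnFace s
            on = trans (sym (walk-φ s)) (trans (cong walk q) one)
            open Pattern s on b
            -- On a face of length two the dart other than `α e` would be `e`, which is white.
            2<len : 2 < len s
            2<len with m≤n⇒m<n∨m≡n (1<len s)
            ... | inj₁ lt = lt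
            ... | inj₂ len≡ = contradiction white (subst (¬_ ∘ White U) (same-edge (sym tail-e) hd-same)
                                (proj₁ (face-gray (trans (walk-φ (α e)) one))))
              where
              back : φ rot (α e) ≡ s
              back = trans (cong (φ rot) (sym q)) (trans (cong (λ k → iter (φ rot) k s) len≡) (iter-len s))
              hd-same : hd (φ rot (α e)) ≡ hd e
              hd-same = trans (sym (tail-φ _)) (cong tail (trans (cong (φ rot) back) q))

        byFace : Dec (OnFace (α e)) → Solved U (just p)
        byFace (no off) with IH U′ cfg (fewer (d₀ , refl , refl))
                               (just (restrict sub p (keep-live (proj₁ live) (tail∉ off) ,
                                   keep-live (proj₂ live) (hd∉ off))))
        ... | col′ , g′ , f , f′ = colour cA col′ , cycle-good g′ ,
              trans (colour-out cA col′ (tail∉ off)) f , trans (colour-out cA col′ (hd∉ off)) f′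
          where open Pattern d₀ refl true
        byFace (yes one) with α̂ ≟ⁿ 3 | β̂ ≟ⁿ 3
        ... | yes a | _ = start-at-tail one a
        ... | no _ | yes b = start-at-hd one b
        ... | no a | no b = start-before one a b

  -- Following the white boundary along big vertices

  inX? : ∀ v → Dec (InX G v)
  inX? v = 4 ≤? deg rot v

  -- Both middle vertices of this walk have two neighbours in G[X], so in a star forest they would
  -- coincide.
  star-contra : ∀ {p q r} → hd p ≡ tail q → hd q ≡ tail r → InX G (tail p) → InX G (tail q) → InX G (tail r) → InX G (hd r) →
                tail p ≢ tail r → tail q ≢ hd r → ⊥
  star-contra {p} {q} {r} pq qr xp xq xr xz ne ne′ =
    not-loop (trans qr (sym (star-forest (tail q) (tail r) xq xr ((xq , xr , q , refl , qr) ◅ ε)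
      (tail p , tail r , ne , (xq , xp , α p , pq , hd-α p) , (xq , xr , q , refl , qr))
      (tail q , hd r , ne′ , (xr , xq , α q , qr , hd-α q) , (xr , xz , r , refl , refl)))))

  module Walk {U : VSet} (C : Cfg U) (IH : ∀ U′ → Cfg U′ → count U < count U′ → ∀ p → Solved U′ p)
              (cut-free : CutFree U) (chord-free : ChordFree U) where
    open Free C cut-free chord-free
    open Inductive C IH
    open Block cut-free chord-free

    reduce-small : ∀ t → LiveD U t → White U t → Small t → ∀ p → Apart p (_≡ tail t) → Solved U p
    reduce-small t lt wt (inj₁ lo) p ap = reduce-lone t lt wt lo p ap
    reduce-small t lt wt (inj₂ (inj₁ rm)) p ap = reduce-removable t lt wt rm p ap
    reduce-small t lt wt (inj₂ (inj₂ (d₀ , cyc))) p ap = solve-cycle d₀ cyc p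

    Onward : Fin m → Set
    Onward d = ∃[ t ] (tail t ≡ hd d × LiveD U t × White U t × InX G (hd d) × hd t ≢ tail d)

    -- The next boundary vertex is reduced at once if it is outside X, and also if the walk turns
    -- back there, as it is then a leaf; otherwise it is big and the walk goes on.
    visit : ∀ p d → LiveD U d → White U d → Apart p (_≡ hd d) → Solved U p ⊎ Onward d
    visit p d ld wd ap with next-white ld wd
    ... | t , e , lt , wt with inX? (hd d) | hd t ≟ tail d
    ...   | yes x | no ne = inj₂ (t , e , lt , wt , x , ne)
    ...   | yes x | yes q = inj₁ (reduce-lone t lt wt (lone ld wd lt wt e q) p (subst (λ v → Apart p (_≡ v)) (sym e) ap))
    ...   | no ¬x | _ = inj₁ (reduce-small t lt wt (small t lt wt (¬x ∘ subst (InX G) e)) p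
        (subst (λ v → Apart p (_≡ v)) (sym e) ap))

    TwoAt : Fin m → Set
    TwoAt t = White U (α t) ⊎ ∃[ y ] (LiveD U y × tail y ≡ tail t × White U (α y) ×
                                     (∀ d → LiveD U d → tail d ≡ tail t → d ≡ t ⊎ d ≡ y))

    -- Degree at most 3 and one deleted neighbour leave at most two live darts.
    at-most-two : ∀ t → LiveD U t → White U t → ¬ InX G (tail t) → Slack U (tail t) → TwoAt t
    at-most-two t lt wt ¬x (inj₁ x) = contradiction x ¬x
    at-most-two t lt wt ¬x (inj₂ (b , eb , tb)) = go (rotation C t lt wt)
      where
      go : Rotation U t → TwoAt t
      go record { others = [] ; run = end w } = inj₁ w
      go record { others = y ∷ [] ; run = next _ (end w) ; at = at ; complete = complete } =
        inj₂ (y , proj₂ (at (there (here refl))) , proj₁ (at (there (here refl))) , w , λ d ld e → case complete e ld of λ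
          { (here p) → inj₁ p ; (there (here p)) → inj₂ p })
      go record { others = y ∷ z ∷ zs ; unique = unique ; at = at } with few-darts ¬x {b ∷ t ∷ y ∷ z ∷ zs}
            (All.tabulate (λ {x} m → λ { refl → not-both-ld {U} (proj₂ (proj₂ (at m))) tb }) ∷ unique)
            (λ { (here refl) → eb ; (there m) → proj₁ (at m) })
      ... | s≤s (s≤s (s≤s ()))

    module Edge (p : Precoloured U) where
      open Precoloured p

      a b : Fin n
      a = tail e
      b = hd e

      a-white : WhiteV U a
      a-white = proj₁ (ends-white p)
      b-white : WhiteV U b
      b-white = proj₂ (ends-white p)

      apart : ∀ {x} → x ≢ a → x ≢ b → Apart (just p) (_≡ x)
      apart p q = (λ r → p (sym r)) , λ r → q (sym r)

      Ends : Fin n → Set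
      Ends v = v ≡ a ⊎ v ≡ b

      ends? : ∀ v → Dec (Ends v)
      ends? v = (v ≟ a) ⊎-dec (v ≟ b)

      ends-white′ : ∀ {v} → Ends v → WhiteV U v
      ends-white′ (inj₁ refl) = a-white
      ends-white′ (inj₂ refl) = b-white

      module Both = Remove C Ends ends? ends-white′

      paint : Fin n → ℕ
      paint v = if does (v ≟ a) then α̂ else β̂

      paint-a : ∀ {v} → v ≡ a → paint v ≡ α̂
      paint-a {v} q rewrite dec-true (v ≟ a) q = refl

      paint-b : ∀ {v} → v ≡ b → paint v ≡ β̂
      paint-b {v} q rewrite dec-false (v ≟ a) (λ r → not-loop {e} (trans (sym q) r)) = refl

      paint-colour : ∀ {v} → Ends v → Colour (paint v)
      paint-colour (inj₁ q) = subst Colour (sym (paint-a q)) α̂-colour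
      paint-colour (inj₂ q) = subst Colour (sym (paint-b q)) β̂-colour

      -- White on both sides, the edge is a whole component of what remains, so it is deleted and
      -- painted as prescribed.
      single-edge : White U (α e) → Solved U (just p)
      single-edge w with IH Both.Plain.U′ Both.Plain.cfg (Both.Plain.fewer (inj₁ refl)) nothing
      ... | col′ , g′ , _ = colour paint col′ , good g′ paint-colour
              (λ d ld → λ { (inj₁ q) → inj₁ (from-a d ld q) ; (inj₂ q) → inj₁ (from-b d ld q) })
              (λ d gr → λ { (inj₁ q) → contradiction (subst (White U) (sym (proj₂ lone-a d (gray-live C gr) q)) white)
                  (proj₁ gr)
                          ; (inj₂ q) → contradiction (subst (White U) (sym (proj₂ lone-b d (gray-live C gr) q)) w)
                              (proj₁ gr) }) ,
              trans (colour-in paint col′ (inj₁ refl)) (paint-a refl) ,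
                  trans (colour-in paint col′ (inj₂ refl)) (paint-b refl)
        where
        open Both.Plain hiding (live)
        lone-a : Lone e
        lone-a = lone (liveD-α {U} live) w live white (sym (hd-α e)) refl
        lone-b : Lone (α e)
        lone-b = lone live white (liveD-α {U} live) w refl (hd-α e)
        from-a : ∀ d → LiveD U d → tail d ≡ a → Ends (hd d) × paint (tail d) ≢ paint (hd d)
        from-a d ld q with proj₂ lone-a d ld q
        ... | refl = inj₂ refl , λ r → different (trans (sym (paint-a refl)) (trans r (paint-b refl)))
        from-b : ∀ d → LiveD U d → tail d ≡ b → Ends (hd d) × paint (tail d) ≢ paint (hd d)
        from-b d ld q with proj₂ lone-b d ld q
        ... | refl = inj₁ (hd-α e) , λ r → different (trans (sym (paint-a (hd-α e))) (trans (sym r) (paint-b refl)))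

      precolour : ∀ {U′} → U ⊑ U′ → (q : Fin m) → LiveD U′ q → White U q → ∀ {x y} → Colour x → Colour y → x ≢ y →
                  InX G (tail q) ⊎ InX G (hd q) → Precoloured U′
      precolour s q lq wq cx cy ne xs = record
        { e = q ; live = lq ; white = reg-mono s wq ; α̂-colour = cx ; β̂-colour = cy ; different = ne
        ; slack = [ inj₁ ∘ inj₁ , inj₂ ∘ inj₁ ]′ xs }

      Keeps : VSet → (Fin n → Set) → Set
      Keeps U′ A = ∀ {v} → WhiteV U v → ¬ A v → Live U′ v

      -- Delete the small white vertex tail t, whose last white neighbour is tail dz,
      -- after precolouring the edge q of the rest with x and y; it gets colour z.
      finish-one : ∀ t → LiveD U t → White U t → ¬ InX G (tail t) → ¬ Lone t → ∀ dz → LiveD U dz → White U dz →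
          hd dz ≡ tail t →
        ∀ q → LiveD U q → White U q → tail q ≢ tail t → hd q ≢ tail t → InX G (tail q) ⊎ InX G (hd q) →
        ∀ {x y z} → Colour x → Colour y → x ≢ y → Colour z →
        (∀ U′ → Keeps U′ (_≡ tail t) → ∀ col′ → Good U′ col′ → col′ (tail q) ≡ x → col′ (hd q) ≡ y →
           z ≢ col′ (hd t) × z ≢ col′ (tail dz) ×
           (∀ col → col (tail t) ≡ z → (∀ {v} → Live U′ v → col v ≡ col′ v) → Fits (just p) col)) →
        Solved U (just p)
      finish-one t lt wt ¬x ¬lone dz lz wz ez q lq wq q≢ q≢′ xs {x} {y} {z} cx cy ne cz plan with small t lt wt ¬x
      ... | inj₁ lo = contradiction lo ¬lone
      ... | inj₂ (inj₂ (d₀ , cyc)) = solve-cycle d₀ cyc (just p)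
      ... | inj₂ (inj₁ rm) = conclude (R.solve-one (_≡ z) (just pre) choose)
        where
        module R = RemoveOne t lt wt rm
        pre : Precoloured R.U′
        pre = precolour R.sub q (R.keep (q , refl , lq , wq) q≢ , R.keep (white-end lq wq) q≢′) wq cx cy ne xs
        g≡ : hd (Removable.g rm) ≡ tail dz
        g≡ = cong tail (unique-into (liveD-α {U} (Removable.g-live rm)) lz (Removable.g-white rm) wz
               (trans (hd-α _) (trans (Removable.g-at rm) (sym ez))))
        choose : ∀ col′ → Good R.U′ col′ → Fits (just pre) col′ →
                 ∃[ z′ ] (Colour z′ × z′ ≡ z × z′ ≢ col′ (hd t) × z′ ≢ col′ (hd (Removable.g rm)))
        choose col′ g′ (f , f′) = z , cz , refl , proj₁ (plan R.U′ R.keep col′ g′ f f′) ,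
          λ r → proj₁ (proj₂ (plan R.U′ R.keep col′ g′ f f′)) (trans r (cong col′ g≡))
        conclude : ∃[ col ] (Good U col × ∃[ col′ ] ((Good R.U′ col′ × Fits (just pre) col′) ×
            (∀ {v} → Live R.U′ v → col v ≡ col′ v) × col (tail t) ≡ z)) →
                   Solved U (just p)
        conclude (col , g , col′ , (g′ , f , f′) , agree , cz′) = col , g ,
            proj₂ (proj₂ (plan R.U′ R.keep col′ g′ f f′)) col cz′ agree

      AtA AtB : VSet → (Fin n → ℕ) → Fin n → Fin m → Set
      AtA U′ col′ r d = tail d ≡ a → hd d ≡ r ⊎ hd d ≡ b ⊎ (Live U′ (hd d) × α̂ ≢ col′ (hd d))
      AtB U′ col′ r d = tail d ≡ b → hd d ≡ r ⊎ hd d ≡ a ⊎ (Live U′ (hd d) × β̂ ≢ col′ (hd d))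

      -- The precolouring passes from `e` to `q`: both ends of `e` are deleted with one inner vertex
      -- and keep their prescribed colours, and `plan` compares these with what `q` forces on their
      -- neighbours.
      finish-two : ∀ dA dr → Ends (tail dA) → Gray U dr → ¬ WhiteV U (tail dr) → walk dA ≡ walk dr →
        (∀ d → Gray U d → Ends (tail d) → Hits (tail dr) d) →
        ∀ q → LiveD U q → White U q → ¬ Ends (tail q) → ¬ Ends (hd q) → InX G (tail q) ⊎ InX G (hd q) →
        ∀ {x y} → Colour x → Colour y → x ≢ y →
        (∀ U′ → Keeps U′ Ends → ∀ col′ → Good U′ col′ → col′ (tail q) ≡ x → col′ (hd q) ≡ y → ∀ d → LiveD U d →
           AtA U′ col′ (tail dr) d ×
           AtB U′ col′ (tail dr) d) →
        Solved U (just p)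
      finish-two dA dr inA gr inner same meets q lq wq q∉ q∉′ xs cx cy ne plan =
        conclude (IH W.U′ W.cfg W.fewer (just pre))
        where
        module W = Both.WithTop dA dr inA gr inner same meets
        live-of : ∀ {v} → WhiteV U v → Live U v
        live-of (_ , refl , (l , _) , _) = l
        keep : Keeps W.U′ Ends
        keep wv ¬a = W.live (live-of wv) ¬a (W.white≢r wv)
        pre : Precoloured W.U′
        pre = precolour W.sub q (keep (q , refl , lq , wq) q∉ , keep (white-end lq wq) q∉′) wq cx cy ne xs
        conclude : Solved W.U′ (just pre) → Solved U (just p)
        conclude (col′ , g′ , f , f′) = W.colour paint col′ , W.good g′ paint-colour nbr ,
            trans (W.colour-in paint col′ (inj₁ refl)) (paint-a refl) ,
                trans (W.colour-in paint col′ (inj₂ refl)) (paint-b refl)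
          where
          nbr : ∀ d → LiveD U d → Ends (tail d) → W.ProperAt paint col′ d
          nbr d ld (inj₁ q) with proj₁ (plan W.U′ keep col′ g′ f f′ d ld) q
          ... | inj₁ r = inj₁ r
          ... | inj₂ (inj₁ r) = inj₂ (inj₁ (inj₂ r , λ s → different (trans (sym (paint-a q)) (trans s (paint-b r)))))
          ... | inj₂ (inj₂ (l , r)) = inj₂ (inj₂ (l , λ s → r (trans (sym (paint-a q)) s)))
          nbr d ld (inj₂ q) with proj₂ (plan W.U′ keep col′ g′ f f′ d ld) q
          ... | inj₁ r = inj₁ r
          ... | inj₂ (inj₁ r) = inj₂ (inj₁ (inj₁ r , λ s → different (trans (sym (paint-a r)) (trans (sym s) (paint-b q)))))
          ... | inj₂ (inj₂ (l , r)) = inj₂ (inj₂ (l , λ s → r (trans (sym (paint-b q)) s)))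

      -- The white walk from e = ab, with other side gray, goes on to x₁, x₂, x₃, … .
      module Gray-side (gray : ¬ White U (α e)) (d₁ : Fin m) (t₁ : tail d₁ ≡ b) (l₁ : LiveD U d₁) (w₁ : White U d₁) where

        not-lone-a : ¬ Lone e
        not-lone-a (w , _) = gray w

        not-lone-b : ¬ Lone d₁
        not-lone-b (_ , only) = gray (subst (White U) (sym (only (α e) (liveD-α {U} live) (sym t₁))) w₁)

        into-b : ∀ {d} → LiveD U d → White U d → tail d ≢ a → hd d ≢ b
        into-b ld wd ne q = ne (cong tail (unique-into ld live wd white q))

        x₁≢a : hd d₁ ≢ a
        x₁≢a q = gray (subst (White U) (same-edge t₁ (trans q (sym (hd-α e)))) w₁)

        x₁≢b : hd d₁ ≢ b
        x₁≢b q = not-loop (trans q (sym t₁))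

        third : ∃[ γ ] (Colour γ × γ ≢ α̂ × γ ≢ β̂)
        third = avoid α̂ β̂

        γ : ℕ
        γ = proj₁ third
        γ-colour : Colour γ
        γ-colour = proj₁ (proj₂ third)
        γ≢α̂ : γ ≢ α̂
        γ≢α̂ = proj₁ (proj₂ (proj₂ third))
        γ≢β̂ : γ ≢ β̂
        γ≢β̂ = proj₂ (proj₂ (proj₂ third))

        -- A triangle in G[X] is impossible, so `a` or `b` is small. Deleting `a`, the edge from `b`
        -- to x₁ gets `β̂`, `γ`; deleting `b`, the edge from x₁ to `a` gets `γ`, `α̂`. The deleted
        -- end sees only the other two colours.
        triangle : ∀ d₂ → tail d₂ ≡ hd d₁ → LiveD U d₂ → White U d₂ → InX G (hd d₁) → hd d₂ ≡ a → Solved U (just p)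
        triangle d₂ t₂ l₂ w₂ x₁ q with inX? a | inX? b
        ... | no ¬a | _ = finish-one e live white ¬a not-lone-a d₂ l₂ w₂ q d₁ l₁ w₁
            (λ r → not-loop {e} (trans (sym t₁) r)) x₁≢a (inj₂ x₁)
                β̂-colour γ-colour (γ≢β̂ ∘ sym) α̂-colour λ U′ keep col′ g f f′ →
                  (λ r → different (trans r (trans (cong col′ (sym t₁)) f))) ,
                  (λ r → γ≢α̂ (sym (trans r (trans (cong col′ t₂) f′)))) ,
                  λ col ca agree → ca , trans (agree (keep b-white (not-loop {e}))) (trans (cong col′ (sym t₁)) f)
        ... | yes _ | no ¬b = finish-one d₁ l₁ w₁ (¬b ∘ subst (InX G) t₁) not-lone-b e live white (sym t₁) d₂ l₂ w₂
                (λ r → x₁≢b (trans (sym t₂) (trans r t₁))) (λ r → not-loop {e} (sym (trans (sym q) (trans r t₁))))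
                    (inj₁ (subst (InX G) (sym t₂) x₁))
                γ-colour α̂-colour γ≢α̂ β̂-colour λ U′ keep col′ g f f′ →
                  (λ r → γ≢β̂ (sym (trans r (trans (cong col′ (sym t₂)) f)))) ,
                  (λ r → different (sym (trans r (trans (cong col′ (sym q)) f′)))) ,
                  λ col cb agree → trans (agree (keep a-white (λ r → not-loop {e} (sym (trans r t₁)))))
                      (trans (cong col′ (sym q)) f′) ,
                                   trans (cong col (sym t₁)) cb
        ... | yes xa | yes xb = ⊥-elim (star-contra {e} {d₁} {d₂} (sym t₁) (sym t₂) xa (subst (InX G) (sym t₁) xb)
            (subst (InX G) (sym t₂) x₁)
                (subst (InX G) (sym q) xa) (λ r → x₁≢a (trans (sym t₂) (sym r)))
                    (λ r → not-loop {e} (trans (sym t₁) (trans r q))))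

        -- When `a` is deleted, colour `α̂` on x₁ keeps it away from x₂, the other neighbour of `a`.
        -- When `b` is deleted, colour `β̂` on x₂ keeps it away from x₁.
        square : ∀ d₂ d₃ → tail d₂ ≡ hd d₁ → LiveD U d₂ → White U d₂ → tail d₃ ≡ hd d₂ → LiveD U d₃ → White U d₃ →
                 InX G (hd d₁) → InX G (hd d₂) → hd d₂ ≢ a → hd d₂ ≢ b → hd d₃ ≡ a → Solved U (just p)
        square d₂ d₃ t₂ l₂ w₂ t₃ l₃ w₃ x₁ x₂ x₂≢a x₂≢b q with inX? a | inX? b
        ... | no ¬a | _ = finish-one e live white ¬a not-lone-a d₃ l₃ w₃ q d₁ l₁ w₁
            (λ r → not-loop {e} (trans (sym t₁) r)) x₁≢a (inj₂ x₁)
                β̂-colour α̂-colour (different ∘ sym) α̂-colour λ U′ keep col′ g f f′ →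
                  (λ r → different (trans r (trans (cong col′ (sym t₁)) f))) ,
                  (λ r → proper g d₂ (keep (d₂ , refl , l₂ , w₂) (x₁≢a ∘ trans (sym t₂)) , keep (white-end l₂ w₂) x₂≢a)
                           (trans (cong col′ t₂) (trans f′ (trans r (cong col′ t₃))))) ,
                  λ col ca agree → ca , trans (agree (keep b-white (not-loop {e}))) (trans (cong col′ (sym t₁)) f)
        ... | yes _ | no ¬b = finish-one d₁ l₁ w₁ (¬b ∘ subst (InX G) t₁) not-lone-b e live white (sym t₁) d₃ l₃ w₃
                (λ r → x₂≢b (trans (sym t₃) (trans r t₁))) (λ r → not-loop {e} (sym (trans (sym q) (trans r t₁))))
                    (inj₁ (subst (InX G) (sym t₃) x₂))
                β̂-colour α̂-colour (different ∘ sym) β̂-colour λ U′ keep col′ g f f′ →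
                  (λ r → proper g d₂ (keep (d₂ , refl , l₂ , w₂) (λ s → x₁≢b (trans (sym t₂) (trans s t₁))) ,
                      keep (white-end l₂ w₂) (λ s → x₂≢b (trans s t₁)))
                           (trans (cong col′ t₂) (trans (sym r) (trans (sym f) (cong col′ t₃))))) ,
                  (λ r → different (sym (trans r (trans (cong col′ (sym q)) f′)))) ,
                  λ col cb agree → trans (agree (keep a-white (λ r → not-loop {e} (sym (trans r t₁)))))
                      (trans (cong col′ (sym q)) f′) ,
                                   trans (cong col (sym t₁)) cb
        ... | yes xa | yes xb = ⊥-elim (star-contra {e} {d₁} {d₂} (sym t₁) (sym t₂) xa (subst (InX G) (sym t₁) xb)
            (subst (InX G) (sym t₂) x₁)
                x₂ (λ r → x₁≢a (trans (sym t₂) (sym r))) (λ r → x₂≢b (trans (sym r) t₁)))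

        -- With three vertices in between, no single precoloured edge controls both the end that is
        -- kept and the far neighbour of the deleted one, so `a` and `b` go together.
        pentagon : ∀ d₂ d₃ d₄ → tail d₂ ≡ hd d₁ → LiveD U d₂ → White U d₂ → tail d₃ ≡ hd d₂ → LiveD U d₃ → White U d₃ →
                   tail d₄ ≡ hd d₃ → LiveD U d₄ → White U d₄ → InX G (hd d₁) → InX G (hd d₂) → InX G (hd d₃) →
                   hd d₂ ≢ a → hd d₂ ≢ b → hd d₃ ≢ a → hd d₃ ≢ b → hd d₃ ≢ hd d₁ → hd d₄ ≡ a → Solved U (just p)
        pentagon d₂ d₃ d₄ t₂ l₂ w₂ t₃ l₃ w₃ t₄ l₄ w₄ x₁ x₂ x₃ x₂≢a x₂≢b x₃≢a x₃≢b x₃≢x₁ q = by-slack slack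
          where
          ¬xa : ¬ InX G a
          ¬xa xa = star-contra {d₂} {d₃} {d₄} (sym t₃) (sym t₄) (subst (InX G) (sym t₂) x₁)
              (subst (InX G) (sym t₃) x₂) (subst (InX G) (sym t₄) x₃)
            (subst (InX G) (sym q) xa) (λ r → x₃≢x₁ (sym (trans (sym t₂) (trans r t₄))))
                (λ r → x₂≢a (trans (sym t₃) (trans r q)))
          ¬xb : ¬ InX G b
          ¬xb xb = star-contra {d₁} {d₂} {d₃} (sym t₂) (sym t₃) (subst (InX G) (sym t₁) xb)
              (subst (InX G) (sym t₂) x₁) (subst (InX G) (sym t₃) x₂)
            x₃ (λ r → x₂≢b (sym (trans (sym t₁) (trans r t₃)))) (λ r → x₃≢x₁ (trans (sym r) t₂))
          v₁ : WhiteV U (hd d₁)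
          v₁ = white-end l₁ w₁
          v₂ : WhiteV U (hd d₂)
          v₂ = white-end l₂ w₂
          v₃ : WhiteV U (hd d₃)
          v₃ = white-end l₃ w₃
          x₁∉ : ¬ Ends (hd d₁)
          x₁∉ = [ x₁≢a , x₁≢b ]′
          x₂∉ : ¬ Ends (hd d₂)
          x₂∉ = [ x₂≢a , x₂≢b ]′
          x₃∉ : ¬ Ends (hd d₃)
          x₃∉ = [ x₃≢a , x₃≢b ]′
          back : Fin m
          back = φ rot (α e)
          back-tail : tail back ≡ a
          back-tail = trans (tail-φ (α e)) (hd-α e)
          back-gray : Gray U back
          back-gray = gray-walk C (sym (walk-φ (α e))) (gray , proj₂ live)

          -- The only gray face at `a` lies behind `e`, and the inner vertex deleted with `b` is on
          -- it. Precolouring x₂ x₃ with `β̂`, `γ` suits both ends: x₁ cannot get `β̂` next to x₂,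
          -- and x₃ has `γ`, not `α̂`.
          slack-a : Slack U a → Solved U (just p)
          slack-a sa with at-most-two e live white ¬xa sa | small d₁ l₁ w₁ (¬xb ∘ subst (InX G) t₁)
          ... | inj₁ w | _ = contradiction w gray
          ... | inj₂ _ | inj₁ lo = contradiction lo not-lone-b
          ... | inj₂ _ | inj₂ (inj₂ (d₀ , cyc)) = solve-cycle d₀ cyc (just p)
          ... | inj₂ (y , ly , ty , wy , only) | inj₂ (inj₁ rm) =
            finish-two dx dr (inj₂ (trans dx-at t₁)) gray-r inner same meets′ d₃ l₃ w₃ (x₂∉ ∘ subst Ends t₃) x₃∉ (inj₂ x₃)
              β̂-colour γ-colour (γ≢β̂ ∘ sym) plan
            where
            open Removable rm
            y-end : hd y ≡ hd d₃
            y-end = trans (cong tail (unique-into (liveD-α {U} ly) l₄ wy w₄ (trans (hd-α y) (trans ty (sym q))))) t₄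
            g-end : hd g ≡ a
            g-end = cong tail (unique-into (liveD-α {U} g-live) live g-white white (trans (hd-α g) (trans g-at t₁)))
            meets′ : ∀ d → Gray U d → Ends (tail d) → Hits (tail dr) d
            meets′ d gr (inj₂ r) = meets d gr (trans r (sym t₁))
            meets′ d gr (inj₁ r) with only d (gray-live C gr) r | only back (gray-live C back-gray) back-tail
            ... | inj₁ refl | _ = contradiction white (proj₁ gr)
            ... | inj₂ _ | inj₁ s = contradiction (subst (White U) (sym s) white) (proj₁ back-gray)
            ... | inj₂ refl | inj₂ s with meets (α e) (gray , proj₂ live) (sym t₁)
            ...   | d′ , u , v = d′ , trans u (trans (sym (walk-φ (α e))) (cong walk s)) , v
            plan : ∀ U′ → Keeps U′ Ends → ∀ col′ → Good U′ col′ → col′ (tail d₃) ≡ β̂ → col′ (hd d₃) ≡ γ → ∀ d → LiveD U d →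
              AtA U′ col′ (tail dr) d ×
              AtB U′ col′ (tail dr) d
            plan U′ keep col′ g f f′ d ld = at-a , at-b
              where
              at-a : AtA U′ col′ (tail dr) d
              at-a r with only d ld r
              ... | inj₁ refl = inj₂ (inj₁ refl)
              ... | inj₂ refl = inj₂ (inj₂ (subst (Live U′) (sym y-end) (keep v₃ x₃∉) ,
                                  λ s → γ≢α̂ (sym (trans s (trans (cong col′ y-end) f′)))))
              at-b : AtB U′ col′ (tail dr) d
              at-b r with nbrs d ld (trans r (sym t₁))
              ... | inj₁ refl = inj₂ (inj₂ (keep v₁ x₁∉ , λ s →
                      proper g d₂ (subst (Live U′) (sym t₂) (keep v₁ x₁∉) , keep v₂ x₂∉)
                        (trans (cong col′ t₂) (trans (sym s) (trans (sym f) (cong col′ t₃))))))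
              ... | inj₂ (inj₁ refl) = inj₂ (inj₁ g-end)
              ... | inj₂ (inj₂ s) = inj₁ s

          -- The mirror image: x₁ x₂ gets `γ`, `α̂`, so x₁ differs from `β̂`, and x₃, next to x₂,
          -- from `α̂`.
          slack-b : Slack U b → Solved U (just p)
          slack-b sb with at-most-two d₁ l₁ w₁ (¬xb ∘ subst (InX G) t₁) (subst (Slack U) (sym t₁) sb) | small e live
              white ¬xa
          ... | _ | inj₁ lo = contradiction lo not-lone-a
          ... | _ | inj₂ (inj₂ (d₀ , cyc)) = solve-cycle d₀ cyc (just p)
          ... | two | inj₂ (inj₁ rm) =
            finish-two dx dr (inj₁ dx-at) gray-r inner same meets′ d₂ l₂ w₂ (x₁∉ ∘ subst Ends t₂) x₂∉ (inj₂ x₂)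
              γ-colour α̂-colour γ≢α̂ plan
            where
            open Removable rm
            only : ∀ d → LiveD U d → tail d ≡ b → d ≡ d₁ ⊎ d ≡ α e
            only d ld r = from two
              where
              from : TwoAt d₁ → d ≡ d₁ ⊎ d ≡ α e
              from (inj₁ w) = contradiction (cong tail (unique-into (liveD-α {U} l₁) live w white (trans (hd-α d₁) t₁))) x₁≢a
              from (inj₂ (y , _ , _ , _ , all)) with all d ld (trans r (sym t₁)) | all (α e) (liveD-α {U} live) (sym t₁)
              ... | inj₁ s | _ = inj₁ s
              ... | inj₂ _ | inj₁ s = contradiction (subst (White U) (sym s) w₁) gray
              ... | inj₂ s | inj₂ s′ = inj₂ (trans s (sym s′))
            g-end : hd g ≡ hd d₃
            g-end = trans (cong tail (unique-into (liveD-α {U} g-live) l₄ g-white w₄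
                (trans (hd-α g) (trans g-at (sym q))))) t₄
            meets′ : ∀ d → Gray U d → Ends (tail d) → Hits (tail dr) d
            meets′ d gr (inj₁ r) = meets d gr r
            meets′ d gr (inj₂ r) with only d (gray-live C gr) r
            ... | inj₁ refl = contradiction w₁ (proj₁ gr)
            ... | inj₂ refl with meets back back-gray back-tail
            ...   | d′ , u , v = d′ , trans u (walk-φ (α e)) , v
            plan : ∀ U′ → Keeps U′ Ends → ∀ col′ → Good U′ col′ → col′ (tail d₂) ≡ γ → col′ (hd d₂) ≡ α̂ → ∀ d → LiveD U d →
              AtA U′ col′ (tail dr) d ×
              AtB U′ col′ (tail dr) d
            plan U′ keep col′ gd f f′ d ld = at-a , at-b
              where
              at-a : AtA U′ col′ (tail dr) d
              at-a r with nbrs d ld r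
              ... | inj₁ refl = inj₂ (inj₁ refl)
              ... | inj₂ (inj₁ refl) = inj₂ (inj₂ (subst (Live U′) (sym g-end) (keep v₃ x₃∉) , λ s →
                      proper gd d₃ (subst (Live U′) (sym t₃) (keep v₂ x₂∉) , keep v₃ x₃∉)
                        (trans (cong col′ t₃) (trans f′ (trans s (cong col′ g-end))))))
              ... | inj₂ (inj₂ s) = inj₁ s
              at-b : AtB U′ col′ (tail dr) d
              at-b r with only d ld r
              ... | inj₁ refl = inj₂ (inj₂ (keep v₁ x₁∉ , λ s → γ≢β̂ (sym (trans s (trans (cong col′ (sym t₂)) f)))))
              ... | inj₂ refl = inj₂ (inj₁ (hd-α e))

          by-slack : Slack U a ⊎ Slack U b → Solved U (just p)
          by-slack (inj₁ s) = slack-a s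
          by-slack (inj₂ s) = slack-b s

        solve-outer : Solved U (just p)
        solve-outer with visit (just p) d₁ l₁ w₁ (apart x₁≢a x₁≢b)
        ... | inj₁ s = s
        ... | inj₂ (d₂ , t₂ , l₂ , w₂ , x₁ , n₂) with hd d₂ ≟ a
        ...   | yes q = triangle d₂ t₂ l₂ w₂ x₁ q
        ...   | no x₂≢a with visit (just p) d₂ l₂ w₂ (apart x₂≢a (λ r → n₂ (trans r (sym t₁))))
        ...     | inj₁ s = s
        ...     | inj₂ (d₃ , t₃ , l₃ , w₃ , x₂ , n₃) with hd d₃ ≟ a
        ...       | yes q = square d₂ d₃ t₂ l₂ w₂ t₃ l₃ w₃ x₁ x₂ x₂≢a (λ r → n₂ (trans r (sym t₁))) q
        ...       | no x₃≢a with visit (just p) d₃ l₃ w₃ (apart x₃≢a (into-b l₃ w₃ (λ r → x₂≢a (trans (sym t₃) r))))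
        ...         | inj₁ s = s
        ...         | inj₂ (d₄ , t₄ , l₄ , w₄ , x₃ , n₄) with hd d₄ ≟ a
        ...           | yes q = pentagon d₂ d₃ d₄ t₂ l₂ w₂ t₃ l₃ w₃ t₄ l₄ w₄ x₁ x₂ x₃ x₂≢a (λ r → n₂ (trans r (sym t₁))) x₃≢a
                                (into-b l₃ w₃ (λ r → x₂≢a (trans (sym t₃) r))) (λ r → n₃ (trans r (sym t₂))) q
        ...           | no x₄≢a with visit (just p) d₄ l₄ w₄ (apart x₄≢a (into-b l₄ w₄ (λ r → x₃≢a (trans (sym t₄) r))))
        ...             | inj₁ s = s
        -- Otherwise x₁ x₂ x₃ x₄ would be a path in G[X].
        ...             | inj₂ (_ , _ , _ , _ , x₄ , _) = ⊥-elim (star-contra {d₂} {d₃} {d₄} (sym t₃) (sym t₄)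
                              (subst (InX G) (sym t₂) x₁) (subst (InX G) (sym t₃) x₂) (subst (InX G) (sym t₄) x₃) x₄
                              (λ r → n₃ (trans (sym t₄) (sym r))) (λ r → n₄ (sym r)))

      solve-edge : Solved U (just p)
      solve-edge with white? U (α e) | next-white live white
      ... | yes w | _ = single-edge w
      ... | no ¬w | d₁ , t₁ , l₁ , w₁ = Gray-side.solve-outer ¬w d₁ t₁ l₁ w₁

    free-solve : ∀ p → Solved U p
    free-solve (just p) = Edge.solve-edge p
    free-solve nothing with any? (λ d → liveD? U d ×-dec white? U d)
    -- By `live-white` there is then no live dart at all, and a constant colouring will do.
    ... | no none = (λ _ → 1) , record
            { range = λ _ → s≤s z≤n , s≤s z≤n ; low = λ _ _ _ → s≤s z≤n
            ; proper = λ d ld _ → none (live-white C ld)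
            ; maxima = λ d gr → contradiction (live-white C (gray-live C gr)) none } , tt
    ... | yes (t , lt , wt) with inX? (tail t)
    ...   | no ¬x = reduce-small t lt wt (small t lt wt ¬x) nothing tt
    -- A big vertex has slack by definition, so any two colours may be prescribed on its white edge.
    ...   | yes x with Edge.solve-edge (record { e = t ; live = lt ; white = wt ; α̂ = 1 ; β̂ = 2
                          ; α̂-colour = s≤s z≤n , s≤s z≤n ; β̂-colour = s≤s z≤n , s≤s (s≤s z≤n) ; different =
                              λ () ; slack = inj₁ (inj₁ x) })
    ...     | col , g , _ = col , g , tt

  step : ∀ {U} (C : Cfg U) → (∀ U′ → Cfg U′ → count U < count U′ → ∀ p → Solved U′ p) → ∀ p → Solved U p
  step {U} C IH p with any? (λ w → any? λ w′ → (liveD? U w ×-dec liveD? U w′) ×-dec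
      ((white? U w ×-dec white? U w′) ×-dec ((tail w ≟ tail w′) ×-dec ¬? (w ≟ w′))))
  ... | yes (w , w′ , (lw , lw′) , (ww , ww′) , e , ne) = Inductive.solve-cut C IH e lw lw′
      (cut-vertex C lw lw′ ww ww′ e ne) p
  ... | no no-cut with any? (λ e → (liveD? U e ×-dec (¬? (white? U e) ×-dec ¬? (white? U (α e)))) ×-dec
      (whiteV? U (tail e) ×-dec whiteV? U (hd e)))
  ...   | yes (e , (le , ¬w , ¬w′) , (wa , qa , la , ha) , (wb , qb , lb , hb)) =
            Inductive.solve-chord C IH (wa , qa , la , ha) (wb , qb , lb , hb) (chord C le ¬w ¬w′ qa la ha qb lb hb) p
  ...   | no no-chord = Walk.free-solve C IH cut-free chord-free p
    where
    cut-free : CutFree U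
    cut-free {w} {w′} lw lw′ ww ww′ e with w ≟ w′
    ... | yes q = q
    ... | no ne = contradiction (w , w′ , (lw , lw′) , (ww , ww′) , e , ne) no-cut
    chord-free : ChordFree U
    chord-free {e} le ¬w wa wb with white? U (α e)
    ... | yes w = w
    ... | no ¬w′ = contradiction (e , (le , ¬w , ¬w′) , wa , wb) no-chord

  -- The fuel `k` bounds the number of live vertices.
  solve-within : ∀ k U → Cfg U → n ≤ k + count U → ∀ p → Solved U p
  solve-within zero U C h nothing = (λ _ → 1) , record
    { range = λ _ → s≤s z≤n , s≤s z≤n ; low = λ _ _ _ → s≤s z≤n
    ; proper = λ d ld _ → not-both-ld {U} (proj₁ ld) (count-full U h _)
    ; maxima = λ d gr → contradiction (count-full U h _) (not-both-ld {U} (proj₂ gr)) } , tt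
  solve-within zero U C h (just p) = contradiction (count-full U h _) (not-both-ld {U} (proj₁ (Precoloured.live p)))
  solve-within (suc k) U C h p = step C (λ U′ C′ lt → solve-within k U′ C′
      (≤-trans (subst (n ≤_) (sym (+-suc k _)) h) (+-monoʳ-≤ k lt))) p

  solve : ∀ {U} → Cfg U → ∃[ col ] Good U col
  solve {U} C with solve-within n U C (m≤m+n n _) nothing
  ... | col , g , _ = col , g

-- Cardinalities under insertion

count-one-more : ∀ {N} {U V : Fin N → Bool} i → U i ≡ false → V i ≡ true → (∀ j → j ≢ i → V j ≡ U j) →
    count V ≡ suc (count U)
count-cong : ∀ {N} {U V : Fin N → Bool} → (∀ j → V j ≡ U j) → count V ≡ count U
count-cong {zero} h = refl
count-cong {suc N} {U} {V} h rewrite h zero with U zero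
... | true = cong suc (count-cong (h ∘ suc))
... | false = count-cong (h ∘ suc)
count-one-more {suc N} zero u v h rewrite u | v = cong suc (count-cong (λ j → h (suc j) λ ()))
count-one-more {suc N} {U} {V} (suc i) u v h rewrite h zero (λ ()) with U zero
... | true = cong suc (count-one-more i u v (λ j ne → h (suc j) (λ { refl → ne refl })))
... | false = count-one-more i u v (λ j ne → h (suc j) (λ { refl → ne refl }))

count-none : ∀ N → count {N} (λ _ → false) ≡ 0
count-none zero = refl
count-none (suc N) = count-none N

count-all : ∀ {N} {U : Fin N → Bool} → (∀ j → U j ≡ true) → count U ≡ N
count-all {zero} h = refl
count-all {suc N} h rewrite h zero = cong suc (count-all (h ∘ suc))

insert : ∀ {N} → (Fin N → Bool) → Fin N → Fin N → Bool
insert U i = dec-∪ U (_≟ i)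

insert-self : ∀ {N} (U : Fin N → Bool) i → insert U i i ≡ true
insert-self U i = ∪-trueʳ {U = U} (_≟ i) refl

insert-old : ∀ {N} (U : Fin N → Bool) i {j} → U j ≡ true → insert U i j ≡ true
insert-old U i = ∪-trueˡ {U = U} (_≟ i)

insert-other : ∀ {N} (U : Fin N → Bool) i j → j ≢ i → insert U i j ≡ U j
insert-other U i j ne with U j
... | true = refl
... | false rewrite dec-false (j ≟ i) ne = refl

insert-inv : ∀ {N} (U : Fin N → Bool) i {j} → insert U i j ≡ true → U j ≡ true ⊎ j ≡ i
insert-inv U i = ∪-true⁻ {U = U} (_≟ i)

count-insert : ∀ {N} (U : Fin N → Bool) i → U i ≡ false → count (insert U i) ≡ suc (count U)
count-insert U i u = count-one-more i u (insert-self U i) (insert-other U i)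

bool-cases : ∀ b → b ≡ true ⊎ b ≡ false
bool-cases true = inj₁ refl
bool-cases false = inj₂ refl

-- Assembling the components along the tree of components and faces

module Assembly (G : PlaneGraph) (star-forest : XStarForest G) where
  open PlaneGraph G
  open Planar G

  OnBoundary : Fin n → Fin B → Set
  OnBoundary v b = (∃[ d ] (tail d ≡ v × walk d ≡ b)) ⊎ (Isolated rot v × isoB v ≡ b)

  On : (Fin B → Set) → Fin n → Set
  On S v = ∃[ b ] (S b × OnBoundary v b)

  InFace : (Fin B → Bool) → Fin F → Fin B → Set
  InFace used f b = used b ≡ true × face b ≡ f

  Peak : (Fin n → ℕ) → (Fin B → Set) → Set
  Peak col S = ∃[ v ] (On S v × (∀ w → On S w → col w ≤ col v × (col w ≡ col v → w ≡ v)))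

  peak-cong : ∀ {col col′ S} → (∀ v → On S v → col v ≡ col′ v) → Peak col S → Peak col′ S
  peak-cong same (v , o , h) = v , o , λ w ow →
    subst₂ _≤_ (same w ow) (same v o) (proj₁ (h w ow)) , λ e → proj₂ (h w ow) (trans (same w ow) (trans e (sym (same v o))))

  peak-iff : ∀ {col S S′} → (∀ {v} → On S v → On S′ v) → (∀ {v} → On S′ v → On S v) → Peak col S → Peak col S′
  peak-iff to from (v , o , h) = v , to o , λ w ow → h w (from ow)

  isolated-alone : ∀ {u v} → Isolated rot u → comp u ≡ comp v → u ≡ v
  isolated-alone {u} {v} i e with comp-conn u v e
  ... | ε = refl
  ... | (d , q , _) ◅ _ = contradiction q (i d)

  on-comp : ∀ {v b} → OnBoundary v b → comp v ≡ bcomp b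
  on-comp (inj₁ (d , refl , refl)) = sym (bcomp-walk d)
  on-comp (inj₂ (i , refl)) = sym (bcomp-iso _ i)

  on-walk : ∀ {v d} → OnBoundary v (walk d) → ∃[ d′ ] (tail d′ ≡ v × walk d′ ≡ walk d)
  on-walk (inj₁ x) = x
  on-walk {v} {d} (inj₂ (i , e)) = contradiction e (isoB-walk v d i)

  some-boundary : ∀ v → ∃[ b ] OnBoundary v b
  some-boundary v with any? (λ d → tail d ≟ v)
  ... | yes (d , e) = walk d , inj₁ (d , e , refl)
  ... | no none = isoB v , inj₂ ((λ d e → none (d , e)) , refl)

  -- `b` is the boundary by which the component is attached. It is exempt from `others` because its
  -- face may already contain vertices of other components.
  record ComponentColouring (b : Fin B) (col : Fin n → ℕ) : Set where
    field
      range  : ∀ v → 1 ≤ col v × col v ≤ 4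
      proper : ∀ d → comp (tail d) ≡ bcomp b → col (tail d) ≢ col (hd d)
      others : ∀ b′ → bcomp b′ ≡ bcomp b → b′ ≢ b → Peak col (_≡ b′)

  -- Two ways to attach a component: with its own 4 on `b`, or with `b` kept below 4 for a face that
  -- already has one.
  Topped Lowered : Fin B → Set
  Topped b = ∃[ col ] (ComponentColouring b col × Peak col (_≡ b) × ∃[ v ] (OnBoundary v b × col v ≡ 4))
  Lowered b = ∃[ col ] (ComponentColouring b col × (∀ v → OnBoundary v b → col v ≤ 3))

  module AtWalk (ω : Fin m) where
    κ : Fin c
    κ = comp (tail ω)
    open Component G star-forest κ ω refl

    κ-eq : bcomp (walk ω) ≡ κ
    κ-eq = bcomp-walk ω

    elsewhere? : ∀ v → Dec (comp v ≢ κ)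
    elsewhere? v = ¬? (comp v ≟ κ)

    U₀ : VSet
    U₀ = dec-∪ (λ _ → false) elsewhere?

    dead₀ : ∀ {v} → Dead U₀ v → comp v ≢ κ
    dead₀ t with ∪-true⁻ {U = λ _ → false} elsewhere? t
    ... | inj₂ x = x

    live₀ : ∀ {v} → comp v ≡ κ → Live U₀ v
    live₀ e = ∪-false⁺ {U = λ _ → false} elsewhere? refl (λ ne → ne e)

    C₀ : Cfg U₀
    C₀ = record { outside = λ v ne → ∪-trueʳ {U = λ _ → false} elsewhere? ne ; dead-white = λ d t e →
        contradiction e (dead₀ t) }

    untouched : ∀ {d} → comp (tail d) ≡ κ → ¬ Touch U₀ d
    untouched e (inj₁ t) = dead₀ t e
    untouched {d} e (inj₂ t) = dead₀ t (trans (sym (comp-hd d)) e)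

    white₀ : ∀ {d} → White U₀ d → walk ω ≡ walk d
    white₀ w = only w
      where
      only : ∀ {b} → Star (Step U₀) (walk ω) b → walk ω ≡ b
      only ε = refl
      only ((d , t , e , _) ◅ _) = contradiction t (untouched (comp-walk (sym e)))

    dart-comp : ∀ {b′ d} → bcomp b′ ≡ bcomp (walk ω) → walk d ≡ b′ → comp (tail d) ≡ κ
    dart-comp {d = d} e refl = trans (sym (bcomp-walk d)) (trans e κ-eq)

    from-walk : ∀ {col d} → UniqueMax col (walk d) → Peak col (_≡ walk d)
    from-walk {col} (d₀ , e , h) = tail d₀ , (walk d₀ , e , inj₁ (d₀ , refl , refl)) , λ w → λ where
      (_ , refl , o) → case on-walk o of λ { (d′ , refl , q) → h d′ q }

    all-walks : ∀ {b′} → bcomp b′ ≡ bcomp (walk ω) → ∃[ d ] walk d ≡ b′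
    all-walks {b′} e with bnd-surj b′
    ... | inj₁ x = x
    ... | inj₂ (v , i , refl) = contradiction (sym (isolated-alone i (trans (sym (bcomp-iso v i)) (trans e κ-eq)))) (i ω)

    -- With nothing of the component deleted, the white region is the facial walk of `ω` alone,
    -- which therefore stays below 4.
    lowered : Lowered (walk ω)
    lowered with solve C₀
    ... | col , g = col , record
          { range = Good.range g
          ; proper = λ d e → Good.proper g d (live₀ (trans e κ-eq) , live₀ (trans (sym (comp-hd d)) (trans e κ-eq)))
          ; others = λ b′ e ne → case all-walks e of λ { (d , refl) → from-walk (Good.maxima g d
              ((λ w → ne (sym (white₀ w))) , live₀ (dart-comp e refl))) }
          } , low
      where
      low : ∀ v → OnBoundary v (walk ω) → col v ≤ 3
      low v o with on-walk o
      ... | d , refl , q = Good.low g d (live₀ (dart-comp refl q)) (white-walk {U₀} (sym q) ε)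

    top? : ∀ v → Dec (v ≡ tail ω)
    top? v = v ≟ tail ω

    U₁ : VSet
    U₁ = dec-∪ U₀ top?

    s₁ : U₀ ⊑ U₁
    s₁ = ⊑-∪ top?

    top-dead : Dead U₁ (tail ω)
    top-dead = ∪-trueʳ {U = U₀} top? refl

    new-dead : ∀ {v} → comp v ≡ κ → Dead U₁ v → v ≡ tail ω
    new-dead e t with ∪-true⁻ {U = U₀} top? t
    ... | inj₁ x = contradiction e (dead₀ x)
    ... | inj₂ x = x

    C₁ : Cfg U₁
    C₁ = extend C₀ s₁ λ v l t → case new-dead (Cfg.live-in C₀ l) t of λ { refl → ω , refl , ε }

    -- The colouring is found after deleting `tail ω`, which then gets 4 and is the only maximum on
    -- all faces around it.
    topped : Topped (walk ω)
    topped with solve C₁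
    ... | col′ , g = col , record { range = rng ; proper = λ d e → pr d (trans e κ-eq) ; others = λ b′ e _ → peak b′ e } ,
          peak (walk ω) refl , tail ω , inj₁ (ω , refl , refl) , col-top refl
      where
      col : Fin n → ℕ
      col v = if does (top? v) then 4 else col′ v
      col-top : ∀ {v} → v ≡ tail ω → col v ≡ 4
      col-top {v} e rewrite dec-true (top? v) e = refl
      col-live : ∀ {v} → Live U₁ v → col′ v ≡ col v
      col-live {v} l rewrite dec-false (top? v) (proj₂ (∪-false⁻ {U = U₀} top? l)) = refl
      rng : ∀ v → 1 ≤ col v × col v ≤ 4
      rng v with top? v
      ... | yes _ = s≤s z≤n , ≤-refl
      ... | no _ = Good.range g v
      not-4 : ∀ {x} → x ≤ 3 → 4 ≢ x
      not-4 le refl = 1+n≰n le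
      low : ∀ d → Live U₁ (tail d) → White U₁ d → col (tail d) ≤ 3
      low d l w = subst (_≤ 3) (col-live l) (Good.low g d l w)
      top-white : ∀ {d} → tail d ≡ tail ω → White U₁ d
      top-white e = spread C₀ s₁ (sym e) top-dead ε
      top-edge : ∀ d → comp (tail d) ≡ κ → tail d ≡ tail ω → col (tail d) ≢ col (hd d)
      top-edge d k e with live-or-dead U₁ (hd d)
      ... | inj₁ l = λ q → not-4 (low (α d) l (white-across {U₁} (inj₁ (subst (Dead U₁) (sym e) top-dead)) (top-white e)))
                             (trans (sym (col-top e)) q)
      ... | inj₂ t = contradiction (trans (new-dead (trans (sym (comp-hd d)) k) t) (sym e)) (noLoop d)
      pr : ∀ d → comp (tail d) ≡ κ → col (tail d) ≢ col (hd d)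
      pr d k with live-or-dead U₁ (tail d) | live-or-dead U₁ (hd d)
      ... | inj₂ t | _ = top-edge d k (new-dead k t)
      ... | inj₁ _ | inj₂ t = λ q → top-edge (α d) (trans (sym (comp-hd d)) k) (new-dead (trans (sym (comp-hd d)) k) t)
                                (trans (sym q) (cong col (sym (hd-α d))))
      ... | inj₁ l | inj₁ l′ = λ q → Good.proper g d (l , l′) (trans (col-live l) (trans q (sym (col-live l′))))
      top-peak : ∀ d d₀ → comp (tail d) ≡ κ → walk d₀ ≡ walk d → tail d₀ ≡ tail ω → UniqueMax col (walk d)
      top-peak d d₀ k e q = d₀ , e , at
        where
        at : ∀ d′ → walk d′ ≡ walk d → col (tail d′) ≤ col (tail d₀) × (col (tail d′) ≡ col (tail d₀) → tail d′ ≡ tail d₀)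
        at d′ r with live-or-dead U₁ (tail d′)
        ... | inj₂ t = let z = trans (new-dead (trans (comp-walk r) k) t) (sym q) in ≤-reflexive (cong col z) , λ _ → z
        ... | inj₁ l = subst (_ ≤_) (sym (col-top q)) (m≤n⇒m≤1+n le) , λ z →
            contradiction (trans (sym (col-top q)) (sym z)) (not-4 le)
          where
          le : col (tail d′) ≤ 3
          le = low d′ l (white-walk {U₁} (trans e (sym r)) (top-white q))
      peak-dart : ∀ d → comp (tail d) ≡ κ → UniqueMax col (walk d)
      peak-dart d k with white? U₁ d
      ... | no ¬w = unique-max-cong col′ col (λ d′ q → col-live (proj₂ (gray-walk C₁ (sym q) (¬w , not-white-live C₁ k ¬w))))
                      (Good.maxima g d (¬w , not-white-live C₁ k ¬w))
      ... | yes w with new-white C₀ s₁ w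
      ...   | inj₁ w₀ = top-peak d ω k (white₀ w₀) refl
      ...   | inj₂ (d₁ , e , l , t) = top-peak d d₁ k e (new-dead (Cfg.live-in C₀ l) t)
      peak : ∀ b′ → bcomp b′ ≡ bcomp (walk ω) → Peak col (_≡ b′)
      peak b′ e with all-walks e
      ... | d , refl = from-walk (peak-dart d (dart-comp e refl))

  module AtIsolated (v : Fin n) (i : Isolated rot v) where

    only-boundary : ∀ b′ → bcomp b′ ≡ bcomp (isoB v) → b′ ≡ isoB v
    only-boundary b′ e with bnd-surj b′
    ... | inj₁ (d , refl) = contradiction
        (sym (isolated-alone i (trans (sym (bcomp-iso v i)) (trans (sym e) (bcomp-walk d))))) (i d)
    ... | inj₂ (u , iu , refl) = cong isoB (isolated-alone iu (trans (sym (bcomp-iso u iu)) (trans e (bcomp-iso v i))))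

    only-vertex : ∀ {u} → OnBoundary u (isoB v) → u ≡ v
    only-vertex (inj₁ (d , _ , e)) = contradiction (sym e) (isoB-walk v d i)
    only-vertex {u} (inj₂ (iu , e)) = isoB-inj u v iu i e

    constant : ∀ k → 1 ≤ k → k ≤ 4 → ComponentColouring (isoB v) (λ _ → k)
    constant k p q = record
      { range = λ _ → p , q
      ; proper = λ d e → contradiction (sym (isolated-alone i (trans (sym (bcomp-iso v i)) (sym e)))) (i d)
      ; others = λ b′ e ne → contradiction (only-boundary b′ e) ne }

    topped : Topped (isoB v)
    topped = (λ _ → 4) , constant 4 (s≤s z≤n) ≤-refl ,
      (v , (isoB v , refl , inj₂ (i , refl)) , (λ { w (_ , refl , o) → ≤-refl , λ _ → only-vertex o })) , v ,
          inj₂ (i , refl) , refl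

    lowered : Lowered (isoB v)
    lowered = (λ _ → 1) , constant 1 ≤-refl (s≤s z≤n) , λ _ _ → s≤s z≤n

  topped : ∀ b → Topped b
  topped b with bnd-surj b
  ... | inj₁ (ω , refl) = AtWalk.topped ω
  ... | inj₂ (v , i , refl) = AtIsolated.topped v i

  lowered : ∀ b → Lowered b
  lowered b with bnd-surj b
  ... | inj₁ (ω , refl) = AtWalk.lowered ω
  ... | inj₂ (v , i , refl) = AtIsolated.lowered v i

  -- A subtree of the tree of components and faces, with a colouring of its components.
  record Grown : Set where
    field
      comps  : Fin c → Bool
      faces  : Fin F → Bool
      used   : Fin B → Bool
      col    : Fin n → ℕ
      f₀     : Fin F
      root   : faces f₀ ≡ true
      -- A tree has one node more than edges; at the end this forces every boundary to be used.
      balance   : count comps + count faces ≡ suc (count used)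
      ends   : ∀ {b} → used b ≡ true → comps (bcomp b) ≡ true × faces (face b) ≡ true
      range  : ∀ v → 1 ≤ col v × col v ≤ 4
      proper : ∀ d → comps (comp (tail d)) ≡ true → col (tail d) ≢ col (hd d)
      alone  : ∀ {b} → used b ≡ false → comps (bcomp b) ≡ true → Peak col (_≡ b)
      joint  : ∀ {b} → used b ≡ true → Peak col (InFace used (face b))

  Larger : Grown → Set
  Larger S = Σ Grown λ S′ → count (Grown.used S′) ≡ suc (count (Grown.used S))

  -- `b` is the only used boundary of the new face, so the maximum that `b` has by itself serves the
  -- face.
  add-face : (S : Grown) (b : Fin B) → Grown.comps S (bcomp b) ≡ true → Grown.faces S (face b) ≡ false →
             Larger S
  add-face S b cb fb = record
    { comps = comps ; faces = faces′ ; used = used′ ; col = col ; f₀ = f₀ ; root = insert-old faces (face b) root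
    ; balance = trans (cong (count comps +_) (count-insert faces (face b) fb))
        (trans (+-suc _ _) (cong suc (trans balance (sym count-used))))
    ; ends = ends′ ; range = range ; proper = proper
    ; alone = λ {b′} u k → alone (proj₁ (unused u)) k
    ; joint = joint′ } , count-used
    where
    open Grown S
    faces′ : Fin F → Bool
    faces′ = insert faces (face b)
    used′ : Fin B → Bool
    used′ = insert used b
    ub : used b ≡ false
    ub with bool-cases (used b)
    ... | inj₂ u = u
    ... | inj₁ u = contradiction (trans (sym fb) (proj₂ (ends u))) λ ()
    count-used : count used′ ≡ suc (count used)
    count-used = count-insert used b ub
    unused : ∀ {b′} → used′ b′ ≡ false → used b′ ≡ false × b′ ≢ b
    unused = ∪-false⁻ {U = used} (_≟ b)
    ends′ : ∀ {b′} → used′ b′ ≡ true → comps (bcomp b′) ≡ true × faces′ (face b′) ≡ true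
    ends′ u with insert-inv used b u
    ... | inj₁ u′ = proj₁ (ends u′) , insert-old faces (face b) (proj₂ (ends u′))
    ... | inj₂ refl = cb , insert-self faces (face b)
    joint′ : ∀ {b₁} → used′ b₁ ≡ true → Peak col (InFace used′ (face b₁))
    joint′ {b₁} u with insert-inv used b u
    ... | inj₂ refl = peak-iff (λ { (_ , refl , o) → b , (insert-self used b , refl) , o }) only (alone ub cb)
      where
      only : ∀ {v} → On (InFace used′ (face b)) v → On (_≡ b) v
      only (b′ , (u′ , e) , o) with insert-inv used b u′
      ... | inj₂ refl = b , refl , o
      ... | inj₁ u″ = contradiction (trans (sym fb) (trans (cong faces (sym e)) (proj₂ (ends u″)))) λ ()
    ... | inj₁ u₁ = peak-iff (λ { (b′ , (u′ , e) , o) → b′ , (insert-old used b u′ , e) , o }) only (joint u₁)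
      where
      only : ∀ {v} → On (InFace used′ (face b₁)) v → On (InFace used (face b₁)) v
      only (b′ , (u′ , e) , o) with insert-inv used b u′
      ... | inj₁ u″ = b′ , (u″ , e) , o
      ... | inj₂ refl = contradiction (trans (sym fb) (trans (cong faces e) (proj₂ (ends u₁)))) λ ()

  module AddComponent (S : Grown) (b : Fin B) (fb : Grown.faces S (face b) ≡ true) (cb : Grown.comps S (bcomp b) ≡ false)
    (colₖ : Fin n → ℕ) (colouring : ComponentColouring b colₖ) where
    open Grown S
    module K = ComponentColouring colouring

    k : Fin c
    k = bcomp b
    comps′ : Fin c → Bool
    comps′ = insert comps k
    used′ : Fin B → Bool
    used′ = insert used b

    ub : used b ≡ false
    ub with bool-cases (used b)
    ... | inj₂ u = u
    ... | inj₁ u = contradiction (trans (sym cb) (proj₁ (ends u))) λ ()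

    count-used : count used′ ≡ suc (count used)
    count-used = count-insert used b ub

    col′ : Fin n → ℕ
    col′ v = if does (comp v ≟ k) then colₖ v else col v

    col-new : ∀ {v} → comp v ≡ k → colₖ v ≡ col′ v
    col-new {v} e rewrite dec-true (comp v ≟ k) e = refl

    col-old : ∀ {v} → comp v ≢ k → col v ≡ col′ v
    col-old {v} ne rewrite dec-false (comp v ≟ k) ne = refl

    old≢k : ∀ {j} → comps j ≡ true → j ≢ k
    old≢k t refl = contradiction (trans (sym cb) t) λ ()

    old-on : ∀ {v b′} → used b′ ≡ true → OnBoundary v b′ → col v ≡ col′ v
    old-on u o = col-old (λ e → old≢k (proj₁ (ends u)) (trans (sym (on-comp o)) e))

    new-on : ∀ {v b′} → bcomp b′ ≡ k → OnBoundary v b′ → colₖ v ≡ col′ v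
    new-on e o = col-new (trans (on-comp o) e)

    Here : Fin B → Set
    Here = InFace used (face b)

    grown : Peak col′ (InFace used′ (face b)) → Larger S
    grown here-peak = record
      { comps = comps′ ; faces = faces ; used = used′ ; col = col′ ; f₀ = f₀ ; root = root
      ; balance = trans (cong (_+ count faces) (count-insert comps k cb)) (cong suc (trans balance (sym count-used)))
      ; ends = ends′ ; range = range′ ; proper = proper′ ; alone = alone′ ; joint = joint′ } , count-used
      where
      ends′ : ∀ {b′} → used′ b′ ≡ true → comps′ (bcomp b′) ≡ true × faces (face b′) ≡ true
      ends′ u with insert-inv used b u
      ... | inj₁ u′ = insert-old comps k (proj₁ (ends u′)) , proj₂ (ends u′)
      ... | inj₂ refl = insert-self comps k , fb
      range′ : ∀ v → 1 ≤ col′ v × col′ v ≤ 4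
      range′ v with comp v ≟ k
      ... | yes _ = K.range v
      ... | no _ = range v
      proper′ : ∀ d → comps′ (comp (tail d)) ≡ true → col′ (tail d) ≢ col′ (hd d)
      proper′ d t q = go (comp (tail d) ≟ k) (insert-inv comps k t)
        where
        ce : comp (tail d) ≡ comp (hd d)
        ce = comp-adj _ _ (d , refl , refl)
        go : Dec (comp (tail d) ≡ k) → comps (comp (tail d)) ≡ true ⊎ comp (tail d) ≡ k → ⊥
        go (yes e) _ = K.proper d e (trans (col-new e) (trans q (sym (col-new (trans (sym ce) e)))))
        go (no ne) (inj₁ t′) = proper d t′ (trans (col-old ne) (trans q (sym (col-old (λ e → ne (trans ce e))))))
        go (no ne) (inj₂ e) = ne e
      alone′ : ∀ {b′} → used′ b′ ≡ false → comps′ (bcomp b′) ≡ true → Peak col′ (_≡ b′)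
      alone′ {b′} u t = go (∪-false⁻ {U = used} (_≟ b) u) (bcomp b′ ≟ k) (insert-inv comps k t)
        where
        go : used b′ ≡ false × b′ ≢ b → Dec (bcomp b′ ≡ k) → comps (bcomp b′) ≡ true ⊎ bcomp b′ ≡ k → Peak col′ (_≡ b′)
        go (_ , ne) (yes e) _ = peak-cong {colₖ} {col′} (λ { v (_ , refl , o) → new-on e o }) (K.others b′ e ne)
        go (u₀ , _) (no ne′) (inj₁ t′) = peak-cong {col} {col′}
            (λ { v (_ , refl , o) → col-old (λ q → ne′ (trans (sym (on-comp o)) q)) }) (alone u₀ t′)
        go _ (no ne′) (inj₂ e) = contradiction e ne′
      joint′ : ∀ {b₁} → used′ b₁ ≡ true → Peak col′ (InFace used′ (face b₁))
      joint′ {b₁} u with face b₁ ≟ face b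
      ... | yes e = peak-iff (λ { (b′ , (u′ , q) , o) → b′ , (u′ , trans q (sym e)) , o })
                             (λ { (b′ , (u′ , q) , o) → b′ , (u′ , trans q e) , o }) here-peak
      ... | no ne with insert-inv used b u
      ...   | inj₂ refl = contradiction refl ne
      ...   | inj₁ u₁ = peak-cong (λ { v (b′ , (u′ , e) , o) → old-on (old u′ e) o })
                (peak-iff (λ { (b′ , (u′ , e) , o) → b′ , (insert-old used b u′ , e) , o })
                          (λ { (b′ , (u′ , e) , o) → b′ , (old u′ e , e) , o }) (joint u₁))
        where
        old : ∀ {b′} → used′ b′ ≡ true → face b′ ≡ face b₁ → used b′ ≡ true
        old u′ e with insert-inv used b u′
        ... | inj₁ x = x
        ... | inj₂ refl = contradiction (sym e) ne

    not-4 : ∀ {x} → x ≤ 3 → 4 ≢ x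
    not-4 le refl = 1+n≰n le

    keep-top : (∀ v → OnBoundary v b → colₖ v ≤ 3) → ∀ v → On Here v → col v ≡ 4 →
        (∀ w → On Here w → col w ≡ col v → w ≡ v) →
               Peak col′ (InFace used′ (face b))
    keep-top low v (b₁ , (u₁ , e₁) , o₁) v4 unique = v , (b₁ , (insert-old used b u₁ , e₁) , o₁) , at
      where
      v4′ : col′ v ≡ 4
      v4′ = trans (sym (old-on u₁ o₁)) v4
      at : ∀ w → On (InFace used′ (face b)) w → col′ w ≤ col′ v × (col′ w ≡ col′ v → w ≡ v)
      at w (b′ , (u′ , e) , o) with insert-inv used b u′
      ... | inj₁ u = subst₂ _≤_ (old-on u o) (sym v4′) (proj₂ (range w)) ,
                     λ q → unique w (b′ , (u , e) , o) (trans (old-on u o) (trans q (sym (old-on u₁ o₁))))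
      ... | inj₂ refl = subst₂ _≤_ (new-on refl o) (sym v4′) (m≤n⇒m≤1+n (low w o)) ,
                     λ q → contradiction (trans (sym v4′) (trans (sym q) (sym (new-on refl o)))) (not-4 (low w o))

    new-top : Peak colₖ (_≡ b) → ∀ v → OnBoundary v b → colₖ v ≡ 4 → (∀ w → On Here w → col w ≤ 3) →
              Peak col′ (InFace used′ (face b))
    new-top (m₀ , (_ , refl , om) , h) v ov v4 low = v , (b , (insert-self used b , refl) , ov) , at
      where
      v4′ : col′ v ≡ 4
      v4′ = trans (sym (new-on refl ov)) v4
      m4 : colₖ m₀ ≡ 4
      m4 = ≤-antisym (proj₂ (K.range m₀)) (subst (_≤ colₖ m₀) v4 (proj₁ (h v (b , refl , ov))))
      -- Colour 4 is the top of the range, so the vertex that carries it is the peak of `b`.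
      v≡m : v ≡ m₀
      v≡m = proj₂ (h v (b , refl , ov)) (trans v4 (sym m4))
      at : ∀ w → On (InFace used′ (face b)) w → col′ w ≤ col′ v × (col′ w ≡ col′ v → w ≡ v)
      at w (b′ , (u′ , e) , o) with insert-inv used b u′
      ... | inj₁ u = subst₂ _≤_ (old-on u o) (sym v4′) (m≤n⇒m≤1+n (low w (b′ , (u , e) , o))) ,
                     λ q → contradiction (trans (sym v4′) (trans (sym q) (sym (old-on u o))))
                         (not-4 (low w (b′ , (u , e) , o)))
      ... | inj₂ refl = subst₂ _≤_ (new-on refl o) (sym v4′) (proj₂ (K.range w)) ,
                     λ q → trans (proj₂ (h w (b , refl , o)) (trans (new-on refl o) (trans q (trans v4′ (sym m4)))))
                         (sym v≡m)

  -- The new component has a 4 on its boundary b unless the face has one already.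
  add-component : (S : Grown) (b : Fin B) → Grown.faces S (face b) ≡ true → Grown.comps S (bcomp b) ≡ false →
                  Larger S
  add-component S b fb cb with any? (λ b′ → (Grown.used S b′ ≟ᵇ true) ×-dec (face b′ ≟ face b))
  ... | no none = fresh (topped b)
    where
    fresh : Topped b → Larger S
    fresh (colₖ , cc , pk , v , ov , v4) = A.grown (A.new-top pk v ov v4 λ { w (b′ , x , _) → contradiction (b′ , x) none })
      where module A = AddComponent S b fb cb colₖ cc
  ... | yes (b₁ , u₁ , e₁) = by-peak (subst (λ f → Peak (Grown.col S) (InFace (Grown.used S) f)) e₁ (Grown.joint S u₁))
    where
    by-peak : Peak (Grown.col S) (InFace (Grown.used S) (face b)) → Larger S
    by-peak (v , o , h) with Grown.col S v ≟ⁿ 4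
    ... | yes v4 = use (lowered b)
      where
      use : Lowered b → Larger S
      use (colₖ , cc , low) = A.grown (A.keep-top low v o v4 λ w ow → proj₂ (h w ow))
        where module A = AddComponent S b fb cb colₖ cc
    ... | no ¬4 = use (topped b)
      where
      use : Topped b → Larger S
      use (colₖ , cc , pk , v′ , ov , v4) = A.grown (A.new-top pk v′ ov v4 λ w ow →
          ≤-trans (proj₁ (h w ow)) (≤-pred (≤∧≢⇒< (proj₂ (Grown.range S v)) ¬4)))
        where module A = AddComponent S b fb cb colₖ cc

  -- By connectivity some edge of the tree leaves the part reached so far, and its direction tells
  -- which kind of node to add.
  grow : (S : Grown) → (∃[ i ] Grown.comps S i ≡ false) ⊎ (∃[ f ] Grown.faces S f ≡ false) →
         Larger S
  grow S missing = cross (star-exit reached? (tree-conn (inj₂ f₀) (proj₁ target)) root (proj₂ target))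
    where
    open Grown S
    Reached : Fin c ⊎ Fin F → Set
    Reached (inj₁ i) = comps i ≡ true
    Reached (inj₂ f) = faces f ≡ true
    reached? : ∀ x → Dec (Reached x)
    reached? (inj₁ i) = comps i ≟ᵇ true
    reached? (inj₂ f) = faces f ≟ᵇ true
    not-true : ∀ {x} → x ≡ false → ¬ x ≡ true
    not-true refl ()
    to-false : ∀ {x} → ¬ x ≡ true → x ≡ false
    to-false {x} h with bool-cases x
    ... | inj₁ t = contradiction t h
    ... | inj₂ f = f
    target : ∃[ x ] ¬ Reached x
    target = case missing of λ { (inj₁ (i , e)) → inj₁ i , not-true e ; (inj₂ (f , e)) → inj₂ f , not-true e }
    cross : ∃₂ (λ u v → BipEdge bcomp face u v × Reached u × ¬ Reached v) → Larger S
    cross (_ , _ , (b , inj₁ (refl , refl)) , p , q) = add-face S b p (to-false q)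
    cross (_ , _ , (b , inj₂ (refl , refl)) , p , q) = add-component S b p (to-false q)

  everything : ∀ k (S : Grown) → B ≤ k + count (Grown.used S) → Σ Grown λ S′ → ∀ b → Grown.used S′ b ≡ true
  everything zero S h = S , count-full (Grown.used S) h
  everything (suc k) S h with any? (λ i → Grown.comps S i ≟ᵇ false) | any? (λ f → Grown.faces S f ≟ᵇ false)
  ... | yes x | _ = let S′ , e = grow S (inj₁ x) in
                    everything k S′ (subst (B ≤_) (trans (sym (+-suc k _)) (cong (k +_) (sym e))) h)
  ... | no _ | yes y = let S′ , e = grow S (inj₂ y) in
                    everything k S′ (subst (B ≤_) (trans (sym (+-suc k _)) (cong (k +_) (sym e))) h)
  ... | no all-c | no all-f = S , count-full (Grown.used S) (≤-reflexive (suc-injective (begin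
      suc B                          ≡⟨ +-comm 1 B ⟩
      B + 1                          ≡⟨ tree-count ⟩
      c + F                          ≡⟨ sym (cong₂ _+_ (count-all (full all-c)) (count-all (full all-f))) ⟩
      count (Grown.comps S) + count (Grown.faces S) ≡⟨ Grown.balance S ⟩
      suc (count (Grown.used S))     ∎)))
    where
    open ≡-Reasoning
    full : ∀ {N} {V : Fin N → Bool} → ¬ (∃[ i ] V i ≡ false) → ∀ i → V i ≡ true
    full {V = V} h i with bool-cases (V i)
    ... | inj₁ t = t
    ... | inj₂ f = contradiction (i , f) h

  v₀ : Fin n
  v₀ = fromℕ< nonempty

  -- A single face is a tree without edges, and it owes no maximum while none of its boundaries is
  -- used.
  seed : Grown
  seed = record
    { comps = λ _ → false ; faces = insert (λ _ → false) f ; used = λ _ → false ; col = λ _ → 1 ; f₀ = f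
    ; root = insert-self (λ _ → false) f
    ; balance = trans (cong₂ _+_ (count-none c) (count-insert (λ _ → false) f refl))
                   (cong suc (trans (count-none F) (sym (count-none B))))
    ; ends = λ () ; range = λ _ → s≤s z≤n , s≤s z≤n ; proper = λ _ () ; alone = λ _ () ; joint = λ () }
    where
    f : Fin F
    f = face (proj₁ (some-boundary v₀))

  -- A tree path from `f` to a component begins with a boundary of `f`.
  face-boundary : ∀ f → ∃[ b ] face b ≡ f
  face-boundary f with tree-conn (inj₂ f) (inj₁ (comp v₀))
  ... | (b , inj₂ (refl , _)) ◅ _ = b , refl

  to-incident : ∀ {v b} → OnBoundary v b → Incident G v (face b)
  to-incident (inj₁ (d , e , refl)) = inj₁ (d , e , refl)
  to-incident (inj₂ (i , refl)) = inj₂ (i , refl)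

  from-incident : ∀ {v f} → Incident G v f → ∃[ b ] (face b ≡ f × OnBoundary v b)
  from-incident (inj₁ (d , e , q)) = walk d , q , inj₁ (d , e , refl)
  from-incident (inj₂ (i , q)) = isoB _ , q , inj₂ (i , refl)

  colouring : ∃[ col ] IsFUMColoring G 4 col
  colouring with everything B seed (m≤m+n B _)
  ... | S , all = col , range , (λ { _ _ (d , refl , refl) → proper d (reached (tail d)) }) , faces-ok
    where
    open Grown S
    reached : ∀ v → comps (comp v) ≡ true
    reached v with some-boundary v
    ... | b , o = subst (λ k → comps k ≡ true) (sym (on-comp o)) (proj₁ (ends (all b)))
    faces-ok : ∀ f → ∃[ v ] (Incident G v f × (∀ w → Incident G w f → col w ≤ col v) ×
        (∀ w → Incident G w f → col w ≡ col v → w ≡ v))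
    faces-ok f with face-boundary f
    ... | b , refl with joint (all b)
    ...   | v , (b′ , (_ , e) , o) , h = v , subst (Incident G v) e (to-incident o) ,
            (λ w i → proj₁ (h w (on w i))) , λ w i → proj₂ (h w (on w i))
      where
      on : ∀ w → Incident G w (face b) → On (InFace used (face b)) w
      on w i with from-incident i
      ... | b″ , q , o″ = b″ , (all b″ , q) , o″

theorem2 : (G : PlaneGraph) → XStarForest G →
    ∃[ col ] IsFUMColoring G 4 col
theorem2 G star-forest = Assembly.colouring G star-forest
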